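{- Let $b>1$ be an integer and $w$ a non-empty word over $\{0,\dots,b-1\}$, with associated point $x_w$, $R_w=\max(x_w,1-x_w)$, and monic eigenpolynomials $(\mathcal B_m)_{m\ge0}$. For any $R>R_w$, the normalized eigenpolynomials $(R^{ -m}\mathcal B_m)_{m\ge0}$ are exponentially close in $\mathcal H_R$-norm, as $m\to\infty$, to the normalized monomials $e_m(z)=(z-x_w)^m/R^m$ giving the canonical orthonormal basis of $\mathcal H_R$ (i.e. there are $C<\infty$ and $\theta<1$ with $\|R^{ -m}\mathcal B_m-e_m\|_{\mathcal H_R}\le C\theta^m$ for all $m$). Moreover $(R^{ -m}\mathcal B_m)_{m\ge0}$ is a Riesz basis of $\mathcal H_R$.
   Context: $\mathcal H_R=H^2(D(x_w,R))$ is the Hardy space of the open disk of center $x_w$ and radius $R$, normed so that the $e_m$, $m\geq0$, form an orthonormal basis. Words are finite sequences (possibly empty) of digits in $\{0,\dots,b-1\}$; $|g|$ is the length of $g$; $n(g)$ is the integer represented by $g$ in base $b$ (most significant digit on the left); $x(g)=n(g)b^{ -|g|}$; for an infinite digit sequence, $x(d_1d_2\dots)=\sum_id_ib^{ -i}$. $k_w(g)$ is the number of occurrences (with overlaps) of $w$ in $g$ as a block of consecutive digits, and $k_w^+(g)=k_w(wg)-1$. $\mathcal G$ is the set of non-empty words $g$ with $k_w^+(g)=1$ and $k_w^+(g^-)=0$, where $g^-$ is $g$ with its last digit deleted. $\lambda_n(w)=\sum_{g\in\mathcal G}b^{ -n|g|}$ for $n\ge1$ (these are distinct, $\lambda_1(w)=1$).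 On functions, $(\mathsf K_wf)(x)=\sum_{g\in\mathcal G}b^{ -|g|}f(x(g)+b^{ -|g|}x)$; $\mathcal B_m$ is the unique monic polynomial of degree $m$ with $\mathsf K_w\mathcal B_m=\lambda_{m+1}(w)\mathcal B_m$. $g_w$ is the (unique) shortest word of $\mathcal G$, and $x_w=x(g_wg_wg_w\cdots)\in[0,1]$. A Riesz basis of a Hilbert space is the image of an orthonormal basis under a bounded invertible operator. -}

module Defs where

open import Algebra.Apartness.Bundles using (HeytingField)
open import Algebra.Bundles.Raw using (RawRing)
import Algebra.Definitions.RawSemiring as RawSemiringDefs
open import Data.Empty using (⊥-elim)
open import Data.Fin.Base using (Fin; toℕ)
import Data.Fin.Properties as Fin
open import Data.List.Base
  using (List; []; _∷_; _++_; length; lookup; take; tails; filter; foldl; foldr; upTo; allFin)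
open import Data.List.Relation.Binary.Prefix.Heterogeneous.Properties using (prefix?)
open import Data.List.Relation.Binary.Subset.Propositional using (_⊆_)
open import Data.List.Relation.Unary.All using (All)
open import Data.List.Relation.Unary.Unique.Propositional using (Unique)
open import Data.Nat.Base as ℕ using (ℕ; zero; suc)
open import Data.Nat.DivMod using (_mod_)
import Data.Nat.Properties as ℕ
open import Data.Product.Base using (Σ; Σ-syntax; ∃-syntax; _×_; _,_; proj₁; proj₂)
open import Data.Sum.Base using (_⊎_; inj₁; inj₂; [_,_]′)
open import Level using (Level; _⊔_) renaming (suc to lsuc)
open import Relation.Binary.Core using (Rel)
open import Relation.Binary.PropositionalEquality using (_≡_; _≢_; refl)
open import Relation.Binary.Structures using (IsStrictPartialOrder)
open import Relation.Nullary using (¬_; yes; no)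

-- Cauchy-complete Archimedean ordered fields.  Classically ℝ is, up to unique
-- isomorphism, the only one.  The axioms are phrased so that they also hold
-- constructively, e.g. for Bishop's reals: ≤ is the negation of the converse
-- of <, apartness is x < y or y < x, and the binary maximum is characterised
-- by ∨-upperˡ, ∨-upperʳ and ∨-least.

record RealField c ℓ₁ ℓ₂ : Set (lsuc (c ⊔ ℓ₁ ⊔ ℓ₂)) where
  field
    heytingField : HeytingField c ℓ₁ ℓ₂
  open HeytingField heytingField public
  infix 4 _<_ _≤_
  infixl 6 _∨_
  field
    _<_                  : Rel Carrier ℓ₂
    isStrictPartialOrder : IsStrictPartialOrder _≈_ _<_
    #⇒<⊎>                : ∀ {x y} → x # y → x < y ⊎ y < x
    <⇒#                  : ∀ {x y} → x < y → x # y
    0<1                  : 0# < 1#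
    +-monoˡ-<            : ∀ {x y} z → x < y → x + z < y + z
    *-pos                : ∀ {x y} → 0# < x → 0# < y → 0# < x * y

  _≤_ : Rel Carrier ℓ₂
  x ≤ y = ¬ (y < x)

  field
    _∨_      : Carrier → Carrier → Carrier
    ∨-upperˡ : ∀ x y → x ≤ x ∨ y
    ∨-upperʳ : ∀ x y → y ≤ x ∨ y
    ∨-least  : ∀ {x y z} → z < x ∨ y → z < x ⊎ z < y

  ∣_∣ : Carrier → Carrier
  ∣ x ∣ = x ∨ (- x)

  rawRing : RawRing c ℓ₁
  rawRing = record
    { Carrier = Carrier ; _≈_ = _≈_ ; _+_ = _+_ ; _*_ = _*_ ; -_ = -_ ; 0# = 0# ; 1# = 1# }

  open RawSemiringDefs (RawRing.rawSemiring rawRing) public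
    using (_^_) renaming (_×_ to _·_)

  fromℕ : ℕ → Carrier
  fromℕ n = n · 1#

  Cauchy : (ℕ → Carrier) → Set (c ⊔ ℓ₂)
  Cauchy s = ∀ ε → 0# < ε → ∃[ N ] (∀ m n → N ℕ.≤ m → N ℕ.≤ n → ∣ s m - s n ∣ < ε)

  Limit : (ℕ → Carrier) → Carrier → Set (c ⊔ ℓ₂)
  Limit s l = ∀ ε → 0# < ε → ∃[ N ] (∀ n → N ℕ.≤ n → ∣ s n - l ∣ < ε)

  field
    archimedean : ∀ x → ∃[ n ] (x < fromℕ n)
    complete    : ∀ s → Cauchy s → ∃[ l ] Limit s l

  open IsStrictPartialOrder isStrictPartialOrder public using (<-respˡ-≈; <-respʳ-≈)
    renaming (irrefl to <-irrefl; trans to <-trans)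

  <-cotrans : ∀ {x y} → x < y → ∀ z → x < z ⊎ z < y
  <-cotrans x<y z with #-cotrans (<⇒# x<y) z
  ... | inj₁ x#z = [ inj₁ , (λ z<x → inj₂ (<-trans z<x x<y)) ]′ (#⇒<⊎> x#z)
  ... | inj₂ z#y = [ inj₂ , (λ y<z → inj₁ (<-trans x<y y<z)) ]′ (#⇒<⊎> z#y)

  ≤-<-trans : ∀ {x y z} → x ≤ y → y < z → x < z
  ≤-<-trans {x} x≤y y<z = [ (λ y<x → ⊥-elim (x≤y y<x)) , (λ x<z → x<z) ]′ (<-cotrans y<z x)

  +-mono-< : ∀ {x y u v} → x < y → u < v → x + u < y + v
  +-mono-< {x} {y} {u} {v} x<y u<v = <-trans (+-monoˡ-< u x<y)
    (<-respˡ-≈ (+-comm u y) (<-respʳ-≈ (+-comm v y) (+-monoˡ-< y u<v)))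

  0<fromℕ-suc : ∀ n → 0# < fromℕ (suc n)
  0<fromℕ-suc zero    = <-respʳ-≈ (sym (+-identityʳ 1#)) 0<1
  0<fromℕ-suc (suc n) = <-respˡ-≈ (+-identityˡ 0#) (+-mono-< 0<1 (0<fromℕ-suc n))

  0<fromℕ : ∀ {n} → 0 ℕ.< n → 0# < fromℕ n
  0<fromℕ {suc n} _ = 0<fromℕ-suc n

  inverse : ∀ {x} → 0# < x → Carrier
  inverse 0<x = proj₁ (#⇒invertible (#-sym (<⇒# 0<x)))

  inverse-correct : ∀ {x} (0<x : 0# < x) → inverse 0<x * x ≈ 1#
  inverse-correct {x} 0<x = trans (*-congˡ (sym x-0≈x)) (proj₁ (proj₂ inv))
    where
    inv   = #⇒invertible (#-sym (<⇒# 0<x))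
    -0≈0  : - 0# ≈ 0#
    -0≈0  = trans (sym (+-identityˡ (- 0#))) (-‿inverseʳ 0#)
    x-0≈x : x - 0# ≈ x
    x-0≈x = trans (+-congˡ -0≈0) (+-identityʳ x)

  max[x,1-x]<R⇒0<R : ∀ {x R} → x ∨ (1# - x) < R → 0# < R
  max[x,1-x]<R⇒0<R {x} {R} h = [ (λ 0<R → 0<R) , cancel ]′ (<-cotrans 0<R+R R)
    where
    x<R   : x < R
    x<R   = ≤-<-trans (∨-upperˡ x (1# - x)) h
    1-x<R : 1# - x < R
    1-x<R = ≤-<-trans (∨-upperʳ x (1# - x)) h
    sum≈1 : (1# - x) + x ≈ 1#
    sum≈1 = trans (+-assoc 1# (- x) x) (trans (+-congˡ (-‿inverseˡ x)) (+-identityʳ 1#))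
    0<R+R : 0# < R + R
    0<R+R = <-trans 0<1 (<-respˡ-≈ sum≈1 (+-mono-< 1-x<R x<R))
    cancel : R < R + R → 0# < R
    cancel R<R+R = <-respˡ-≈ (-‿inverseʳ R)
      (<-respʳ-≈ (trans (+-assoc R R (- R)) (trans (+-congˡ (-‿inverseʳ R)) (+-identityʳ R)))
        (+-monoˡ-< (- R) R<R+R))

module Words (b : ℕ) (w : List (Fin b)) where

  Word : Set
  Word = List (Fin b)

  n⟨_⟩ : Word → ℕ
  n⟨ g ⟩ = foldl (λ n d → n ℕ.* b ℕ.+ toℕ d) 0 g

  -- An occurrence of w in g is a suffix of g that has w as a prefix.
  k : Word → ℕ
  k g = length (filter (prefix? Fin._≟_ w) (tails g))

  -- No truncation happens in the subtraction: k (w ++ g) ≥ 1.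
  k⁺ : Word → ℕ
  k⁺ g = k (w ++ g) ℕ.∸ 1

  _⁻ : Word → Word
  g ⁻ = take (length g ℕ.∸ 1) g

  𝒢 : Word → Set
  𝒢 g = g ≢ [] × k⁺ g ≡ 1 × k⁺ (g ⁻) ≡ 0

  IsShortest𝒢 : Word → Set
  IsShortest𝒢 g = 𝒢 g × (∀ h → 𝒢 h → length g ℕ.≤ length h)

  -- The digits of g g g ⋯, indexed from 0.
  periodic : (g : Word) → g ≢ [] → ℕ → Fin b
  periodic []        g≢[] _ = ⊥-elim (g≢[] refl)
  periodic g@(_ ∷ _) _    i = lookup g (i mod length g)

-- Near ε x y stands for "x and y are at distance < ε".
module Sums {c ℓ₁ ℓ₂} (ℝ : RealField c ℓ₁ ℓ₂)
            {A : Set c} (_+_ : A → A → A) (0# : A)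
            (Near : RealField.Carrier ℝ → A → A → Set ℓ₂) where

  private module ℝ = RealField ℝ

  Σ[_] : ∀ {i} {I : Set i} → List I → (I → A) → A
  Σ[ is ] f = foldr (λ i s → f i + s) 0# is

  -- The series f 0 + f 1 + ⋯ converges to s.
  HasSeriesSum : (ℕ → A) → A → Set (c ⊔ ℓ₂)
  HasSeriesSum f s = ∀ ε → ℝ.0# ℝ.< ε →
    ∃[ N ] (∀ n → N ℕ.≤ n → Near ε (Σ[ upTo n ] f) s)

  -- Unordered sum of f over the index set { i ∣ P i }: convergence along
  -- the directed set of its finite subsets.
  HasSumOver : ∀ {I : Set} → (I → Set) → (I → A) → A → Set (c ⊔ ℓ₂)
  HasSumOver {I} P f s = ∀ ε → ℝ.0# ℝ.< ε →
    Σ[ F ∈ List I ] Unique F × All P F ×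
      (∀ F′ → Unique F′ → All P F′ → F ⊆ F′ → Near ε (Σ[ F′ ] f) s)

module Complex {c ℓ₁ ℓ₂} (ℝ : RealField c ℓ₁ ℓ₂) where

  private module ℝ = RealField ℝ

  infix  8 -_
  infixl 7 _*_
  infixl 6 _+_ _-_
  infix  4 _≈_

  record ℂ : Set c where
    constructor _+i_
    field
      re im : ℝ.Carrier
  open ℂ public

  _≈_ : ℂ → ℂ → Set ℓ₁
  z ≈ z′ = (re z ℝ.≈ re z′) × (im z ℝ.≈ im z′)

  _+_ _*_ _-_ : ℂ → ℂ → ℂ
  (x +i y) + (u +i v) = (x ℝ.+ u) +i (y ℝ.+ v)
  (x +i y) * (u +i v) = (x ℝ.* u ℝ.- y ℝ.* v) +i (x ℝ.* v ℝ.+ y ℝ.* u)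
  (x +i y) - (u +i v) = (x ℝ.- u) +i (y ℝ.- v)

  -_ conj : ℂ → ℂ
  - (x +i y)    = (ℝ.- x) +i (ℝ.- y)
  conj (x +i y) = x +i (ℝ.- y)

  ofℝ : ℝ.Carrier → ℂ
  ofℝ x = x +i ℝ.0#

  0ℂ 1ℂ : ℂ
  0ℂ = ofℝ ℝ.0#
  1ℂ = ofℝ ℝ.1#

  ∣_∣² : ℂ → ℝ.Carrier
  ∣ x +i y ∣² = x ℝ.* x ℝ.+ y ℝ.* y

  ℂ-rawRing : RawRing c ℓ₁
  ℂ-rawRing = record
    { Carrier = ℂ ; _≈_ = _≈_ ; _+_ = _+_ ; _*_ = _*_ ; -_ = -_ ; 0# = 0ℂ ; 1# = 1ℂ }

  open RawSemiringDefs (RawRing.rawSemiring ℂ-rawRing) public using (_^_)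

  module ℝΣ = Sums ℝ ℝ._+_ ℝ.0# (λ ε x y → ℝ.∣ x ℝ.- y ∣ ℝ.< ε)
  module ℂΣ = Sums ℝ _+_ 0ℂ (λ ε z z′ → ∣ z - z′ ∣² ℝ.< ε ℝ.* ε)

  -- The monic polynomial z ^ m + Σ_{i < m} p i * z ^ i.
  MonicPoly : ℕ → Set c
  MonicPoly m = Fin m → ℂ

  eval : ∀ {m} → MonicPoly m → ℂ → ℂ
  eval {m} p z = z ^ m + ℂΣ.Σ[ allFin m ] (λ i → p i * z ^ toℕ i)

module Setting {c ℓ₁ ℓ₂} (ℝ : RealField c ℓ₁ ℓ₂)
               (b : ℕ) (1<b : 1 ℕ.< b) (w : List (Fin b)) where

  private module ℝ = RealField ℝ
  open Complex ℝ
  open Words b w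

  b⁻^ : ℕ → ℝ.Carrier
  b⁻^ n = ℝ.inverse (ℝ.0<fromℕ (ℕ.<-trans (ℕ.n<1+n 0) 1<b)) ℝ.^ n

  x⟨_⟩ : Word → ℝ.Carrier
  x⟨ g ⟩ = ℝ.fromℕ n⟨ g ⟩ ℝ.* b⁻^ (length g)

  -- x is the number 0.d₀d₁d₂⋯ in base b (digits indexed from 0).
  HasDigits : ℝ.Carrier → (ℕ → Fin b) → Set (c ⊔ ℓ₂)
  HasDigits x d = ℝΣ.HasSeriesSum (λ i → ℝ.fromℕ (toℕ (d i)) ℝ.* b⁻^ (suc i)) x

  Isλ : ℕ → ℝ.Carrier → Set (c ⊔ ℓ₂)
  Isλ n l = ℝΣ.HasSumOver 𝒢 (λ g → b⁻^ (n ℕ.* length g)) l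

  -- y is the value (𝖪_w f)(x).
  IsK : (ℂ → ℂ) → ℂ → ℂ → Set (c ⊔ ℓ₂)
  IsK f x y = ℂΣ.HasSumOver 𝒢
    (λ g → ofℝ (b⁻^ (length g)) * f (ofℝ x⟨ g ⟩ + ofℝ (b⁻^ (length g)) * x)) y

  IsEigenfunction : ℝ.Carrier → (ℂ → ℂ) → Set (c ⊔ ℓ₂)
  IsEigenfunction l f = ∀ x → IsK f x (ofℝ l * f x)

-- The Hardy space H² of the open disk with real centre a and radius R.
module Hardy {c ℓ₁ ℓ₂} (ℝ : RealField c ℓ₁ ℓ₂)
             (a R : RealField.Carrier ℝ)
             (0<R : RealField._<_ ℝ (RealField.0# ℝ) R) where

  private module ℝ = RealField ℝ
  open Complex ℝ

  Disk : Set (c ⊔ ℓ₂)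
  Disk = Σ[ z ∈ ℂ ] ∣ z - ofℝ a ∣² ℝ.< R ℝ.* R

  Fun : Set (c ⊔ ℓ₂)
  Fun = Disk → ℂ

  infix 4 _≗_
  _≗_ : Fun → Fun → Set (c ⊔ ℓ₁ ⊔ ℓ₂)
  f ≗ g = ∀ z → f z ≈ g z

  R⁻^ : ℕ → ℂ
  R⁻^ m = ofℝ (ℝ.inverse 0<R ℝ.^ m)

  e : ℕ → Fun
  e m (z , _) = R⁻^ m * (z - ofℝ a) ^ m

  -- Functions on the disk with an expansion Σ aₘ eₘ, Σ ∣aₘ∣² < ∞.  The
  -- coefficients are determined by the function, so equality of elements
  -- is pointwise equality (_≗_) of the functions.
  record H² : Set (c ⊔ ℓ₁ ⊔ ℓ₂) where
    field
      fun       : Fun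
      coeff     : ℕ → ℂ
      expansion : ∀ z → ℂΣ.HasSeriesSum (λ m → coeff m * e m z) (fun z)
      ‖_‖²      : ℝ.Carrier
      summable  : ℝΣ.HasSeriesSum (λ m → ∣ coeff m ∣²) ‖_‖²
  open H² public

  -- ⟨ f , g ⟩ = z, the inner product being linear in the first argument.
  ⟨_,_⟩≈_ : H² → H² → ℂ → Set (c ⊔ ℓ₂)
  ⟨ f , g ⟩≈ z = ℂΣ.HasSeriesSum (λ m → coeff f m * conj (coeff g m)) z

  -- The function φ lies in H² and has norm at most B.
  ‖_‖≤_ : Fun → ℝ.Carrier → Set (c ⊔ ℓ₁ ⊔ ℓ₂)
  ‖ φ ‖≤ B = Σ[ f ∈ H² ] fun f ≗ φ × ℝ.0# ℝ.≤ B × ‖ f ‖² ℝ.≤ B ℝ.* B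

  δ : ℕ → ℕ → ℂ
  δ m n with m ℕ.≟ n
  ... | yes _ = 1ℂ
  ... | no  _ = 0ℂ

  record IsOrthonormalBasis (u : ℕ → H²) : Set (c ⊔ ℓ₁ ⊔ ℓ₂) where
    field
      orthonormal : ∀ m n → ⟨ u m , u n ⟩≈ δ m n
      total       : ∀ (f : H²) ε → ℝ.0# ℝ.< ε →
        ∃[ n ] Σ[ t ∈ (ℕ → ℂ) ]
          ‖ (λ z → fun f z - ℂΣ.Σ[ upTo n ] (λ k → t k * fun (u k) z)) ‖≤ ε

  record BoundedOperator : Set (c ⊔ ℓ₁ ⊔ ℓ₂) where
    field
      op      : H² → H²
      -- Linearity, including compatibility with the equality on H² (t = 0).
      linear  : ∀ t f g h → fun h ≗ (λ z → t * fun f z + fun g z) →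
                fun (op h) ≗ (λ z → t * fun (op f) z + fun (op g) z)
      bound   : ℝ.Carrier
      0≤bound : ℝ.0# ℝ.≤ bound
      bounded : ∀ f → ‖ op f ‖² ℝ.≤ (bound ℝ.* bound) ℝ.* ‖ f ‖²
  open BoundedOperator public

  record Invertible (T : BoundedOperator) : Set (c ⊔ ℓ₁ ⊔ ℓ₂) where
    field
      inv      : BoundedOperator
      inverseˡ : ∀ f → fun (op inv (op T f)) ≗ fun f
      inverseʳ : ∀ f → fun (op T (op inv f)) ≗ fun f

  IsRieszBasis : (ℕ → Fun) → Set (c ⊔ ℓ₁ ⊔ ℓ₂)
  IsRieszBasis φ = Σ[ u ∈ (ℕ → H²) ] Σ[ T ∈ BoundedOperator ]
    IsOrthonormalBasis u × Invertible T × (∀ m → fun (op T (u m)) ≗ φ m)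

  ExponentiallyClose : (ℕ → Fun) → (ℕ → Fun) → Set (c ⊔ ℓ₁ ⊔ ℓ₂)
  ExponentiallyClose φ ψ = ∃[ C ] ∃[ θ ] ℝ.0# ℝ.≤ θ × θ ℝ.< ℝ.1# ×
    (∀ m → ‖ (λ z → φ m z - ψ m z) ‖≤ (C ℝ.* θ ℝ.^ m))

  normalized : (∀ m → MonicPoly m) → ℕ → Fun
  normalized B m (z , _) = R⁻^ m * eval (B m) z

{-# OPTIONS --safe #-}

-- Centre everything at x_w, the fixed point of the contraction T_g : x ↦ x(g) + b^(−|g|) x
-- attached to g = g_w.  In powers of x − x_w the operator K is upper triangular with
-- diagonal λ_(k+1), and λ_(k+1) − λ_(m+1) ≥ s^(k+1) (1 − s) for k < m, where s = b^(−|g_w|).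
-- Every g in 𝒢 is h g_w, so T_g = T_h ∘ T_(g_w): divided by s^k, the k-th row of K involves
-- only T_h, which for non-empty h maps the disk of radius R into one of radius (R + R_w)/2.
-- Hence the normalized coefficients v_k of 𝓑_m satisfy v_k ≤ C θᵏ Σ_{k<j≤m} θʲ v_j with some
-- θ < 1, and a discrete Gronwall argument gives v_k ≤ C′ θᵏ θᵐ for k < m.  So the 𝓑_m arise
-- from the e_m by a matrix 1 + N with N strictly upper triangular and exponentially small;
-- the recursion for the inverse matrix has the same shape, so the same argument bounds it.

module Submission where

open import Defs
open import Algebra.Apartness.Bundles using (HeytingCommutativeRing)
open import Algebra.Bundles using (CommutativeRing)
open import Algebra.Bundles.Raw using (RawRing)
import Algebra.Consequences.Setoid
import Algebra.Properties.AbelianGroup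
import Algebra.Properties.CommutativeSemigroup
import Algebra.Properties.CommutativeSemiring.Exp
import Algebra.Properties.Ring
import Algebra.Properties.Semiring.Exp
import Algebra.Properties.Semiring.Mult
import Algebra.Properties.Semiring.Mult.TCOptimised
import Algebra.Solver.Ring
open import Algebra.Solver.Ring.AlmostCommutativeRing using (_-Raw-AlmostCommutative⟶_; fromCommutativeRing)
open import Algebra.Structures using (IsCommutativeRing)
open import Data.Empty using (⊥-elim)
open import Data.Fin.Base as Fin using (Fin; toℕ; fromℕ<)
import Data.Fin.Properties as Fin
open import Data.List.Base using (List; []; _∷_; _++_; _∷ʳ_; length; lookup; take; foldl; upTo; applyUpTo; tabulate; deduplicate; initLast; _∷ʳ′_)
open import Data.List.Membership.Propositional using (_∈_)
open import Data.List.Membership.Propositional.Properties using (∈-deduplicate⁺)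
import Data.List.Properties as List
open import Data.List.Relation.Binary.Prefix.Heterogeneous using (Prefix; []; _∷_)
open import Data.List.Relation.Binary.Prefix.Heterogeneous.Properties using (prefix?)
open import Data.List.Relation.Binary.Subset.Propositional using (_⊆_)
open import Data.List.Relation.Binary.Subset.Propositional.Properties using (xs⊆xs++ys; xs⊆ys++xs)
open import Data.List.Relation.Unary.All as All using (All; []; _∷_)
import Data.List.Relation.Unary.All.Properties as All
open import Data.List.Relation.Unary.AllPairs using ([]; _∷_)
open import Data.List.Relation.Unary.Any using (here; there)
open import Data.List.Relation.Unary.Unique.DecPropositional.Properties using (deduplicate-!)
open import Data.List.Relation.Unary.Unique.Propositional using (Unique)
open import Data.List.Reverse using (Reverse; []; _∶_∶ʳ_; reverseView)
open import Data.Maybe.Base using (Maybe; just; nothing)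
open import Data.Nat.Base as ℕ using (ℕ; zero; suc; z≤n; s≤s)
open import Data.Nat.DivMod using (_%_; m%n<n; m<n⇒m%n≡m; [m+n]%n≡m%n)
open import Data.Nat.Induction using (<-rec)
import Data.Nat.Properties as ℕ
open import Data.Nat.Solver using (module +-*-Solver)
open import Data.Product.Base using (Σ-syntax; ∃-syntax; _×_; _,_; proj₁; proj₂; map₂)
open import Data.Sum.Base using (_⊎_; inj₁; inj₂; [_,_]′)
open import Function.Base using (_∘_; id)
open import Level using (Level; _⊔_) renaming (zero to 0ℓ; suc to lsuc)
open import Relation.Binary.Bundles using (Setoid)
open import Relation.Binary.Definitions using (DecidableEquality)
open import Relation.Binary.PropositionalEquality as ≡ using (_≡_; _≢_)
import Relation.Binary.Reasoning.Base.Triple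
import Relation.Binary.Reasoning.Setoid
open import Relation.Binary.Structures using (IsEquivalence; IsPreorder; IsStrictPartialOrder)
open import Relation.Nullary using (¬_; Dec; yes; no)

-- The obstacle is that consecutive eigenvalues approach each other like s^k, so solving the k-th
-- row for its coefficient amplifies any row bound that is merely uniform in k. The common suffix
-- `g_w` of all words of `𝒢` repays exactly this loss, and it singles out the centre: x_w is the
-- point that `g_w` fixes. Triangularity replaces smallness: both recursions are solved one index at
-- a time, and the losses 1 + C θⁿ multiply to a bounded product. Two more constraints shape the
-- argument. The eigenvalue equation is given pointwise, as a limit over finite subsets of `𝒢`, so
-- coefficients must be extracted from pointwise limits before any estimate. And the field may be
-- constructive: the order need not be decidable and square roots are avoided, so bounds are put on
-- squares or on real and imaginary parts, and every norm has to be exhibited as the limit of a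
-- series.

-- The coefficients are formal differences of naturals, so that the solver can
-- cancel although the equality of R is not decidable.
module RingSolver {r₁ r₂ : Level} (R : CommutativeRing r₁ r₂) where
  open CommutativeRing R
  open Algebra.Properties.Ring ring
  open Algebra.Properties.AbelianGroup +-abelianGroup using (⁻¹-∙-comm; xyx⁻¹≈y)
  open Algebra.Properties.CommutativeSemigroup +-commutativeSemigroup using (interchange)
  open Algebra.Properties.Semiring.Mult.TCOptimised semiring
    using (×-homo-+; ×1-homo-*) renaming (_×_ to _·_)
  open import Relation.Binary.Reasoning.Setoid setoid

  private
    nat : ℕ → Carrier
    nat n = n · 1#

    -0≈0 : - 0# ≈ 0#
    -0≈0 = trans (sym (+-identityˡ (- 0#))) (-‿inverseʳ 0#)

    -- The normal form of a formal difference; without it the solver would not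
    -- identify 2 − 1 and 1.
    reduce : ℕ × ℕ → ℕ × ℕ
    reduce (a , b) = a ℕ.∸ b , b ℕ.∸ a

    differences : RawRing _ _
    differences = record
      { Carrier = ℕ × ℕ
      ; _≈_     = _≡_
      ; _+_     = λ (a , b) (c , d) → reduce (a ℕ.+ c , b ℕ.+ d)
      ; _*_     = λ (a , b) (c , d) → reduce (a ℕ.* c ℕ.+ b ℕ.* d , a ℕ.* d ℕ.+ b ℕ.* c)
      ; -_      = λ (a , b) → b , a
      ; 0#      = 0 , 0
      ; 1#      = 1 , 0
      }

    ⟦_⟧ᶜ : ℕ × ℕ → Carrier
    ⟦ a , zero  ⟧ᶜ = nat a
    ⟦ a , suc b ⟧ᶜ = nat a - nat (suc b)

    unfold : ∀ a b → ⟦ a , b ⟧ᶜ ≈ nat a - nat b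
    unfold a zero    = sym (trans (+-congˡ -0≈0) (+-identityʳ (nat a)))
    unfold a (suc b) = refl

    regroup : ∀ x y u v → (x + u) - (y + v) ≈ (x - y) + (u - v)
    regroup x y u v = trans (+-congˡ (sym (⁻¹-∙-comm y v))) (interchange x u (- y) (- v))

    add-back : ∀ x y → x ≈ (x - y) + y
    add-back x y = sym (trans (+-assoc x (- y) y) (trans (+-congˡ (-‿inverseˡ y)) (+-identityʳ x)))

    equal : ∀ a b c d → a ℕ.+ d ≡ c ℕ.+ b → ⟦ a , b ⟧ᶜ ≈ ⟦ c , d ⟧ᶜ
    equal a b c d eq = begin
      ⟦ a , b ⟧ᶜ  ≈⟨ unfold a b ⟩
      nat a - nat b  ≈⟨ add-back _ (nat d - nat d) ⟩
      (nat a - nat b - (nat d - nat d)) + (nat d - nat d)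
        ≈⟨ +-congʳ (trans (+-congˡ (trans (-‿cong (-‿inverseʳ (nat d))) -0≈0)) (+-identityʳ _)) ⟩
      (nat a - nat b) + (nat d - nat d)    ≈⟨ regroup (nat a) (nat b) (nat d) (nat d) ⟨
      (nat a + nat d) - (nat b + nat d)  ≈⟨ +-cong (trans (sym (×-homo-+ 1# a d)) (trans (reflexive (≡.cong nat eq)) (×-homo-+ 1# c b)))
                                                (-‿cong (+-comm (nat b) (nat d))) ⟩
      (nat c + nat b) - (nat d + nat b)    ≈⟨ regroup (nat c) (nat d) (nat b) (nat b) ⟩
      (nat c - nat d) + (nat b - nat b)    ≈⟨ trans (+-congˡ (-‿inverseʳ (nat b))) (+-identityʳ _) ⟩
      nat c - nat d  ≈⟨ unfold c d ⟨
      ⟦ c , d ⟧ᶜ  ∎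

    reduce-correct : ∀ p → ⟦ reduce p ⟧ᶜ ≈ ⟦ p ⟧ᶜ
    reduce-correct (a , b) = equal (a ℕ.∸ b) (b ℕ.∸ a) a b (balance a b)
      where
      balance : ∀ a b → a ℕ.∸ b ℕ.+ b ≡ a ℕ.+ (b ℕ.∸ a)
      balance zero    zero    = ≡.refl
      balance zero    (suc b) = ≡.refl
      balance (suc a) zero    = ≡.refl
      balance (suc a) (suc b) = ≡.trans (ℕ.+-suc (a ℕ.∸ b) b) (≡.cong suc (balance a b))

    homo-+ : ∀ p q → ⟦ reduce (proj₁ p ℕ.+ proj₁ q , proj₂ p ℕ.+ proj₂ q) ⟧ᶜ ≈ ⟦ p ⟧ᶜ + ⟦ q ⟧ᶜ
    homo-+ (a , b) (c , d) = begin
      ⟦ reduce (a ℕ.+ c , b ℕ.+ d) ⟧ᶜ    ≈⟨ reduce-correct (a ℕ.+ c , b ℕ.+ d) ⟩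
      ⟦ a ℕ.+ c , b ℕ.+ d ⟧ᶜ  ≈⟨ unfold (a ℕ.+ c) (b ℕ.+ d) ⟩
      nat (a ℕ.+ c) - nat (b ℕ.+ d)      ≈⟨ +-cong (×-homo-+ 1# a c) (-‿cong (×-homo-+ 1# b d)) ⟩
      (nat a + nat c) - (nat b + nat d)  ≈⟨ regroup (nat a) (nat b) (nat c) (nat d) ⟩
      (nat a - nat b) + (nat c - nat d)  ≈⟨ +-cong (unfold a b) (unfold c d) ⟨
      ⟦ a , b ⟧ᶜ + ⟦ c , d ⟧ᶜ  ∎

    expand : ∀ x y u v → (x - y) * (u - v) ≈ (x * u + y * v) - (x * v + y * u)
    expand x y u v = begin
      (x - y) * (u - v)  ≈⟨ distribʳ (u - v) x (- y) ⟩
      x * (u - v) + (- y) * (u - v)  ≈⟨ +-cong (distribˡ x u (- v)) (distribˡ (- y) u (- v)) ⟩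
      (x * u + x * - v) + (- y * u + - y * - v)      ≈⟨ +-cong (+-congˡ (sym (-‿distribʳ-* x v)))
                                                          (+-cong (sym (-‿distribˡ-* y u)) (trans (sym (-‿distribˡ-* y (- v)))
                                                            (trans (-‿cong (sym (-‿distribʳ-* y v))) (-‿involutive (y * v))))) ⟩
      (x * u - x * v) + (- (y * u) + y * v)  ≈⟨ +-congˡ (+-comm (- (y * u)) (y * v)) ⟩
      (x * u - x * v) + (y * v - y * u)  ≈⟨ regroup (x * u) (x * v) (y * v) (y * u) ⟨
      (x * u + y * v) - (x * v + y * u)  ∎

    nat-*+ : ∀ a c b d → nat (a ℕ.* c ℕ.+ b ℕ.* d) ≈ nat a * nat c + nat b * nat d
    nat-*+ a c b d = trans (×-homo-+ 1# (a ℕ.* c) (b ℕ.* d)) (+-cong (×1-homo-* a c) (×1-homo-* b d))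

    homo-* : ∀ p q → ⟦ reduce (proj₁ p ℕ.* proj₁ q ℕ.+ proj₂ p ℕ.* proj₂ q
                             , proj₁ p ℕ.* proj₂ q ℕ.+ proj₂ p ℕ.* proj₁ q) ⟧ᶜ ≈ ⟦ p ⟧ᶜ * ⟦ q ⟧ᶜ
    homo-* (a , b) (c , d) = begin
      ⟦ reduce (a ℕ.* c ℕ.+ b ℕ.* d , a ℕ.* d ℕ.+ b ℕ.* c) ⟧ᶜ  ≈⟨ reduce-correct (_ , a ℕ.* d ℕ.+ b ℕ.* c) ⟩
      ⟦ a ℕ.* c ℕ.+ b ℕ.* d , a ℕ.* d ℕ.+ b ℕ.* c ⟧ᶜ  ≈⟨ unfold _ (a ℕ.* d ℕ.+ b ℕ.* c) ⟩
      nat (a ℕ.* c ℕ.+ b ℕ.* d) - nat (a ℕ.* d ℕ.+ b ℕ.* c)  ≈⟨ +-cong (nat-*+ a c b d) (-‿cong (nat-*+ a d b c)) ⟩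
      (nat a * nat c + nat b * nat d) - (nat a * nat d + nat b * nat c)  ≈⟨ expand (nat a) (nat b) (nat c) (nat d) ⟨
      (nat a - nat b) * (nat c - nat d)  ≈⟨ *-cong (unfold a b) (unfold c d) ⟨
      ⟦ a , b ⟧ᶜ * ⟦ c , d ⟧ᶜ  ∎

    homo-neg : ∀ p → ⟦ proj₂ p , proj₁ p ⟧ᶜ ≈ - ⟦ p ⟧ᶜ
    homo-neg (a , b) = begin
      ⟦ b , a ⟧ᶜ  ≈⟨ unfold b a ⟩
      nat b - nat a  ≈⟨ +-comm (nat b) (- nat a) ⟩
      - nat a + nat b       ≈⟨ +-congˡ (-‿involutive (nat b)) ⟨
      - nat a + - - nat b   ≈⟨ ⁻¹-∙-comm (nat a) (- nat b) ⟩
      - (nat a - nat b)     ≈⟨ -‿cong (unfold a b) ⟨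
      - ⟦ a , b ⟧ᶜ  ∎

    morphism : differences -Raw-AlmostCommutative⟶ fromCommutativeRing R
    morphism = record
      { ⟦_⟧    = ⟦_⟧ᶜ
      ; +-homo = homo-+
      ; *-homo = homo-*
      ; -‿homo = homo-neg
      ; 0-homo = refl
      ; 1-homo = refl
      }

    decide : ∀ p q → Maybe (⟦ p ⟧ᶜ ≈ ⟦ q ⟧ᶜ)
    decide (a , b) (c , d) with a ℕ.+ d ℕ.≟ c ℕ.+ b
    ... | yes eq = just (equal a b c d eq)
    ... | no  _  = nothing

  open import Algebra.Solver.Ring differences (fromCommutativeRing R) morphism decide public
    using (solve; Polynomial; con; _:=_; _:+_; _:*_; _:-_; :-_; _:^_)

  :1 :0 : ∀ {n} → Polynomial n
  :1 = con (1 , 0)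
  :0 = con (0 , 0)

  :2 : ∀ {n} → Polynomial n
  :2 = con (2 , 0)

-- Order, absolute values, inverses and powers in the real field

module OrderedField {c ℓ₁ ℓ₂ : Level} (ℝ : RealField c ℓ₁ ℓ₂) where
  open RealField ℝ hiding (zero) public

  commutativeRing : CommutativeRing c ℓ₁
  commutativeRing = HeytingCommutativeRing.commutativeRing heytingCommutativeRing

  open RingSolver commutativeRing public

  <-asym : ∀ {x y} → x < y → ¬ (y < x)
  <-asym p q = <-irrefl refl (<-trans p q)

  <⇒≤ : ∀ {x y} → x < y → x ≤ y
  <⇒≤ = <-asym

  ≤-reflexive : ∀ {x y} → x ≈ y → x ≤ y
  ≤-reflexive eq y<x = <-irrefl (sym eq) y<x

  ≤-refl : ∀ {x} → x ≤ x
  ≤-refl = ≤-reflexive refl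

  ≤-trans : ∀ {x y z} → x ≤ y → y ≤ z → x ≤ z
  ≤-trans {y = y} x≤y y≤z z<x = [ y≤z , x≤y ]′ (<-cotrans z<x y)

  <-≤-trans : ∀ {x y z} → x < y → y ≤ z → x < z
  <-≤-trans {z = z} x<y y≤z = [ (λ p → p) , (λ p → ⊥-elim (y≤z p)) ]′ (<-cotrans x<y z)

  ≤-antisym : ∀ {x y} → x ≤ y → y ≤ x → x ≈ y
  ≤-antisym x≤y y≤x = proj₁ (tight _ _) (λ x#y → [ y≤x , x≤y ]′ (#⇒<⊎> x#y))

  ≤-isPreorder : IsPreorder _≈_ _≤_
  ≤-isPreorder = record { isEquivalence = isEquivalence ; reflexive = ≤-reflexive ; trans = ≤-trans }

  module ≤-Reasoning = Relation.Binary.Reasoning.Base.Triple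
    ≤-isPreorder <-asym <-trans (IsStrictPartialOrder.<-resp-≈ isStrictPartialOrder) <⇒≤ <-≤-trans ≤-<-trans

  ≤-resp : ∀ {x y u v} → x ≈ u → y ≈ v → x ≤ y → u ≤ v
  ≤-resp x≈u y≈v x≤y = ≤-trans (≤-reflexive (sym x≈u)) (≤-trans x≤y (≤-reflexive y≈v))

  <-resp : ∀ {x y u v} → x ≈ u → y ≈ v → x < y → u < v
  <-resp x≈u y≈v x<y = <-respˡ-≈ x≈u (<-respʳ-≈ y≈v x<y)

  -- Inequalities are negations, so they may be proved by cases on the order.
  ≤-cases : ∀ {p q} x y → (x ≤ y → p ≤ q) → (y ≤ x → p ≤ q) → p ≤ q
  ≤-cases x y f g q<p = f (λ y<x → g (<⇒≤ y<x) q<p) q<p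

  ≈-cases : ∀ {p q} x y → (x ≤ y → p ≈ q) → (y ≤ x → p ≈ q) → p ≈ q
  ≈-cases x y f g = ≤-antisym
    (≤-cases x y (λ h → ≤-reflexive (f h)) (λ h → ≤-reflexive (g h)))
    (≤-cases x y (λ h → ≤-reflexive (sym (f h))) (λ h → ≤-reflexive (sym (g h))))

  +-monoˡ-≤ : ∀ {x y} z → x ≤ y → x + z ≤ y + z
  +-monoˡ-≤ {x} {y} z x≤y h = x≤y (<-resp (cancel y) (cancel x) (+-monoˡ-< (- z) h))
    where
    cancel : ∀ u → u + z - z ≈ u
    cancel u = solve 2 (λ u z → u :+ z :- z := u) refl u z

  +-mono-≤ : ∀ {x y u v} → x ≤ y → u ≤ v → x + u ≤ y + v
  +-mono-≤ {x} {y} {u} {v} x≤y u≤v =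
    ≤-trans (+-monoˡ-≤ u x≤y) (≤-resp (+-comm u y) (+-comm v y) (+-monoˡ-≤ y u≤v))

  +-monoʳ-≤ : ∀ {x y} z → x ≤ y → z + x ≤ z + y
  +-monoʳ-≤ z = +-mono-≤ ≤-refl

  neg-mono-≤ : ∀ {x y} → x ≤ y → - y ≤ - x
  neg-mono-≤ {x} {y} h = ≤-resp
    (solve 2 (λ x y → x :+ (:- x :- y) := :- y) refl x y)
    (solve 2 (λ x y → y :+ (:- x :- y) := :- x) refl x y) (+-monoˡ-≤ (- x - y) h)

  ≤⇒0≤- : ∀ {x y} → x ≤ y → 0# ≤ y - x
  ≤⇒0≤- {x} {y} h = ≤-resp (-‿inverseʳ x) refl (+-monoˡ-≤ (- x) h)

  <⇒0<- : ∀ {x y} → x < y → 0# < y - x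
  <⇒0<- {x} {y} h = <-resp (-‿inverseʳ x) refl (+-monoˡ-< (- x) h)

  ≤-by : ∀ {x y d} → 0# ≤ d → y ≈ x + d → x ≤ y
  ≤-by {x} h eq = ≤-resp (+-identityʳ x) (sym eq) (+-monoʳ-≤ x h)

  <-by : ∀ {x y d} → 0# < d → y ≈ x + d → x < y
  <-by {x} {y} {d} h eq = <-resp (+-identityˡ x) (trans (+-comm d x) (sym eq)) (+-monoˡ-< x h)

  0≤+ : ∀ {x y} → 0# ≤ x → 0# ≤ y → 0# ≤ x + y
  0≤+ p q = ≤-resp (+-identityˡ 0#) refl (+-mono-≤ p q)

  0<+ : ∀ {x y} → 0# < x → 0# ≤ y → 0# < x + y
  0<+ {x} p q = <-≤-trans p (≤-by q refl)

  -- The goal is a negation, so `x * y < 0#` may be assumed. A positive x would then force y ≈ 0 and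
  -- a zero product; hence x ≤ 0, so x ≈ 0, and the product is zero again.
  0≤* : ∀ {x y} → 0# ≤ x → 0# ≤ y → 0# ≤ x * y
  0≤* {x} {y} 0≤x 0≤y xy<0 = <-irrefl (trans (*-congʳ (≤-antisym x≤0 0≤x)) (zeroˡ y)) xy<0
    where
    x≤0 : x ≤ 0#
    x≤0 0<x = <-irrefl (trans (*-congˡ (≤-antisym y≤0 0≤y)) (zeroʳ x)) xy<0
      where
      y≤0 : y ≤ 0#
      y≤0 0<y = <-asym (*-pos 0<x 0<y) xy<0

  0≤1 : 0# ≤ 1#
  0≤1 = <⇒≤ 0<1

  *-monoˡ-≤ : ∀ {x y z} → 0# ≤ z → x ≤ y → z * x ≤ z * y
  *-monoˡ-≤ {x} {y} {z} 0≤z x≤y = ≤-by (0≤* 0≤z (≤⇒0≤- x≤y))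
    (solve 3 (λ x y z → z :* y := z :* x :+ z :* (y :- x)) refl x y z)

  *-monoʳ-≤ : ∀ {x y z} → 0# ≤ z → x ≤ y → x * z ≤ y * z
  *-monoʳ-≤ {x} {y} {z} p q = ≤-resp (*-comm z x) (*-comm z y) (*-monoˡ-≤ p q)

  *-mono-≤ : ∀ {x y u v} → 0# ≤ x → x ≤ y → 0# ≤ u → u ≤ v → x * u ≤ y * v
  *-mono-≤ 0≤x x≤y 0≤u u≤v = ≤-trans (*-monoʳ-≤ 0≤u x≤y) (*-monoˡ-≤ (≤-trans 0≤x x≤y) u≤v)

  *-monoˡ-< : ∀ {x y z} → 0# < z → x < y → z * x < z * y
  *-monoˡ-< {x} {y} {z} 0<z x<y = <-by (*-pos 0<z (<⇒0<- x<y))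
    (solve 3 (λ x y z → z :* y := z :* x :+ z :* (y :- x)) refl x y z)

  *-cancelˡ-≤ : ∀ {x y z} → 0# < z → z * x ≤ z * y → x ≤ y
  *-cancelˡ-≤ 0<z h y<x = h (*-monoˡ-< 0<z y<x)

  0≤square : ∀ x → 0# ≤ x * x
  0≤square x = ≤-cases 0# x (λ h → 0≤* h h) (λ h →
    ≤-resp refl (solve 1 (λ x → (:- x) :* (:- x) := x :* x) refl x) (0≤* (neg h) (neg h)))
    where
    neg : x ≤ 0# → 0# ≤ - x
    neg h = ≤-resp refl (+-identityˡ (- x)) (≤⇒0≤- h)

  square-mono-≤ : ∀ {x y} → 0# ≤ x → x ≤ y → x * x ≤ y * y
  square-mono-≤ p q = *-mono-≤ p q p q

  square-cancel-≤ : ∀ {x y} → 0# ≤ y → x * x ≤ y * y → x ≤ y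
  square-cancel-≤ 0≤y h y<x = h (≤-<-trans (*-monoˡ-≤ 0≤y (<⇒≤ y<x))
    (<-resp (*-comm _ _) refl (*-monoˡ-< (≤-<-trans 0≤y y<x) y<x)))

  x≤∣x∣ : ∀ x → x ≤ ∣ x ∣
  x≤∣x∣ x = ∨-upperˡ x (- x)

  -x≤∣x∣ : ∀ x → - x ≤ ∣ x ∣
  -x≤∣x∣ x = ∨-upperʳ x (- x)

  ∣∣≤ : ∀ {x z} → x ≤ z → - x ≤ z → ∣ x ∣ ≤ z
  ∣∣≤ p q h = [ p , q ]′ (∨-least h)

  ∣∣-nonneg : ∀ {x} → 0# ≤ x → ∣ x ∣ ≈ x
  ∣∣-nonneg {x} h = ≤-antisym (∣∣≤ ≤-refl (≤-by (0≤+ h h) (solve 1 (λ x → x := (:- x) :+ (x :+ x)) refl x))) (x≤∣x∣ x)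

  ∣∣-nonpos : ∀ {x} → x ≤ 0# → ∣ x ∣ ≈ - x
  ∣∣-nonpos {x} h = ≤-antisym (∣∣≤ (≤-by (0≤+ (≤⇒0≤- h) (≤⇒0≤- h))
    (solve 1 (λ x → :- x := x :+ ((:0 :- x) :+ (:0 :- x))) refl x)) ≤-refl) (-x≤∣x∣ x)

  neg-nonneg : ∀ {x} → x ≤ 0# → 0# ≤ - x
  neg-nonneg {x} h = ≤-resp refl (+-identityˡ (- x)) (≤⇒0≤- h)

  0≤∣∣ : ∀ x → 0# ≤ ∣ x ∣
  0≤∣∣ x = ≤-cases 0# x (λ h → ≤-trans h (x≤∣x∣ x)) (λ h → ≤-trans (neg-nonneg h) (-x≤∣x∣ x))

  ∣∣-cong : ∀ {x y} → x ≈ y → ∣ x ∣ ≈ ∣ y ∣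
  ∣∣-cong {x} {y} eq = ≤-antisym
    (∣∣≤ (≤-resp (sym eq) refl (x≤∣x∣ y)) (≤-resp (-‿cong (sym eq)) refl (-x≤∣x∣ y)))
    (∣∣≤ (≤-resp eq refl (x≤∣x∣ x)) (≤-resp (-‿cong eq) refl (-x≤∣x∣ x)))

  ∣-∣ : ∀ x → ∣ - x ∣ ≈ ∣ x ∣
  ∣-∣ x = ≤-antisym (∣∣≤ (-x≤∣x∣ x) (≤-resp (sym ¬¬x≈x) refl (x≤∣x∣ x)))
                    (∣∣≤ (≤-resp ¬¬x≈x refl (-x≤∣x∣ (- x))) (x≤∣x∣ (- x)))
    where
    ¬¬x≈x : - - x ≈ x
    ¬¬x≈x = solve 1 (λ x → :- (:- x) := x) refl x

  ∣x-y∣≈∣y-x∣ : ∀ x y → ∣ x - y ∣ ≈ ∣ y - x ∣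
  ∣x-y∣≈∣y-x∣ x y = trans (∣∣-cong (solve 2 (λ x y → x :- y := :- (y :- x)) refl x y)) (∣-∣ (y - x))

  ∣x+y∣≤ : ∀ x y → ∣ x + y ∣ ≤ ∣ x ∣ + ∣ y ∣
  ∣x+y∣≤ x y = ∣∣≤ (+-mono-≤ (x≤∣x∣ x) (x≤∣x∣ y))
    (≤-resp (solve 2 (λ x y → :- x :+ :- y := :- (x :+ y)) refl x y) refl (+-mono-≤ (-x≤∣x∣ x) (-x≤∣x∣ y)))

  ∣x-y∣≤ : ∀ x y → ∣ x - y ∣ ≤ ∣ x ∣ + ∣ y ∣
  ∣x-y∣≤ x y = ≤-trans (∣x+y∣≤ x (- y)) (+-monoʳ-≤ ∣ x ∣ (≤-reflexive (∣-∣ y)))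

  ∣x*y∣ : ∀ x y → ∣ x * y ∣ ≈ ∣ x ∣ * ∣ y ∣
  ∣x*y∣ x y = ≈-cases 0# x
    (λ 0≤x → trans (onNonneg x y 0≤x) (*-congʳ (sym (∣∣-nonneg 0≤x))))
    (λ x≤0 → trans (trans (trans (sym (∣-∣ (x * y))) (∣∣-cong (solve 2 (λ x y → :- (x :* y) := (:- x) :* y) refl x y)))
      (onNonneg (- x) y (neg-nonneg x≤0))) (*-congʳ (sym (∣∣-nonpos x≤0))))
    where
    onNonneg : ∀ x y → 0# ≤ x → ∣ x * y ∣ ≈ x * ∣ y ∣
    onNonneg x y 0≤x = ≈-cases 0# y
      (λ 0≤y → trans (∣∣-nonneg (0≤* 0≤x 0≤y)) (*-congˡ (sym (∣∣-nonneg 0≤y))))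
      (λ y≤0 → trans (∣∣-nonpos (≤-resp refl (zeroʳ x) (*-monoˡ-≤ 0≤x y≤0)))
        (trans (solve 2 (λ x y → :- (x :* y) := x :* (:- y)) refl x y) (*-congˡ (sym (∣∣-nonpos y≤0)))))

  ∣c*x∣ : ∀ {x} y → 0# ≤ x → ∣ x * y ∣ ≈ x * ∣ y ∣
  ∣c*x∣ {x} y 0≤x = trans (∣x*y∣ x y) (*-congʳ (∣∣-nonneg 0≤x))

  ∣x∣≤0⇒x≈0 : ∀ {x} → ∣ x ∣ ≤ 0# → x ≈ 0#
  ∣x∣≤0⇒x≈0 {x} h = ≤-antisym (≤-trans (x≤∣x∣ x) h)
    (≤-resp (solve 0 (:- :0 := :0) refl) (solve 1 (λ x → :- (:- x) := x) refl x) (neg-mono-≤ (≤-trans (-x≤∣x∣ x) h)))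

  ∣∣²≈ : ∀ x → ∣ x ∣ * ∣ x ∣ ≈ x * x
  ∣∣²≈ x = trans (sym (∣x*y∣ x x)) (∣∣-nonneg (0≤square x))

  ∣x∣≤y-from-squares : ∀ {x y} → 0# ≤ y → x * x ≤ y * y → ∣ x ∣ ≤ y
  ∣x∣≤y-from-squares {x} 0≤y h = square-cancel-≤ 0≤y (≤-resp (sym (∣∣²≈ x)) refl h)

  square≤-from-∣∣ : ∀ {x y} → ∣ x ∣ ≤ y → x * x ≤ y * y
  square≤-from-∣∣ {x} h = ≤-resp (∣∣²≈ x) refl (square-mono-≤ (0≤∣∣ x) h)

  inverse-correctʳ : ∀ {x} (0<x : 0# < x) → x * inverse 0<x ≈ 1#
  inverse-correctʳ 0<x = trans (*-comm _ _) (inverse-correct 0<x)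

  -- Invertible elements are apart from zero, so the inverse has a sign; a negative one would make 1
  -- negative.
  0<inverse : ∀ {x} (0<x : 0# < x) → 0# < inverse 0<x
  0<inverse {x} 0<x = [ (λ p → p) , (λ p → ⊥-elim (absurd p)) ]′ (#⇒<⊎> 0#inv)
    where
    i = inverse 0<x
    0#inv : 0# # i
    0#inv = #-sym (invertible⇒# (x , trans (*-congˡ (solve 1 (λ i → i :- :0 := i) refl i)) (inverse-correctʳ 0<x)
                                    , trans (*-congʳ (solve 1 (λ i → i :- :0 := i) refl i)) (inverse-correct 0<x)))
    absurd : ¬ (i < 0#)
    absurd i<0 = <-asym 0<1 (<-resp (inverse-correctʳ 0<x) (zeroʳ x) (*-monoˡ-< 0<x i<0))

  2# : Carrier
  2# = 1# + 1#

  0<2 : 0# < 2#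
  0<2 = 0<+ 0<1 0≤1

  ½ : Carrier
  ½ = inverse 0<2

  0<½ : 0# < ½
  0<½ = 0<inverse 0<2

  ½+½ : ∀ x → ½ * x + ½ * x ≈ x
  ½+½ x = trans (solve 2 (λ h x → h :* x :+ h :* x := (h :* (:1 :+ :1)) :* x) refl ½ x)
    (trans (*-congʳ (inverse-correct 0<2)) (*-identityˡ x))

  0<½* : ∀ {x} → 0# < x → 0# < ½ * x
  0<½* = *-pos 0<½

  x-0≈x : ∀ x → x - 0# ≈ x
  x-0≈x x = solve 1 (λ x → x :- :0 := x) refl x

  x*[1*1]≈x : ∀ x → x * (1# * 1#) ≈ x
  x*[1*1]≈x x = solve 1 (λ x → x :* (:1 :* :1) := x) refl x

  ½*< : ∀ {x} → 0# < x → ½ * x < x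
  ½*< {x} 0<x = <-by (0<½* 0<x) (sym (½+½ x))

  ½<1 : ½ < 1#
  ½<1 = <-resp (*-identityʳ ½) refl (½*< 0<1)

  ≤-of-≤+ε : ∀ {x y} → (∀ ε → 0# < ε → x ≤ y + ε) → x ≤ y
  ≤-of-≤+ε {x} {y} h y<x = h (½ * (x - y)) (0<½* 0<x-y)
    (<-by (0<½* 0<x-y) (trans (solve 2 (λ x y → x := y :+ (x :- y)) refl x y)
      (trans (+-congˡ (sym (½+½ (x - y)))) (sym (+-assoc y _ _)))))
    where 0<x-y = <⇒0<- y<x

  open Algebra.Properties.Semiring.Exp (CommutativeRing.semiring commutativeRing) public
    using (^-homo-*; ^-assocʳ; ^-congˡ)
  open Algebra.Properties.CommutativeSemiring.Exp (CommutativeRing.commutativeSemiring commutativeRing) public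
    using (^-distrib-*)

  0≤^ : ∀ {x} n → 0# ≤ x → 0# ≤ x ^ n
  0≤^ zero    h = 0≤1
  0≤^ (suc n) h = 0≤* h (0≤^ n h)

  0<^ : ∀ {x} n → 0# < x → 0# < x ^ n
  0<^ zero    h = 0<1
  0<^ (suc n) h = *-pos h (0<^ n h)

  ^-monoˡ-≤ : ∀ {x y} n → 0# ≤ x → x ≤ y → x ^ n ≤ y ^ n
  ^-monoˡ-≤ zero    p q = ≤-refl
  ^-monoˡ-≤ (suc n) p q = *-mono-≤ p q (0≤^ n p) (^-monoˡ-≤ n p q)

  1^ : ∀ n → 1# ^ n ≈ 1#
  1^ zero    = refl
  1^ (suc n) = trans (*-identityˡ _) (1^ n)

  inverse^-correct : ∀ {x} (0<x : 0# < x) n → inverse 0<x ^ n * x ^ n ≈ 1#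
  inverse^-correct 0<x n = trans (sym (^-distrib-* _ _ n)) (trans (^-congˡ n (inverse-correct 0<x)) (1^ n))

  ^≤1 : ∀ {x} n → 0# ≤ x → x ≤ 1# → x ^ n ≤ 1#
  ^≤1 n p q = ≤-trans (^-monoˡ-≤ n p q) (≤-reflexive (1^ n))

  ^-antitone : ∀ {x m n} → 0# ≤ x → x ≤ 1# → m ℕ.≤ n → x ^ n ≤ x ^ m
  ^-antitone {n = n} p q z≤n       = ^≤1 n p q
  ^-antitone         p q (s≤s m≤n) = *-monoˡ-≤ p (^-antitone p q m≤n)

  ∣^∣ : ∀ x n → ∣ x ^ n ∣ ≈ ∣ x ∣ ^ n
  ∣^∣ x zero    = ∣∣-nonneg 0≤1
  ∣^∣ x (suc n) = trans (∣x*y∣ x (x ^ n)) (*-congˡ (∣^∣ x n))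

-- Finite sums and the Cauchy-Schwarz inequality

module RingSums {r₁ r₂ : Level} (R : CommutativeRing r₁ r₂) where
  open CommutativeRing R hiding (zero)
  open RingSolver R
  open import Relation.Binary.Reasoning.Setoid setoid

  -- The last term is split off, as suits partial sums of series. The list sums of the statement
  -- split off the first one; `∑-front` reconciles the two.
  ∑ : ℕ → (ℕ → Carrier) → Carrier
  ∑ zero    f = 0#
  ∑ (suc n) f = ∑ n f + f n

  ∑-cong< : ∀ n {f g} → (∀ i → i ℕ.< n → f i ≈ g i) → ∑ n f ≈ ∑ n g
  ∑-cong< zero    h = refl
  ∑-cong< (suc n) h = +-cong (∑-cong< n (λ i i<n → h i (ℕ.m<n⇒m<1+n i<n))) (h n ℕ.≤-refl)

  ∑-cong : ∀ n {f g} → (∀ i → f i ≈ g i) → ∑ n f ≈ ∑ n g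
  ∑-cong n h = ∑-cong< n (λ i _ → h i)

  ∑-0 : ∀ n {f} → (∀ i → i ℕ.< n → f i ≈ 0#) → ∑ n f ≈ 0#
  ∑-0 zero    h = refl
  ∑-0 (suc n) h = trans (+-cong (∑-0 n (λ i i<n → h i (ℕ.m<n⇒m<1+n i<n))) (h n ℕ.≤-refl)) (+-identityˡ 0#)

  ∑-+ : ∀ n f g → ∑ n (λ i → f i + g i) ≈ ∑ n f + ∑ n g
  ∑-+ zero    f g = sym (+-identityˡ 0#)
  ∑-+ (suc n) f g = trans (+-congʳ (∑-+ n f g))
    (solve 4 (λ s t x y → (s :+ t) :+ (x :+ y) := (s :+ x) :+ (t :+ y)) refl (∑ n f) (∑ n g) (f n) (g n))

  ∑-* : ∀ n a f → ∑ n (λ i → a * f i) ≈ a * ∑ n f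
  ∑-* zero    a f = sym (zeroʳ a)
  ∑-* (suc n) a f = trans (+-congʳ (∑-* n a f)) (sym (distribˡ a (∑ n f) (f n)))

  ∑-neg : ∀ n f → ∑ n (λ i → - f i) ≈ - ∑ n f
  ∑-neg zero    f = solve 0 (:0 := :- :0) refl
  ∑-neg (suc n) f = trans (+-congʳ (∑-neg n f)) (solve 2 (λ s x → :- s :+ :- x := :- (s :+ x)) refl (∑ n f) (f n))

  ∑-- : ∀ n f g → ∑ n (λ i → f i - g i) ≈ ∑ n f - ∑ n g
  ∑-- n f g = trans (∑-+ n f (λ i → - g i)) (+-congˡ (∑-neg n g))

  ∑-swap : ∀ m n (f : ℕ → ℕ → Carrier) → ∑ m (λ i → ∑ n (f i)) ≈ ∑ n (λ j → ∑ m (λ i → f i j))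
  ∑-swap zero    n f = sym (∑-0 n (λ _ _ → refl))
  ∑-swap (suc m) n f = trans (+-congʳ (∑-swap m n f)) (sym (∑-+ n _ (f m)))

  ∑-front : ∀ n f → ∑ (suc n) f ≈ f 0 + ∑ n (f ∘ suc)
  ∑-front zero    f = +-comm 0# (f 0)
  ∑-front (suc n) f = trans (+-congʳ (∑-front n f)) (+-assoc (f 0) _ _)

  ∑-split : ∀ m n f → ∑ (m ℕ.+ n) f ≈ ∑ m f + ∑ n (λ i → f (m ℕ.+ i))
  ∑-split zero    n f = sym (+-identityˡ _)
  ∑-split (suc m) n f = begin
    ∑ (suc (m ℕ.+ n)) f  ≈⟨ ∑-front (m ℕ.+ n) f ⟩
    f 0 + ∑ (m ℕ.+ n) (f ∘ suc)  ≈⟨ +-congˡ (∑-split m n (f ∘ suc)) ⟩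
    f 0 + (∑ m (f ∘ suc) + ∑ n (λ i → f (suc m ℕ.+ i)))  ≈⟨ +-assoc (f 0) _ _ ⟨
    (f 0 + ∑ m (f ∘ suc)) + ∑ n (λ i → f (suc m ℕ.+ i))  ≈⟨ +-congʳ (∑-front m f) ⟨
    ∑ (suc m) f + ∑ n (λ i → f (suc m ℕ.+ i))  ∎

module FiniteSums {c ℓ₁ ℓ₂ : Level} (ℝ : RealField c ℓ₁ ℓ₂) where
  open OrderedField ℝ public
  open Complex ℝ using (module ℝΣ)
  open RingSums commutativeRing public

  ∑-mono : ∀ n {f g} → (∀ i → i ℕ.< n → f i ≤ g i) → ∑ n f ≤ ∑ n g
  ∑-mono zero    h = ≤-refl
  ∑-mono (suc n) h = +-mono-≤ (∑-mono n (λ i i<n → h i (ℕ.m<n⇒m<1+n i<n))) (h n ℕ.≤-refl)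

  ∑-nonneg : ∀ n {f} → (∀ i → 0# ≤ f i) → 0# ≤ ∑ n f
  ∑-nonneg n h = ≤-resp (∑-0 n (λ _ _ → refl)) refl (∑-mono n (λ i _ → h i))

  ∑-extend : ∀ {m n f} → (∀ i → 0# ≤ f i) → m ℕ.≤ n → ∑ m f ≤ ∑ n f
  ∑-extend {m} {n} {f} h m≤n = go (ℕ.≤⇒≤′ m≤n)
    where
    go : ∀ {n} → m ℕ.≤′ n → ∑ m f ≤ ∑ n f
    go (ℕ.≤′-reflexive ≡.refl) = ≤-refl
    go (ℕ.≤′-step {n} p) = ≤-trans (go p) (≤-by (h n) refl)

  ∣∑∣≤ : ∀ n f → ∣ ∑ n f ∣ ≤ ∑ n (λ i → ∣ f i ∣)
  ∣∑∣≤ zero    f = ≤-reflexive (∣∣-nonneg ≤-refl)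
  ∣∑∣≤ (suc n) f = ≤-trans (∣x+y∣≤ (∑ n f) (f n)) (+-monoˡ-≤ ∣ f n ∣ (∣∑∣≤ n f))

  ∑-term≤ : ∀ {n f i} → (∀ i → 0# ≤ f i) → i ℕ.< n → f i ≤ ∑ n f
  ∑-term≤ {i = i} h i<n = ≤-trans (≤-by (∑-nonneg i h) (+-comm _ _)) (∑-extend h i<n)

  -- The function `g` is arbitrary because unfolding `applyUpTo` replaces it by `g ∘ suc`.
  Σ-applyUpTo : ∀ n (f : ℕ → Carrier) (g : ℕ → ℕ) → ℝΣ.Σ[ applyUpTo g n ] f ≈ ∑ n (f ∘ g)
  Σ-applyUpTo zero    f g = refl
  Σ-applyUpTo (suc n) f g = trans (+-congˡ (Σ-applyUpTo n f (g ∘ suc))) (sym (∑-front n (f ∘ g)))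

  Σ-upTo : ∀ n (f : ℕ → Carrier) → ℝΣ.Σ[ upTo n ] f ≈ ∑ n f
  Σ-upTo n f = Σ-applyUpTo n f id

  -- Lagrange's identity with the difference of the two sides kept as a sum of squares.
  cauchy-schwarz : ∀ n (f g : ℕ → Carrier) → ∑ n (λ i → f i * g i) * ∑ n (λ i → f i * g i) ≤
                             ∑ n (λ i → f i * f i) * ∑ n (λ i → g i * g i)
  cauchy-schwarz zero    f g = ≤-reflexive refl
  cauchy-schwarz (suc n) f g = ≤-by (0≤+ (≤⇒0≤- (cauchy-schwarz n f g)) 0≤D)
    (trans (solve 5 (λ A B S x y → (A :+ x :* x) :* (B :+ y :* y) :=
        (S :+ x :* y) :* (S :+ x :* y) :+ ((A :* B :- S :* S) :+ (y :* y :* A :- :2 :* x :* y :* S :+ x :* x :* B)))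
        refl A B S x y)
      (+-congˡ (+-congˡ (sym (D≈ n)))))
    where
    A = ∑ n (λ i → f i * f i)
    B = ∑ n (λ i → g i * g i)
    S = ∑ n (λ i → f i * g i)
    x = f n
    y = g n
    -- x and y stay fixed at index n while the length k varies, so that `D≈` can be proved by
    -- induction on k.
    D : ℕ → Carrier
    D k = ∑ k (λ i → (f i * y - x * g i) * (f i * y - x * g i))
    0≤D : 0# ≤ D n
    0≤D = ∑-nonneg n (λ i → 0≤square _)
    D≈ : ∀ k → D k ≈ y * y * ∑ k (λ i → f i * f i) - 2# * x * y * ∑ k (λ i → f i * g i)
                     + x * x * ∑ k (λ i → g i * g i)
    D≈ zero    = solve 2 (λ x y → :0 := y :* y :* :0 :- :2 :* x :* y :* :0 :+ x :* x :* :0) refl x y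
    D≈ (suc k) = trans (+-congʳ (D≈ k))
      (solve 7 (λ x y A B S u v →
         (y :* y :* A :- :2 :* x :* y :* S :+ x :* x :* B) :+ (u :* y :- x :* v) :* (u :* y :- x :* v) :=
         y :* y :* (A :+ u :* u) :- :2 :* x :* y :* (S :+ u :* v) :+ x :* x :* (B :+ v :* v))
        refl x y (∑ k (λ i → f i * f i)) (∑ k (λ i → g i * g i)) (∑ k (λ i → f i * g i)) (f k) (g k))

-- Limits along nets, shared by sequences and by sums over finite subsets

record Net : Set₁ where
  field
    Index Tail : Set
    _∋_        : Tail → Index → Set
    top        : Tail
    meet       : ∀ s t → Σ[ u ∈ Tail ] (∀ j → u ∋ j → s ∋ j × t ∋ j)
    -- Tails must be inhabited: inequalities and uniqueness of limits are read off at a single index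
    -- of a common tail.
    point      : ∀ t → Σ[ j ∈ Index ] t ∋ j

  Eventually : ∀ {p} → (Index → Set p) → Set p
  Eventually P = Σ[ t ∈ Tail ] (∀ j → t ∋ j → P j)

  always : ∀ {p} {P : Index → Set p} → (∀ j → P j) → Eventually P
  always h = top , λ j _ → h j

  ev-map : ∀ {p q} {P : Index → Set p} {Q : Index → Set q} → (∀ j → P j → Q j) → Eventually P → Eventually Q
  ev-map f (t , h) = t , λ j t∋j → f j (h j t∋j)

  ev-zip : ∀ {p q r} {P : Index → Set p} {Q : Index → Set q} {R : Index → Set r} →
           (∀ j → P j → Q j → R j) → Eventually P → Eventually Q → Eventually R
  ev-zip f (s , h) (t , k) = let u , m = meet s t in
    u , λ j u∋j → f j (h j (proj₁ (m j u∋j))) (k j (proj₂ (m j u∋j)))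

ℕ-net : Net
ℕ-net = record
  { Index = ℕ ; Tail = ℕ ; _∋_ = ℕ._≤_ ; top = 0
  ; meet  = λ s t → s ℕ.⊔ t , λ j h → ℕ.≤-trans (ℕ.m≤m⊔n s t) h , ℕ.≤-trans (ℕ.m≤n⊔m s t) h
  ; point = λ t → t , ℕ.≤-refl
  }

module Limits {c ℓ₁ ℓ₂ : Level} (ℝ : RealField c ℓ₁ ℓ₂) (N : Net) where
  open FiniteSums ℝ
  open Net N public

  -- The bound is `≤ ε`, which survives limits and sums; returning to the strict bound of the
  -- statement only costs a factor `½` in ε.
  record Lim (f : Index → Carrier) (l : Carrier) : Set (c ⊔ ℓ₂) where
    constructor lim
    field near : ∀ ε → 0# < ε → Eventually (λ j → ∣ f j - l ∣ ≤ ε)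
  open Lim public

  lim-cong : ∀ {f g l m} → Eventually (λ j → f j ≈ g j) → l ≈ m → Lim f l → Lim g m
  lim-cong e l≈m (lim h) = lim λ ε 0<ε → ev-zip (λ j p q → ≤-resp (∣∣-cong (+-cong p (-‿cong l≈m))) refl q) e (h ε 0<ε)

  lim-const : ∀ a → Lim (λ _ → a) a
  lim-const a = lim λ ε 0<ε → always (λ _ → ≤-resp (trans (sym (∣∣-nonneg ≤-refl)) (∣∣-cong (sym (-‿inverseʳ a)))) refl (<⇒≤ 0<ε))

  lim-+ : ∀ {f g l m} → Lim f l → Lim g m → Lim (λ j → f j + g j) (l + m)
  lim-+ {f} {g} {l} {m} (lim p) (lim q) = lim λ ε 0<ε → ev-zip (λ j a b → ≤-trans
      (≤-resp (∣∣-cong (solve 4 (λ x y l m → (x :- l) :+ (y :- m) := (x :+ y) :- (l :+ m)) refl (f j) (g j) l m)) refl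
        (∣x+y∣≤ (f j - l) (g j - m)))
      (≤-resp refl (½+½ ε) (+-mono-≤ a b)))
    (p (½ * ε) (0<½* 0<ε)) (q (½ * ε) (0<½* 0<ε))

  -- ε is divided by `1# + K` and not by K, since K may be zero and whether it is need not be
  -- decidable.
  lim-from-multiple : ∀ {f l} K → 0# ≤ K → (∀ ε → 0# < ε → Eventually (λ j → ∣ f j - l ∣ ≤ K * ε)) → Lim f l
  lim-from-multiple K 0≤K h = lim λ ε 0<ε → ev-map (λ j p → ≤-trans p (bound ε 0<ε)) (h (inverse 0<1+K * ε) (*-pos (0<inverse 0<1+K) 0<ε))
    where
    0<1+K : 0# < 1# + K
    0<1+K = 0<+ 0<1 0≤K
    i = inverse 0<1+K
    bound : ∀ ε → 0# < ε → K * (i * ε) ≤ ε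
    bound ε 0<ε = ≤-by (0≤* (<⇒≤ (0<inverse 0<1+K)) (<⇒≤ 0<ε))
      (trans (sym (*-identityˡ ε)) (trans (*-congʳ (sym (inverse-correct 0<1+K)))
        (solve 3 (λ K i e → (i :* (:1 :+ K)) :* e := K :* (i :* e) :+ i :* e) refl K i ε)))

  lim-* : ∀ {f l} a → Lim f l → Lim (λ j → a * f j) (a * l)
  lim-* {f} {l} a (lim p) = lim-from-multiple ∣ a ∣ (0≤∣∣ a) λ ε 0<ε → ev-map (λ j q →
    ≤-resp (trans (sym (∣x*y∣ a (f j - l))) (∣∣-cong (solve 3 (λ a x l → a :* (x :- l) := a :* x :- a :* l) refl a (f j) l)))
      refl (*-monoˡ-≤ (0≤∣∣ a) q)) (p ε 0<ε)

  lim-neg : ∀ {f l} → Lim f l → Lim (λ j → - f j) (- l)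
  lim-neg {f} {l} (lim p) = lim λ ε 0<ε → ev-map (λ j q → ≤-resp (trans (sym (∣-∣ (f j - l)))
    (∣∣-cong (solve 2 (λ x l → :- (x :- l) := :- x :- :- l) refl (f j) l))) refl q) (p ε 0<ε)

  lim-- : ∀ {f g l m} → Lim f l → Lim g m → Lim (λ j → f j - g j) (l - m)
  lim-- p q = lim-+ p (lim-neg q)

  lim-∑ : ∀ n {f : ℕ → Index → Carrier} {l} → (∀ i → i ℕ.< n → Lim (f i) (l i)) → Lim (λ j → ∑ n (λ i → f i j)) (∑ n l)
  lim-∑ zero    h = lim-const 0#
  lim-∑ (suc n) h = lim-+ (lim-∑ n (λ i i<n → h i (ℕ.m<n⇒m<1+n i<n))) (h n ℕ.≤-refl)

  lim-≤ : ∀ {f g l m} → Eventually (λ j → f j ≤ g j) → Lim f l → Lim g m → l ≤ m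
  lim-≤ {f} {g} {l} {m} e (lim p) (lim q) = ≤-of-≤+ε λ ε 0<ε →
    let t , h = ev-zip (λ _ → _,_) e (ev-zip (λ _ → _,_) (p (½ * ε) (0<½* 0<ε)) (q (½ * ε) (0<½* 0<ε)))
        j , t∋j = point t
        f≤g , a , b = h j t∋j
    in begin
      l  ≈⟨ solve 2 (λ l x → l := x :+ :- (x :- l)) refl l (f j) ⟩
      f j + - (f j - l)  ≤⟨ +-mono-≤ f≤g (≤-trans (-x≤∣x∣ (f j - l)) a) ⟩
      g j + ½ * ε  ≈⟨ solve 3 (λ y m e → y :+ e := (m :+ e) :+ (y :- m)) refl (g j) m (½ * ε) ⟩
      (m + ½ * ε) + (g j - m)  ≤⟨ +-monoʳ-≤ _ (≤-trans (x≤∣x∣ (g j - m)) b) ⟩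
      (m + ½ * ε) + ½ * ε  ≈⟨ trans (+-assoc m _ _) (+-congˡ (½+½ ε)) ⟩
      m + ε  ∎
    where open ≤-Reasoning

  lim-unique : ∀ {f l m} → Lim f l → Lim f m → l ≈ m
  lim-unique p q = ≤-antisym (lim-≤ (always (λ _ → ≤-refl)) p q) (lim-≤ (always (λ _ → ≤-refl)) q p)

  lim-∣∣≤ : ∀ {f g l m} → Eventually (λ j → ∣ f j ∣ ≤ g j) → Lim f l → Lim g m → ∣ l ∣ ≤ m
  lim-∣∣≤ {f} e p q = ∣∣≤ (lim-≤ (ev-map (λ j h → ≤-trans (x≤∣x∣ (f j)) h) e) p q)
                          (lim-≤ (ev-map (λ j h → ≤-trans (-x≤∣x∣ (f j)) h) e) (lim-neg p) q)

  lim-squeeze : ∀ {f g l} → Eventually (λ j → ∣ f j - l ∣ ≤ g j) → Lim g 0# → Lim f l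
  lim-squeeze {f} {g} {l} e (lim q) = lim λ ε 0<ε → ev-zip (λ j a b → ≤-trans a (≤-trans
      (≤-resp refl (∣∣-cong (solve 1 (λ x → x := x :- :0) refl (g j))) (x≤∣x∣ (g j))) b)) e (q ε 0<ε)

-- Sequences, completeness and domination by geometric series

module Sequences {c ℓ₁ ℓ₂ : Level} (ℝ : RealField c ℓ₁ ℓ₂) where
  open FiniteSums ℝ
  open Limits ℝ ℕ-net

  lim-shift : ∀ {f l} k → Lim f l → Lim (λ n → f (k ℕ.+ n)) l
  lim-shift k (lim p) = lim λ ε 0<ε → let t , h = p ε 0<ε in t , λ n t≤n → h (k ℕ.+ n) (ℕ.≤-trans t≤n (ℕ.m≤n+m n k))

  complete-lim : ∀ {f} → (∀ ε → 0# < ε → Σ[ N ∈ ℕ ] (∀ n → ∣ f (N ℕ.+ n) - f N ∣ ≤ ε)) → Σ[ l ∈ Carrier ] Lim f l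
  complete-lim {f} h = proj₁ l , lim λ ε 0<ε → proj₁ (proj₂ l ε 0<ε) , λ n N≤n → <⇒≤ (proj₂ (proj₂ l ε 0<ε) n N≤n)
    where
    cauchy : Cauchy f
    cauchy ε 0<ε = N , λ m n N≤m N≤n → ≤-<-trans
        (≤-resp (∣∣-cong (solve 3 (λ x y z → (x :- z) :- (y :- z) := x :- y) refl (f m) (f n) (f N))) (½+½ (½ * ε))
          (≤-trans (∣x-y∣≤ (f m - f N) (f n - f N)) (+-mono-≤ (close m N≤m) (close n N≤n))))
        (½*< 0<ε)
      where
      -- Two differences of size δ add up to `½ * ε`, strictly below ε as `Cauchy` demands.
      δ = ½ * (½ * ε)
      N = proj₁ (h δ (0<½* (0<½* 0<ε)))
      close : ∀ m → N ℕ.≤ m → ∣ f m - f N ∣ ≤ δ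
      close m N≤m = ≡.subst (λ k → ∣ f k - f N ∣ ≤ δ) (ℕ.m+[n∸m]≡n N≤m) (proj₂ (h δ (0<½* (0<½* 0<ε))) (m ℕ.∸ N))
    l = complete f cauchy

  Series : (ℕ → Carrier) → Carrier → Set (c ⊔ ℓ₂)
  Series f s = Lim (λ n → ∑ n f) s

  fromℕ-nonneg : ∀ n → 0# ≤ fromℕ n
  fromℕ-nonneg zero    = ≤-refl
  fromℕ-nonneg (suc n) = 0≤+ 0≤1 (fromℕ-nonneg n)

  module Geometric (θ : Carrier) (0≤θ : 0# ≤ θ) (θ<1 : θ < 1#) where

    private
      d = 1# - θ
      0<d : 0# < d
      0<d = <⇒0<- θ<1

    -- 1/(1 - θ), the sum of the whole geometric series; later constants are expressed through it.
    γ : Carrier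
    γ = inverse 0<d

    0<γ : 0# < γ
    0<γ = 0<inverse 0<d

    ∑θ^≈ : ∀ n → ∑ n (θ ^_) ≈ γ * (1# - θ ^ n)
    ∑θ^≈ n = trans (trans (sym (*-identityˡ _)) (*-congʳ (sym (inverse-correct 0<d))))
      (trans (*-assoc γ d _) (*-congˡ (telescope n)))
      where
      telescope : ∀ n → d * ∑ n (θ ^_) ≈ 1# - θ ^ n
      telescope zero    = solve 1 (λ t → (:1 :- t) :* :0 := :1 :- :1) refl θ
      telescope (suc n) = trans (distribˡ d (∑ n (θ ^_)) (θ ^ n)) (trans (+-congʳ (telescope n))
        (solve 2 (λ t p → (:1 :- p) :+ (:1 :- t) :* p := :1 :- t :* p) refl θ (θ ^ n)))

    ∑θ^≤γ : ∀ n → ∑ n (θ ^_) ≤ γ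
    ∑θ^≤γ n = ≤-by (0≤* (<⇒≤ 0<γ) (0≤^ n 0≤θ)) (trans (solve 2 (λ g p → g := g :* (:1 :- p) :+ g :* p) refl γ (θ ^ n))
      (+-congʳ (sym (∑θ^≈ n))))

    -- Bernoulli's inequality for 1/θ, multiplied out.
    bernoulli : ∀ n → θ ^ n * (1# + fromℕ n * d) ≤ 1#
    bernoulli zero    = ≤-reflexive (solve 1 (λ d → :1 :* (:1 :+ :0 :* d) := :1) refl d)
    bernoulli (suc n) = ≤-trans (≤-by (0≤* (0≤^ n 0≤θ) (0≤* (0≤+ 0≤1 (fromℕ-nonneg n)) (0≤square d)))
      (solve 3 (λ t p k → p :* (:1 :+ k :* (:1 :- t)) :=
          t :* p :* (:1 :+ (:1 :+ k) :* (:1 :- t)) :+ p :* ((:1 :+ k) :* ((:1 :- t) :* (:1 :- t))))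
        refl θ (θ ^ n) (fromℕ n))) (bernoulli n)

    -- For N above 1/(d ε), Bernoulli gives θᴺ (1 + N d) ≤ 1 ≤ N d ε ≤ (1 + N d) ε, and 1 + N d
    -- cancels.
    private module Radius (ε : Carrier) (0<ε : 0# < ε) where
      0<dε = *-pos 0<d 0<ε
      N = proj₁ (archimedean (inverse 0<dε))
      a = fromℕ N
      1≤aεd : 1# ≤ a * d * ε
      1≤aεd = ≤-resp (inverse-correctʳ 0<dε) (solve 3 (λ a d e → (d :* e) :* a := a :* d :* e) refl a d ε)
        (*-monoˡ-≤ (<⇒≤ 0<dε) (<⇒≤ (proj₂ (archimedean (inverse 0<dε)))))
      bound : θ ^ N ≤ ε
      bound = *-cancelˡ-≤ (0<+ 0<1 (0≤* (fromℕ-nonneg N) (<⇒≤ 0<d))) (≤-trans (≤-resp (*-comm _ _) refl (bernoulli N))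
        (≤-trans 1≤aεd (≤-by (<⇒≤ 0<ε) (solve 3 (λ a d e → (:1 :+ a :* d) :* e := a :* d :* e :+ e) refl a d ε))))

    θ^→0 : Lim (θ ^_) 0#
    θ^→0 = lim λ ε 0<ε → let open Radius ε 0<ε in N , λ n N≤n → ≤-resp (trans (sym (∣∣-nonneg (0≤^ n 0≤θ))) (∣∣-cong (solve 1 (λ x → x := x :- :0) refl (θ ^ n))))
        refl (≤-trans (^-antitone 0≤θ (<⇒≤ θ<1) N≤n) bound)

    dominated-tail : ∀ {f} D → (∀ k → ∣ f k ∣ ≤ D * θ ^ k) → ∀ N n → ∣ ∑ (N ℕ.+ n) f - ∑ N f ∣ ≤ (D * γ) * θ ^ N
    dominated-tail {f} D h N n = begin
      ∣ ∑ (N ℕ.+ n) f - ∑ N f ∣  ≈⟨ ∣∣-cong (trans (+-congʳ (∑-split N n f))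
                                                 (solve 2 (λ x y → (x :+ y) :- x := y) refl (∑ N f) _)) ⟩
      ∣ ∑ n (λ i → f (N ℕ.+ i)) ∣  ≤⟨ ∣∑∣≤ n _ ⟩
      ∑ n (λ i → ∣ f (N ℕ.+ i) ∣)  ≤⟨ ∑-mono n (λ i _ → ≤-trans (h (N ℕ.+ i)) (≤-reflexive
                                                 (trans (*-congˡ (^-homo-* θ N i)) (sym (*-assoc D _ _))))) ⟩
      ∑ n (λ i → (D * θ ^ N) * θ ^ i)       ≈⟨ ∑-* n (D * θ ^ N) (θ ^_) ⟩
      (D * θ ^ N) * ∑ n (θ ^_)  ≤⟨ *-monoˡ-≤ 0≤DθN (∑θ^≤γ n) ⟩
      (D * θ ^ N) * γ  ≈⟨ solve 3 (λ D t g → (D :* t) :* g := (D :* g) :* t) refl D (θ ^ N) γ ⟩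
      (D * γ) * θ ^ N  ∎
      where
      open ≤-Reasoning
      0≤DθN : 0# ≤ D * θ ^ N
      0≤DθN = ≤-trans (0≤∣∣ (f N)) (h N)

    -- The one place where completeness enters: every limit that the proof has to construct is that
    -- of a geometrically dominated series.
    dominated-series : ∀ {f} D → (∀ k → ∣ f k ∣ ≤ D * θ ^ k) → Σ[ s ∈ Carrier ] Series f s
    dominated-series {f} D h = complete-lim λ ε 0<ε → map₂ (λ {N} p n →
        ≤-trans (dominated-tail D h N n) (drop (p N ℕ.≤-refl))) (near small ε 0<ε)
      where
      small : Lim (λ N → (D * γ) * θ ^ N) 0#
      small = lim-cong (always (λ _ → refl)) (zeroʳ (D * γ)) (lim-* (D * γ) θ^→0)
      drop : ∀ {x ε} → ∣ x - 0# ∣ ≤ ε → x ≤ ε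
      drop {x} h = ≤-trans (≤-resp (x-0≈x x) refl (x≤∣x∣ (x - 0#))) h

    dominated-bound : ∀ {f s} D → (∀ k → ∣ f k ∣ ≤ D * θ ^ k) → Series f s → ∀ N → ∣ s - ∑ N f ∣ ≤ (D * γ) * θ ^ N
    dominated-bound {f} {s} D h p N = lim-∣∣≤ (always (dominated-tail D h N)) (lim-- (lim-shift N p) (lim-const (∑ N f))) (lim-const ((D * γ) * θ ^ N))

-- The ring of complex numbers and its squared modulus

module ComplexNumbers {c ℓ₁ ℓ₂ : Level} (ℝ : RealField c ℓ₁ ℓ₂) where
  open FiniteSums ℝ public
  open Complex ℝ using (ℂ; _+i_; re; im; conj; ofℝ; 0ℂ; 1ℂ; ∣_∣²; module ℝΣ; module ℂΣ; MonicPoly; eval) public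
  module ℂᵒ = Complex ℝ
  open ℂᵒ using () renaming (_≈_ to _≈ᶜ_; _+_ to _+ᶜ_; _*_ to _*ᶜ_; -_ to -ᶜ_; _-_ to _-ᶜ_; _^_ to _^ᶜ_) public

  private
    ≈ᶜ-isEquivalence : IsEquivalence _≈ᶜ_
    ≈ᶜ-isEquivalence = record
      { refl  = refl , refl
      ; sym   = λ (p , q) → sym p , sym q
      ; trans = λ (p , q) (p′ , q′) → trans p p′ , trans q q′
      }

    ℂ-setoid : Setoid c ℓ₁
    ℂ-setoid = record { isEquivalence = ≈ᶜ-isEquivalence }

    open Algebra.Consequences.Setoid ℂ-setoid using (comm∧idˡ⇒id; comm∧distrˡ⇒distr)

    *ᶜ-comm : ∀ z u → z *ᶜ u ≈ᶜ u *ᶜ z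
    *ᶜ-comm z u = solve 4 (λ x y u v → x :* u :- y :* v := u :* x :- v :* y) refl (re z) (im z) (re u) (im u)
                , solve 4 (λ x y u v → x :* v :+ y :* u := u :* y :+ v :* x) refl (re z) (im z) (re u) (im u)

    ℂ-isCommutativeRing : IsCommutativeRing _≈ᶜ_ _+ᶜ_ _*ᶜ_ -ᶜ_ 0ℂ 1ℂ
    ℂ-isCommutativeRing = record
      { isRing = record
        { +-isAbelianGroup = record
          { isGroup = record
            { isMonoid = record
              { isSemigroup = record
                { isMagma = record
                  { isEquivalence = ≈ᶜ-isEquivalence
                  ; ∙-cong = λ (p , q) (p′ , q′) → +-cong p p′ , +-cong q q′
                  }
                ; assoc = λ z u v → +-assoc (re z) (re u) (re v) , +-assoc (im z) (im u) (im v)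
                }
              ; identity = (λ z → +-identityˡ (re z) , +-identityˡ (im z)) , (λ z → +-identityʳ (re z) , +-identityʳ (im z))
              }
            ; inverse = (λ z → -‿inverseˡ (re z) , -‿inverseˡ (im z)) , (λ z → -‿inverseʳ (re z) , -‿inverseʳ (im z))
            ; ⁻¹-cong = λ (p , q) → -‿cong p , -‿cong q
            }
          ; comm = λ z u → +-comm (re z) (re u) , +-comm (im z) (im u)
          }
        ; *-cong = λ (p , q) (p′ , q′) → +-cong (*-cong p p′) (-‿cong (*-cong q q′)) , +-cong (*-cong p q′) (*-cong q p′)
        ; *-assoc = λ z u v →
            solve 6 (λ x y u v s t → (x :* u :- y :* v) :* s :- (x :* v :+ y :* u) :* t :=
                                     x :* (u :* s :- v :* t) :- y :* (u :* t :+ v :* s)) refl (re z) (im z) (re u) (im u) (re v) (im v)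
          , solve 6 (λ x y u v s t → (x :* u :- y :* v) :* t :+ (x :* v :+ y :* u) :* s :=
                                     x :* (u :* t :+ v :* s) :+ y :* (u :* s :- v :* t)) refl (re z) (im z) (re u) (im u) (re v) (im v)
        ; *-identity = comm∧idˡ⇒id *ᶜ-comm (λ z →
              solve 2 (λ x y → :1 :* x :- :0 :* y := x) refl (re z) (im z)
            , solve 2 (λ x y → :1 :* y :+ :0 :* x := y) refl (re z) (im z))
        ; distrib = comm∧distrˡ⇒distr (λ (p , q) (p′ , q′) → +-cong p p′ , +-cong q q′) *ᶜ-comm (λ z u v →
              solve 6 (λ x y u v s t → x :* (u :+ s) :- y :* (v :+ t) := (x :* u :- y :* v) :+ (x :* s :- y :* t))
                refl (re z) (im z) (re u) (im u) (re v) (im v)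
            , solve 6 (λ x y u v s t → x :* (v :+ t) :+ y :* (u :+ s) := (x :* v :+ y :* u) :+ (x :* t :+ y :* s))
                refl (re z) (im z) (re u) (im u) (re v) (im v))
        }
      ; *-comm = *ᶜ-comm
      }

  ℂ-ring : CommutativeRing c ℓ₁
  ℂ-ring = record { isCommutativeRing = ℂ-isCommutativeRing }

  module ℂR = CommutativeRing ℂ-ring
  module ℂS = RingSolver ℂ-ring
  open RingSums ℂ-ring public using () renaming
    ( ∑ to ∑ᶜ; ∑-cong to ∑ᶜ-cong; ∑-cong< to ∑ᶜ-cong<; ∑-0 to ∑ᶜ-0; ∑-+ to ∑ᶜ-+; ∑-* to ∑ᶜ-*; ∑-- to ∑ᶜ--
    ; ∑-swap to ∑ᶜ-swap; ∑-front to ∑ᶜ-front; ∑-split to ∑ᶜ-split )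

  re-∑ : ∀ n f → re (∑ᶜ n f) ≡ ∑ n (re ∘ f)
  re-∑ zero    f = ≡.refl
  re-∑ (suc n) f = ≡.cong (_+ re (f n)) (re-∑ n f)

  im-∑ : ∀ n f → im (∑ᶜ n f) ≡ ∑ n (im ∘ f)
  im-∑ zero    f = ≡.refl
  im-∑ (suc n) f = ≡.cong (_+ im (f n)) (im-∑ n f)

  re-Σ : ∀ {i} {I : Set i} (is : List I) (f : I → ℂ) → re (ℂΣ.Σ[ is ] f) ≡ ℝΣ.Σ[ is ] (re ∘ f)
  re-Σ []       f = ≡.refl
  re-Σ (i ∷ is) f = ≡.cong (re (f i) +_) (re-Σ is f)

  im-Σ : ∀ {i} {I : Set i} (is : List I) (f : I → ℂ) → im (ℂΣ.Σ[ is ] f) ≡ ℝΣ.Σ[ is ] (im ∘ f)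
  im-Σ []       f = ≡.refl
  im-Σ (i ∷ is) f = ≡.cong (im (f i) +_) (im-Σ is f)

  Σ-upToᶜ : ∀ n (f : ℕ → ℂ) → ℂΣ.Σ[ upTo n ] f ≈ᶜ ∑ᶜ n f
  Σ-upToᶜ n f = trans (reflexive (re-Σ (upTo n) f)) (trans (Σ-upTo n (re ∘ f)) (reflexive (≡.sym (re-∑ n f))))
              , trans (reflexive (im-Σ (upTo n) f)) (trans (Σ-upTo n (im ∘ f)) (reflexive (≡.sym (im-∑ n f))))

  ofℝ-+ : ∀ x y → ofℝ (x + y) ≈ᶜ ofℝ x +ᶜ ofℝ y
  ofℝ-+ x y = refl , sym (+-identityˡ 0#)

  ofℝ-* : ∀ x y → ofℝ (x * y) ≈ᶜ ofℝ x *ᶜ ofℝ y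
  ofℝ-* x y = solve 2 (λ x y → x :* y := x :* y :- :0 :* :0) refl x y
            , solve 2 (λ x y → :0 := x :* :0 :+ :0 :* y) refl x y

  ofℝ-cong : ∀ {x y} → x ≈ y → ofℝ x ≈ᶜ ofℝ y
  ofℝ-cong p = p , refl

  ofℝ-^ : ∀ x n → ofℝ (x ^ n) ≈ᶜ ofℝ x ^ᶜ n
  ofℝ-^ x zero    = ℂR.refl
  ofℝ-^ x (suc n) = ℂR.trans (ofℝ-* x (x ^ n)) (ℂR.*-congˡ (ofℝ-^ x n))

  ofℝ-∑ : ∀ n f → ofℝ (∑ n f) ≈ᶜ ∑ᶜ n (ofℝ ∘ f)
  ofℝ-∑ zero    f = ℂR.refl
  ofℝ-∑ (suc n) f = ℂR.trans (ofℝ-+ (∑ n f) (f n)) (ℂR.+-congʳ (ofℝ-∑ n f))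

  ^ᶜ-cong : ∀ j {u v} → u ≈ᶜ v → u ^ᶜ j ≈ᶜ v ^ᶜ j
  ^ᶜ-cong zero    e = ℂR.refl
  ^ᶜ-cong (suc j) e = ℂR.*-cong e (^ᶜ-cong j e)

  re-ofℝ* : ∀ x z → re (ofℝ x *ᶜ z) ≈ x * re z
  re-ofℝ* x z = solve 3 (λ x u v → x :* u :- :0 :* v := x :* u) refl x (re z) (im z)

  im-ofℝ* : ∀ x z → im (ofℝ x *ᶜ z) ≈ x * im z
  im-ofℝ* x z = solve 3 (λ x u v → x :* v :+ :0 :* u := x :* v) refl x (re z) (im z)

  re-*ofℝ : ∀ z x → re (z *ᶜ ofℝ x) ≈ x * re z
  re-*ofℝ z x = solve 3 (λ x u v → u :* x :- v :* :0 := x :* u) refl x (re z) (im z)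

  im-*ofℝ : ∀ z x → im (z *ᶜ ofℝ x) ≈ x * im z
  im-*ofℝ z x = solve 3 (λ x u v → u :* :0 :+ v :* x := x :* v) refl x (re z) (im z)

  ∣∣²-* : ∀ z u → ∣ z *ᶜ u ∣² ≈ ∣ z ∣² * ∣ u ∣²
  ∣∣²-* z u = solve 4 (λ x y u v → (x :* u :- y :* v) :* (x :* u :- y :* v) :+ (x :* v :+ y :* u) :* (x :* v :+ y :* u) :=
    (x :* x :+ y :* y) :* (u :* u :+ v :* v)) refl (re z) (im z) (re u) (im u)

  ∣∣²-cong : ∀ {z u} → z ≈ᶜ u → ∣ z ∣² ≈ ∣ u ∣²
  ∣∣²-cong (p , q) = +-cong (*-cong p p) (*-cong q q)

  ∣∣²-^ : ∀ z n → ∣ z ^ᶜ n ∣² ≈ ∣ z ∣² ^ n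
  ∣∣²-^ z zero    = solve 0 (:1 :* :1 :+ :0 :* :0 := :1) refl
  ∣∣²-^ z (suc n) = trans (∣∣²-* z (z ^ᶜ n)) (*-congˡ (∣∣²-^ z n))

  0≤∣∣² : ∀ z → 0# ≤ ∣ z ∣²
  0≤∣∣² z = 0≤+ (0≤square (re z)) (0≤square (im z))

  re²≤∣∣² : ∀ z → re z * re z ≤ ∣ z ∣²
  re²≤∣∣² z = ≤-by (0≤square (im z)) refl

  im²≤∣∣² : ∀ z → im z * im z ≤ ∣ z ∣²
  im²≤∣∣² z = ≤-by (0≤square (re z)) (+-comm _ _)

  ∣re∣≤ : ∀ {z a} → 0# ≤ a → ∣ z ∣² ≤ a * a → ∣ re z ∣ ≤ a
  ∣re∣≤ {z} 0≤a h = ∣x∣≤y-from-squares 0≤a (≤-trans (re²≤∣∣² z) h)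

  ∣im∣≤ : ∀ {z a} → 0# ≤ a → ∣ z ∣² ≤ a * a → ∣ im z ∣ ≤ a
  ∣im∣≤ {z} 0≤a h = ∣x∣≤y-from-squares 0≤a (≤-trans (im²≤∣∣² z) h)

  near-from-parts : ∀ {z ε} → 0# < ε → ∣ re z ∣ ≤ ½ * ε → ∣ im z ∣ ≤ ½ * ε → ∣ z ∣² < ε * ε
  near-from-parts {z} {ε} 0<ε p q = ≤-<-trans (+-mono-≤ (square≤-from-∣∣ p) (square≤-from-∣∣ q))
    (<-by (*-pos 0<h (*-pos 0<2 0<h)) (trans (*-cong (sym (½+½ ε)) (sym (½+½ ε)))
      (solve 1 (λ h → (h :+ h) :* (h :+ h) := (h :* h :+ h :* h) :+ h :* (:2 :* h)) refl (½ * ε))))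
    where 0<h = 0<½* 0<ε

-- Polynomial coefficients under affine substitutions

module Coefficients {c ℓ₁ ℓ₂ : Level} (ℝ : RealField c ℓ₁ ℓ₂) where
  open ComplexNumbers ℝ

  -- powerCoeff a s j k is the coefficient of yᵏ in (a + s y)ʲ.
  powerCoeff : Carrier → Carrier → ℕ → ℕ → Carrier
  powerCoeff a s zero    zero    = 1#
  powerCoeff a s zero    (suc k) = 0#
  powerCoeff a s (suc j) zero    = a * powerCoeff a s j zero
  powerCoeff a s (suc j) (suc k) = a * powerCoeff a s j (suc k) + s * powerCoeff a s j k

  powerCoeff-cong : ∀ {a a′ s s′} → a ≈ a′ → s ≈ s′ → ∀ j k → powerCoeff a s j k ≈ powerCoeff a′ s′ j k
  powerCoeff-cong p q zero    zero    = refl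
  powerCoeff-cong p q zero    (suc k) = refl
  powerCoeff-cong p q (suc j) zero    = *-cong p (powerCoeff-cong p q j zero)
  powerCoeff-cong p q (suc j) (suc k) = +-cong (*-cong p (powerCoeff-cong p q j (suc k))) (*-cong q (powerCoeff-cong p q j k))

  powerCoeff-above : ∀ a s {j k} → j ℕ.< k → powerCoeff a s j k ≈ 0#
  powerCoeff-above a s {zero}  {suc k} _         = refl
  powerCoeff-above a s {suc j} {suc k} (s≤s j<k) = trans
    (+-cong (*-congˡ (powerCoeff-above a s (ℕ.m<n⇒m<1+n j<k))) (*-congˡ (powerCoeff-above a s j<k)))
    (solve 2 (λ a s → a :* :0 :+ s :* :0 := :0) refl a s)

  powerCoeff-diagonal : ∀ a s k → powerCoeff a s k k ≈ s ^ k
  powerCoeff-diagonal a s zero    = refl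
  powerCoeff-diagonal a s (suc k) = trans (+-cong (*-congˡ (powerCoeff-above a s (ℕ.n<1+n k))) (*-congˡ (powerCoeff-diagonal a s k)))
    (solve 2 (λ a s → a :* :0 :+ s := s) refl a (s * s ^ k))

  -- Without a constant term the substitution is pure scaling. This is the case of `g_w`, whose map
  -- fixes the centre.
  powerCoeff-centred : ∀ {a} s {j k} → a ≈ 0# → k ℕ.< j → powerCoeff a s j k ≈ 0#
  powerCoeff-centred s {suc j} {zero}  a≈0 _         = trans (*-congʳ a≈0) (zeroˡ _)
  powerCoeff-centred s {suc j} {suc k} a≈0 (s≤s k<j) = trans (+-cong (*-congʳ a≈0) (*-congˡ (powerCoeff-centred s a≈0 k<j)))
    (solve 2 (λ p s → :0 :* p :+ s :* :0 := :0) refl (powerCoeff _ s j (suc k)) s)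

  -- A term of the binomial expansion of (|a| + R s)ʲ is at most the whole sum.
  powerCoeff-bound : ∀ {a p s R} → 0# ≤ p → 0# ≤ s → 0# ≤ R → ∀ j k →
                     R ^ k * ∣ powerCoeff a (p * s) j k ∣ ≤ p ^ k * (∣ a ∣ + R * s) ^ j
  powerCoeff-bound {a} {p} {s} {R} 0≤p 0≤s 0≤R = go
    where
    open ≤-Reasoning
    X = ∣ a ∣ + R * s
    0≤X : 0# ≤ X
    0≤X = 0≤+ (0≤∣∣ a) (0≤* 0≤R 0≤s)
    t = powerCoeff a (p * s)
    A = ∣ a ∣
    U V : ℕ → ℕ → Carrier
    U j k = ∣ t j (suc k) ∣
    V j k = ∣ t j k ∣
    go : ∀ j k → R ^ k * ∣ t j k ∣ ≤ p ^ k * X ^ j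
    go zero zero    = ≤-reflexive (*-congˡ (∣∣-nonneg 0≤1))
    go zero (suc k) = ≤-trans (≤-reflexive (trans (*-congˡ (∣∣-nonneg ≤-refl)) (zeroʳ _))) (0≤* (0≤^ (suc k) 0≤p) 0≤1)
    go (suc j) zero = begin
      1# * ∣ a * t j 0 ∣       ≈⟨ trans (*-identityˡ _) (trans (∣x*y∣ a _) (*-congˡ (sym (*-identityˡ _)))) ⟩
      ∣ a ∣ * (1# * ∣ t j 0 ∣) ≤⟨ *-mono-≤ (0≤∣∣ a) (≤-by (0≤* 0≤R 0≤s) refl) (0≤* 0≤1 (0≤∣∣ _)) (go j 0) ⟩
      X * (1# * X ^ j)  ≈⟨ solve 2 (λ x y → x :* (:1 :* y) := :1 :* (x :* y)) refl X (X ^ j) ⟩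
      1# * X ^ suc j  ∎
    go (suc j) (suc k) = begin
      R ^ suc k * ∣ a * t j (suc k) + p * s * t j k ∣
        ≤⟨ *-monoˡ-≤ (0≤^ (suc k) 0≤R) (≤-trans (∣x+y∣≤ _ _) (≤-reflexive
             (+-cong (∣x*y∣ a _) (∣c*x∣ _ (0≤* 0≤p 0≤s))))) ⟩
      R ^ suc k * (A * U j k + p * s * V j k)
        ≈⟨ solve 7 (λ R r a u p s v → (R :* r) :* (a :* u :+ p :* s :* v) := a :* ((R :* r) :* u) :+ (R :* s :* p) :* (r :* v)) refl
             R (R ^ k) A (U j k) p s (V j k) ⟩
      A * (R ^ suc k * U j k) + (R * s * p) * (R ^ k * V j k)
        ≤⟨ +-mono-≤ (*-monoˡ-≤ (0≤∣∣ a) (go j (suc k))) (*-monoˡ-≤ (0≤* (0≤* 0≤R 0≤s) 0≤p) (go j k)) ⟩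
      A * (p ^ suc k * X ^ j) + (R * s * p) * (p ^ k * X ^ j)
        ≈⟨ solve 6 (λ a p q x R s → a :* ((p :* q) :* x) :+ (R :* s :* p) :* (q :* x) := (p :* q) :* ((a :+ R :* s) :* x)) refl
             A p (p ^ k) (X ^ j) R s ⟩
      p ^ suc k * X ^ suc j    ∎

  -- Any length beyond the degree is allowed: the induction uses the same power at the lengths n and
  -- n + 1, and the later double sums want one length common to all powers.
  power-expansion : ∀ a s y j n → j ℕ.< n →
    (ofℝ a +ᶜ ofℝ s *ᶜ y) ^ᶜ j ≈ᶜ ∑ᶜ n (λ k → ofℝ (powerCoeff a s j k) *ᶜ y ^ᶜ k)
  power-expansion a s y zero (suc n) _ = ℂR.sym (ℂR.trans (∑ᶜ-front n _)
    (ℂR.trans (ℂR.+-cong (ℂS.solve 0 (ℂS.:1 ℂS.:* ℂS.:1 ℂS.:= ℂS.:1) ℂR.refl)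
      (∑ᶜ-0 n (λ k _ → ℂR.zeroˡ _))) (ℂR.+-identityʳ 1ℂ)))
  power-expansion a s y (suc j) (suc n) (s≤s j<n) = ℂR.sym (begin
    ∑ᶜ (suc n) (λ k → T (suc j) k)
      ≈⟨ ∑ᶜ-front n _ ⟩
    T (suc j) 0 +ᶜ ∑ᶜ n (λ k → T (suc j) (suc k))
      ≈⟨ ℂR.+-cong (ℂR.trans (ℂR.*-congʳ (ofℝ-* a _)) (ℂR.*-assoc (ofℝ a) _ _))
                   (∑ᶜ-cong n (λ k → ℂR.trans (ℂR.*-congʳ (ℂR.trans (ofℝ-+ _ _) (ℂR.+-cong (ofℝ-* a _) (ofℝ-* s _))))
                     (ℂS.solve 6 (λ a u s v y p → (a ℂS.:* u ℂS.:+ s ℂS.:* v) ℂS.:* (y ℂS.:* p) ℂS.:=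
                                  a ℂS.:* (u ℂS.:* (y ℂS.:* p)) ℂS.:+ (s ℂS.:* y) ℂS.:* (v ℂS.:* p)) ℂR.refl
                       (ofℝ a) (ofℝ (powerCoeff a s j (suc k))) (ofℝ s) (ofℝ (powerCoeff a s j k)) y (y ^ᶜ k)))) ⟩
    ofℝ a *ᶜ T j 0 +ᶜ ∑ᶜ n (λ k → ofℝ a *ᶜ T j (suc k) +ᶜ (ofℝ s *ᶜ y) *ᶜ T j k)
      ≈⟨ ℂR.+-congˡ (ℂR.trans (∑ᶜ-+ n _ _) (ℂR.+-cong (∑ᶜ-* n (ofℝ a) _) (∑ᶜ-* n (ofℝ s *ᶜ y) _))) ⟩
    ofℝ a *ᶜ T j 0 +ᶜ (ofℝ a *ᶜ ∑ᶜ n (λ k → T j (suc k)) +ᶜ (ofℝ s *ᶜ y) *ᶜ ∑ᶜ n (T j))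
      ≈⟨ ℂS.solve 5 (λ a t u v x → a ℂS.:* t ℂS.:+ (a ℂS.:* u ℂS.:+ x ℂS.:* v) ℂS.:= a ℂS.:* (t ℂS.:+ u) ℂS.:+ x ℂS.:* v)
           ℂR.refl (ofℝ a) (T j 0) _ _ (ofℝ s *ᶜ y) ⟩
    ofℝ a *ᶜ (T j 0 +ᶜ ∑ᶜ n (λ k → T j (suc k))) +ᶜ (ofℝ s *ᶜ y) *ᶜ ∑ᶜ n (T j)
      ≈⟨ ℂR.+-cong (ℂR.*-congˡ (ℂR.trans (ℂR.sym (∑ᶜ-front n _)) (ℂR.sym (power-expansion a s y j (suc n) (ℕ.m<n⇒m<1+n j<n)))))
                   (ℂR.*-congˡ (ℂR.sym (power-expansion a s y j n j<n))) ⟩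
    ofℝ a *ᶜ P +ᶜ (ofℝ s *ᶜ y) *ᶜ P
      ≈⟨ ℂR.sym (ℂR.distribʳ P (ofℝ a) (ofℝ s *ᶜ y)) ⟩
    (ofℝ a +ᶜ ofℝ s *ᶜ y) *ᶜ P ∎)
    where
    open import Relation.Binary.Reasoning.Setoid ℂR.setoid
    T : ℕ → ℕ → ℂ
    T j k = ofℝ (powerCoeff a s j k) *ᶜ y ^ᶜ k
    P = (ofℝ a +ᶜ ofℝ s *ᶜ y) ^ᶜ j

  -- The value beyond the degree m is junk.
  monicCoeff : ∀ {m} → MonicPoly m → ℕ → ℂ
  monicCoeff {m} p j with j ℕ.<? m
  ... | yes j<m = p (fromℕ< j<m)
  ... | no  _   = 1ℂ

  monicCoeff-toℕ : ∀ {m} (p : MonicPoly m) i → monicCoeff p (toℕ i) ≡ p i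
  monicCoeff-toℕ {m} p i with toℕ i ℕ.<? m
  ... | yes i<m = ≡.cong p (Fin.fromℕ<-toℕ i i<m)
  ... | no  ¬h  = ⊥-elim (¬h (Fin.toℕ<n i))

  monicCoeff-top : ∀ {m} (p : MonicPoly m) → monicCoeff p m ≡ 1ℂ
  monicCoeff-top {m} p with m ℕ.<? m
  ... | yes m<m = ⊥-elim (ℕ.<-irrefl ≡.refl m<m)
  ... | no  _   = ≡.refl

  Σ-tabulate : ∀ n {I : Set} (g : Fin n → I) (f : I → ℂ) (h : ℕ → ℂ) → (∀ i → f (g i) ≈ᶜ h (toℕ i)) →
               ℂΣ.Σ[ tabulate g ] f ≈ᶜ ∑ᶜ n h
  Σ-tabulate zero    g f h eq = ℂR.refl
  Σ-tabulate (suc n) g f h eq = ℂR.trans (ℂR.+-cong (eq Fin.zero) (Σ-tabulate n (g ∘ Fin.suc) f (h ∘ suc) (eq ∘ Fin.suc)))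
    (ℂR.sym (∑ᶜ-front n h))

  eval-sum : ∀ {m} (p : MonicPoly m) z → eval p z ≈ᶜ ∑ᶜ (suc m) (λ j → monicCoeff p j *ᶜ z ^ᶜ j)
  eval-sum {m} p z = ℂR.trans (ℂR.+-comm _ _) (ℂR.+-cong
    (Σ-tabulate m id _ _ (λ i → ℂR.*-congʳ (ℂR.reflexive (≡.sym (monicCoeff-toℕ p i)))))
    (ℂR.sym (ℂR.trans (ℂR.*-congʳ (ℂR.reflexive (monicCoeff-top p))) (ℂR.*-identityˡ _))))

  -- Coefficient of (z - a)ᵏ. Re-expansion about a is the affine substitution z = a + 1 · y, so
  -- `powerCoeff` serves again.
  centredCoeff : Carrier → ∀ {m} → MonicPoly m → ℕ → ℂ
  centredCoeff a {m} p k = ∑ᶜ (suc m) (λ j → monicCoeff p j *ᶜ ofℝ (powerCoeff a 1# j k))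

  centredCoeff-top : ∀ a {m} (p : MonicPoly m) → centredCoeff a p m ≈ᶜ 1ℂ
  centredCoeff-top a {m} p = ℂR.trans
    (ℂR.+-cong (∑ᶜ-0 m (λ j j<m → ℂR.trans (ℂR.*-congˡ (ofℝ-cong (powerCoeff-above a 1# j<m))) (ℂR.zeroʳ _)))
      (ℂR.*-cong (ℂR.reflexive (monicCoeff-top p)) (ofℝ-cong (trans (powerCoeff-diagonal a 1# m) (1^ m)))))
    (ℂS.solve 0 (ℂS.:0 ℂS.:+ ℂS.:1 ℂS.:* ℂS.:1 ℂS.:= ℂS.:1) ℂR.refl)

  eval-centred : ∀ a {m} (p : MonicPoly m) z → eval p z ≈ᶜ ∑ᶜ (suc m) (λ k → centredCoeff a p k *ᶜ (z -ᶜ ofℝ a) ^ᶜ k)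
  eval-centred a {m} p z = begin
    eval p z
      ≈⟨ eval-sum p z ⟩
    ∑ᶜ (suc m) (λ j → monicCoeff p j *ᶜ z ^ᶜ j)
      ≈⟨ ∑ᶜ-cong< (suc m) (λ j j≤m → ℂR.*-congˡ (ℂR.trans (^ᶜ-cong j z≈) (power-expansion a 1# y j (suc m) j≤m))) ⟩
    ∑ᶜ (suc m) (λ j → monicCoeff p j *ᶜ ∑ᶜ (suc m) (λ k → ofℝ (powerCoeff a 1# j k) *ᶜ y ^ᶜ k))
      ≈⟨ ∑ᶜ-cong (suc m) (λ j → ℂR.trans (ℂR.sym (∑ᶜ-* (suc m) _ _)) (∑ᶜ-cong (suc m) (λ k → ℂR.sym (ℂR.*-assoc _ _ _)))) ⟩
    ∑ᶜ (suc m) (λ j → ∑ᶜ (suc m) (λ k → (monicCoeff p j *ᶜ ofℝ (powerCoeff a 1# j k)) *ᶜ y ^ᶜ k))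
      ≈⟨ ∑ᶜ-swap (suc m) (suc m) _ ⟩
    ∑ᶜ (suc m) (λ k → ∑ᶜ (suc m) (λ j → (monicCoeff p j *ᶜ ofℝ (powerCoeff a 1# j k)) *ᶜ y ^ᶜ k))
      ≈⟨ ∑ᶜ-cong (suc m) (λ k → ℂR.trans (∑ᶜ-cong (suc m) (λ j → ℂR.*-comm _ _))
           (ℂR.trans (∑ᶜ-* (suc m) _ _) (ℂR.*-comm _ _))) ⟩
    ∑ᶜ (suc m) (λ k → centredCoeff a p k *ᶜ y ^ᶜ k) ∎
    where
    open import Relation.Binary.Reasoning.Setoid ℂR.setoid
    y = z -ᶜ ofℝ a
    z≈ : z ≈ᶜ ofℝ a +ᶜ ofℝ 1# *ᶜ y
    z≈ = ℂS.solve 2 (λ z a → z ℂS.:= a ℂS.:+ ℂS.:1 ℂS.:* (z ℂS.:- a)) ℂR.refl z (ofℝ a)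

-- Combinatorics of words: occurrences of w and suffixes

module _ {A : Set} where
  open ≡ using (refl; sym; trans; cong)

  prefix⇒++ : ∀ {u v : List A} → Prefix _≡_ u v → ∃[ s ] u ++ s ≡ v
  prefix⇒++ {v = v} []    = v , refl
  prefix⇒++ (refl ∷ p) = map₂ (cong (_ ∷_)) (prefix⇒++ p)

  ++⇒prefix : ∀ (u : List A) {s v} → u ++ s ≡ v → Prefix _≡_ u v
  ++⇒prefix []      eq   = []
  ++⇒prefix (x ∷ u) refl = refl ∷ ++⇒prefix u refl

  shorter-suffix : ∀ (a : List A) {b} c {d} → a ++ b ≡ c ++ d → length b ℕ.≤ length d → ∃[ p ] d ≡ p ++ b
  shorter-suffix a       []      eq   b≤d = a , sym eq
  shorter-suffix []      (y ∷ c) {d} refl b≤d = ⊥-elim (ℕ.<-irrefl refl (ℕ.≤-trans (s≤s (List.length-++-≤ʳ d {c})) b≤d))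
  shorter-suffix (x ∷ a) (y ∷ c) eq   b≤d = shorter-suffix a c (List.∷-injectiveʳ eq) b≤d

  take-∷ʳ : ∀ (v : List A) d → take (length (v ∷ʳ d) ℕ.∸ 1) (v ∷ʳ d) ≡ v
  take-∷ʳ v d = trans (cong (λ n → take (n ℕ.∸ 1) (v ∷ʳ d)) (List.length-++-comm v (d ∷ []))) (take-length v)
    where
    take-length : ∀ v → take (length v) (v ∷ʳ d) ≡ v
    take-length []      = refl
    take-length (x ∷ v) = cong (x ∷_) (take-length v)

  nonempty-length : ∀ {g : List A} → g ≢ [] → 0 ℕ.< length g
  nonempty-length {[]}    g≢[] = ⊥-elim (g≢[] refl)
  nonempty-length {_ ∷ _} _    = s≤s z≤n

module Occurrences (b : ℕ) (w : List (Fin b)) (w≢[] : w ≢ []) where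
  open Words b w
  open ≡ using (refl; sym; trans; cong)

  private
    W? = prefix? Fin._≟_ w

    prefix-or-not : ∀ v → Prefix _≡_ w v ⊎ ¬ Prefix _≡_ w v
    prefix-or-not v with W? v
    ... | yes p = inj₁ p
    ... | no ¬p = inj₂ ¬p

  k-here : ∀ {x v} → Prefix _≡_ w (x ∷ v) → k (x ∷ v) ≡ suc (k v)
  k-here p = cong length (List.filter-accept W? p)

  k-skip : ∀ {x v} → ¬ Prefix _≡_ w (x ∷ v) → k (x ∷ v) ≡ k v
  k-skip p = cong length (List.filter-reject W? p)

  k-[] : k [] ≡ 0
  k-[] = cong length (List.filter-reject W? {xs = []} λ p → w≢[] (List.++-conicalˡ w _ (proj₂ (prefix⇒++ p))))

  k-suffix : ∀ u v → k v ℕ.≤ k (u ++ v)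
  k-suffix []      v = ℕ.≤-refl
  k-suffix (x ∷ u) v with prefix-or-not (x ∷ u ++ v)
  ... | inj₁ p = ℕ.≤-trans (k-suffix u v) (ℕ.≤-trans (ℕ.n≤1+n _) (ℕ.≤-reflexive (sym (k-here p))))
  ... | inj₂ ¬p = ℕ.≤-trans (k-suffix u v) (ℕ.≤-reflexive (sym (k-skip ¬p)))

  k-short : ∀ v → length v ℕ.< length w → k v ≡ 0
  k-short []      h = k-[]
  k-short (x ∷ v) h = trans (k-skip λ p → let s , eq = prefix⇒++ p in
      ℕ.<-irrefl refl (ℕ.<-≤-trans h (ℕ.≤-trans (List.length-++-≤ˡ w {s}) (ℕ.≤-reflexive (cong length eq)))))
    (k-short v (ℕ.<-trans (ℕ.n<1+n _) h))

  -- `k` counts suffixes from the left while the digit arrives on the right, so each suffix is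
  -- compared before and after the append. One that begins with w only afterwards must be equal to
  -- w; a shorter suffix is then too short to end in w, so there is no second new occurrence.
  k-∷ʳ : ∀ v d → k (v ∷ʳ d) ≡ k v ⊎ (k (v ∷ʳ d) ≡ suc (k v) × ∃[ u ] v ∷ʳ d ≡ u ++ w)
  k-∷ʳ [] d with prefix-or-not (d ∷ [])
  ... | inj₂ ¬p = inj₁ (k-skip ¬p)
  ... | inj₁ p = inj₂ (k-here p , [] , sym (whole p refl))
    where
    whole : ∀ {u} → Prefix _≡_ u (d ∷ []) → u ≡ w → u ≡ d ∷ []
    whole []          u≡w = ⊥-elim (w≢[] (sym u≡w))
    whole (refl ∷ []) _   = refl
  k-∷ʳ (x ∷ v) d with prefix-or-not (x ∷ v) | prefix-or-not (x ∷ v ∷ʳ d)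
  ... | inj₁ p | inj₂ ¬q = ⊥-elim (¬q (let s , eq = prefix⇒++ p in
          ++⇒prefix w (trans (sym (List.++-assoc w s _)) (cong (_∷ʳ d) eq))))
  ... | inj₁ p | inj₁ q with k-∷ʳ v d
  ...   | inj₁ eq            = inj₁ (trans (k-here q) (trans (cong suc eq) (sym (k-here p))))
  ...   | inj₂ (eq , u , e)  = inj₂ (trans (k-here q) (cong suc (trans eq (sym (k-here p)))) , x ∷ u , cong (x ∷_) e)
  k-∷ʳ (x ∷ v) d | inj₂ ¬p | inj₂ ¬q with k-∷ʳ v d
  ...   | inj₁ eq            = inj₁ (trans (k-skip ¬q) (trans eq (sym (k-skip ¬p))))
  ...   | inj₂ (eq , u , e)  = inj₂ (trans (k-skip ¬q) (trans eq (cong suc (sym (k-skip ¬p)))) , x ∷ u , cong (x ∷_) e)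
  k-∷ʳ (x ∷ v) d | inj₂ ¬p | inj₁ q with prefix⇒++ q
  ...   | s , eq with initLast s
  ...     | s′ ∷ʳ′ d′ = ⊥-elim (¬p (++⇒prefix w (List.∷ʳ-injectiveˡ (w ++ s′) (x ∷ v) (trans (List.++-assoc w s′ _) eq))))
  ...     | [] with k-∷ʳ v d
  ...       | inj₁ e = inj₂ (trans (k-here q) (cong suc (trans e (sym (k-skip ¬p)))) , [] , trans (sym eq) (List.++-identityʳ w))
  ...       | inj₂ (_ , u , e) = ⊥-elim (ℕ.<-irrefl refl (ℕ.≤-trans (ℕ.≤-reflexive (cong length (trans (sym eq) (List.++-identityʳ w))))
                (ℕ.≤-trans (List.length-++-≤ʳ w {u}) (ℕ.≤-reflexive (cong length (sym e))))))

  k-w : k w ≡ 1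
  k-w = go w refl
    where
    go : ∀ v → v ≡ w → k v ≡ 1
    go []      eq = ⊥-elim (w≢[] (sym eq))
    go (x ∷ v) eq = trans (k-here (++⇒prefix w (trans (List.++-identityʳ w) (sym eq))))
      (cong suc (k-short v (ℕ.≤-reflexive (cong length eq))))

  0<k[w++v] : ∀ v → 0 ℕ.< k (w ++ v)
  0<k[w++v] v = go w refl
    where
    go : ∀ u → u ≡ w → 0 ℕ.< k (u ++ v)
    go []      eq = ⊥-elim (w≢[] (sym eq))
    go (x ∷ u) eq = ℕ.<-≤-trans (s≤s z≤n) (ℕ.≤-reflexive (sym (k-here (++⇒prefix w (cong (_++ v) (sym eq))))))

  k⁺-∷ʳ : ∀ g d → k⁺ (g ∷ʳ d) ≡ k⁺ g ⊎ (k⁺ (g ∷ʳ d) ≡ suc (k⁺ g) × ∃[ u ] w ++ (g ∷ʳ d) ≡ u ++ w)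
  k⁺-∷ʳ g d with k-∷ʳ (w ++ g) d
  ... | inj₁ eq = inj₁ (cong (ℕ._∸ 1) (trans (cong k (sym (List.++-assoc w g _))) eq))
  ... | inj₂ (eq , u , e) = inj₂ (trans (cong (ℕ._∸ 1) (trans (cong k (sym (List.++-assoc w g _))) eq))
                                    (ℕ.+-∸-assoc 1 (0<k[w++v] g))
                                 , u , trans (sym (List.++-assoc w g _)) e)

  k⁺-[] : k⁺ [] ≡ 0
  k⁺-[] = cong (ℕ._∸ 1) (trans (cong k (List.++-identityʳ w)) k-w)

  -- In w w the first copy is discounted by `k⁺`, and the final copy still counts.
  0<k⁺w : 0 ℕ.< k⁺ w
  0<k⁺w = go w refl
    where
    go : ∀ u → u ≡ w → 0 ℕ.< k (u ++ w) ℕ.∸ 1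
    go []      eq = ⊥-elim (w≢[] (sym eq))
    go (x ∷ u) eq = ℕ.≤-trans (ℕ.≤-reflexive (sym k-w)) (ℕ.≤-trans (k-suffix u w)
      (ℕ.≤-reflexive (sym (cong (ℕ._∸ 1) (k-here {x} {u ++ w} (++⇒prefix w (cong (_++ w) (sym eq))))))))

  𝒢-∷ʳ : ∀ {g d} → k⁺ g ≡ 0 → k⁺ (g ∷ʳ d) ≢ 0 → 𝒢 (g ∷ʳ d)
  𝒢-∷ʳ {g} {d} h h′ with k⁺-∷ʳ g d
  ... | inj₁ eq       = ⊥-elim (h′ (trans eq h))
  ... | inj₂ (eq , _) = (λ e → ℕ.1+n≢0 (trans (sym (trans (List.length-++-comm g (d ∷ [])) refl)) (cong length e)))
                      , trans eq (cong suc h) , trans (cong k⁺ (take-∷ʳ g d)) h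

  -- Delete digits from the right until `k⁺` drops to 0. The prefix just before that deletion lies
  -- in `𝒢`.
  short-𝒢 : ∀ g → k⁺ g ≢ 0 → ∃[ h ] 𝒢 h × length h ℕ.≤ length g
  short-𝒢 g = go (reverseView g)
    where
    go : ∀ {g} → Reverse g → k⁺ g ≢ 0 → ∃[ h ] 𝒢 h × length h ℕ.≤ length g
    go []            h = ⊥-elim (h k⁺-[])
    go (g ∶ r ∶ʳ d) h with k⁺ g ℕ.≟ 0
    ... | yes z = g ∷ʳ d , 𝒢-∷ʳ z h , ℕ.≤-refl
    ... | no nz = map₂ (map₂ (λ l → ℕ.≤-trans l (List.length-++-≤ˡ g))) (go r nz)

  -- `k⁺` changes between `g ⁻` and g, so the last digit completes an occurrence of w. That
  -- occurrence may begin inside the prepended w, hence the conclusion about `w ++ g` and not about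
  -- g.
  𝒢-ends-in-w : ∀ {g} → 𝒢 g → ∃[ u ] w ++ g ≡ u ++ w
  𝒢-ends-in-w {g} (g≢[] , p , q) with initLast g
  ... | []      = ⊥-elim (g≢[] refl)
  ... | g′ ∷ʳ′ d with k⁺-∷ʳ g′ d
  ...   | inj₂ (_ , u , eq) = u , eq
  ...   | inj₁ eq with trans (sym p) (trans eq (trans (cong k⁺ (sym (take-∷ʳ g′ d))) q))
  ...     | ()

  -- The shortest word of 𝒢 is at most as long as w, since k⁺ w ≥ 1; it is then
  -- a suffix of w, and every word of 𝒢 is a suffix of a word ending in w.
  shortest-is-suffix : ∀ {g₀} → IsShortest𝒢 g₀ → ∀ {g} → 𝒢 g → ∃[ h ] g ≡ h ++ g₀
  shortest-is-suffix {g₀} (𝒢g₀ , least) {g} 𝒢g =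
    let h , 𝒢h , h≤w  = short-𝒢 w (λ e → ℕ.<-irrefl (sym e) 0<k⁺w)
        u′ , eq′      = 𝒢-ends-in-w 𝒢g₀
        p , w≡        = shorter-suffix w u′ eq′ (ℕ.≤-trans (least h 𝒢h) h≤w)
        u , eq        = 𝒢-ends-in-w 𝒢g
    in shorter-suffix (u ++ p) w
         (trans (List.++-assoc u p g₀) (sym (trans eq (cong (u ++_) w≡)))) (least g 𝒢g)

-- Base-b expansions and the affine maps attached to words

module Expansions {c ℓ₁ ℓ₂ : Level} (ℝ : RealField c ℓ₁ ℓ₂)
                  (b : ℕ) (1<b : 1 ℕ.< b) (w : List (Fin b)) where
  open FiniteSums ℝ
  open Sequences ℝ
  open Limits ℝ ℕ-net
  open Words b w
  open Setting ℝ b 1<b w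
  open Algebra.Properties.Semiring.Mult (CommutativeRing.semiring commutativeRing) using (×-homo-+; ×1-homo-*)

  fromℕ-mono : ∀ {m n} → m ℕ.≤ n → fromℕ m ≤ fromℕ n
  fromℕ-mono {n = n} z≤n = fromℕ-nonneg n
  fromℕ-mono (s≤s h)     = +-monoʳ-≤ 1# (fromℕ-mono h)

  private
    0<b : 0# < fromℕ b
    0<b = 0<fromℕ (ℕ.<-trans (ℕ.n<1+n 0) 1<b)

  β : Carrier
  β = inverse 0<b

  0<β : 0# < β
  0<β = 0<inverse 0<b

  β≤½ : β ≤ ½
  β≤½ = *-cancelˡ-≤ 0<b (≤-trans (≤-reflexive (inverse-correctʳ 0<b)) (≤-resp (inverse-correctʳ 0<2) refl
    (*-monoʳ-≤ (<⇒≤ 0<½) (≤-resp (solve 0 (:1 :+ (:1 :+ :0) := :1 :+ :1) refl) refl (fromℕ-mono 1<b)))))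

  β≤1 : β ≤ 1#
  β≤1 = ≤-trans β≤½ (<⇒≤ ½<1)

  0<b⁻^ : ∀ n → 0# < b⁻^ n
  0<b⁻^ n = 0<^ n 0<β

  b⁻^≤1 : ∀ n → b⁻^ n ≤ 1#
  b⁻^≤1 n = ^≤1 n (<⇒≤ 0<β) β≤1

  b⁻^-suc≤½ : ∀ n → b⁻^ (suc n) ≤ ½
  b⁻^-suc≤½ n = ≤-trans (≤-resp refl (*-identityʳ β) (*-monoˡ-≤ (<⇒≤ 0<β) (b⁻^≤1 n))) β≤½

  private
    n-foldl : ∀ m g → foldl (λ n d → n ℕ.* b ℕ.+ toℕ d) m g ≡ m ℕ.* b ℕ.^ length g ℕ.+ n⟨ g ⟩
    n-foldl m []      = ≡.sym (≡.trans (ℕ.+-identityʳ _) (ℕ.*-identityʳ m))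
    n-foldl m (a ∷ g) = ≡.trans (n-foldl (m ℕ.* b ℕ.+ toℕ a) g)
      (≡.trans (+-*-Solver.solve 5 (λ m b a p n → (m :*′ b :+′ a) :*′ p :+′ n :=′ m :*′ (b :*′ p) :+′ (a :*′ p :+′ n))
          ≡.refl m b (toℕ a) (b ℕ.^ length g) n⟨ g ⟩)
        (≡.cong (m ℕ.* b ℕ.^ length (a ∷ g) ℕ.+_) (≡.sym (n-foldl (toℕ a) g))))
      where open +-*-Solver using () renaming (_:*_ to _:*′_; _:+_ to _:+′_; _:=_ to _:=′_)

    fromℕ-+ : ∀ m n → fromℕ (m ℕ.+ n) ≈ fromℕ m + fromℕ n
    fromℕ-+ = ×-homo-+ 1#

    fromℕ-* : ∀ m n → fromℕ (m ℕ.* n) ≈ fromℕ m * fromℕ n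
    fromℕ-* = ×1-homo-*

    b^*b⁻^ : ∀ n → fromℕ (b ℕ.^ n) * b⁻^ n ≈ 1#
    b^*b⁻^ zero    = solve 0 ((:1 :+ :0) :* :1 := :1) refl
    b^*b⁻^ (suc n) = trans (*-congʳ (fromℕ-* b (b ℕ.^ n)))
      (trans (solve 4 (λ B P β p → (B :* P) :* (β :* p) := (B :* β) :* (P :* p)) refl (fromℕ b) (fromℕ (b ℕ.^ n)) β (b⁻^ n))
        (trans (*-cong (inverse-correctʳ 0<b) (b^*b⁻^ n)) (*-identityˡ 1#)))

  x-∷ : ∀ a g → x⟨ a ∷ g ⟩ ≈ β * (fromℕ (toℕ a) + x⟨ g ⟩)
  x-∷ a g = begin-equality
    fromℕ n⟨ a ∷ g ⟩ * (β * p)  ≈⟨ *-congʳ (trans (reflexive (≡.cong fromℕ (n-foldl (toℕ a) g)))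
                                                  (trans (fromℕ-+ (toℕ a ℕ.* b ℕ.^ length g) n⟨ g ⟩) (+-congʳ (fromℕ-* (toℕ a) (b ℕ.^ length g))))) ⟩
    (d * P + n) * (β * p)  ≈⟨ solve 5 (λ d P n β p → (d :* P :+ n) :* (β :* p) := β :* (d :* (P :* p) :+ n :* p))
                                                  refl d P n β p ⟩
    β * (d * (P * p) + n * p)  ≈⟨ *-congˡ (+-congʳ (trans (*-congˡ (b^*b⁻^ (length g))) (*-identityʳ d))) ⟩
    β * (d + n * p)  ∎
    where
    open ≤-Reasoning
    d = fromℕ (toℕ a)
    P = fromℕ (b ℕ.^ length g)
    n = fromℕ n⟨ g ⟩
    p = b⁻^ (length g)

  x-++ : ∀ h g → x⟨ h ++ g ⟩ ≈ x⟨ h ⟩ + b⁻^ (length h) * x⟨ g ⟩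
  x-++ []      g = solve 1 (λ x → x := :0 :* :1 :+ :1 :* x) refl x⟨ g ⟩
  x-++ (a ∷ h) g = trans (x-∷ a (h ++ g)) (trans (*-congˡ (+-congˡ (x-++ h g)))
    (trans (solve 5 (λ β d x p y → β :* (d :+ (x :+ p :* y)) := β :* (d :+ x) :+ (β :* p) :* y) refl
      β (fromℕ (toℕ a)) x⟨ h ⟩ (b⁻^ (length h)) x⟨ g ⟩) (+-congʳ (sym (x-∷ a h)))))

  b⁻^-length-++ : ∀ (h g : Word) → b⁻^ (length (h ++ g)) ≈ b⁻^ (length h) * b⁻^ (length g)
  b⁻^-length-++ h g = trans (reflexive (≡.cong b⁻^ (List.length-++ h))) (^-homo-* β (length h) (length g))

  0≤x : ∀ g → 0# ≤ x⟨ g ⟩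
  0≤x g = 0≤* (fromℕ-nonneg n⟨ g ⟩) (<⇒≤ (0<b⁻^ (length g)))

  -- With `0≤x` this says that T_g maps [0,1] into itself. The induction is on the leading digit,
  -- which is at most b - 1.
  x+b⁻^≤1 : ∀ g → x⟨ g ⟩ + b⁻^ (length g) ≤ 1#
  x+b⁻^≤1 []      = ≤-reflexive (solve 0 (:0 :* :1 :+ :1 := :1) refl)
  x+b⁻^≤1 (a ∷ g) = begin
    x⟨ a ∷ g ⟩ + β * p  ≈⟨ +-congʳ (x-∷ a g) ⟩
    β * (d + x⟨ g ⟩) + β * p  ≈⟨ solve 4 (λ β d x p → β :* (d :+ x) :+ β :* p := β :* (d :+ (x :+ p))) refl β d x⟨ g ⟩ p ⟩
    β * (d + (x⟨ g ⟩ + p))  ≤⟨ *-monoˡ-≤ (<⇒≤ 0<β) (+-monoʳ-≤ d (x+b⁻^≤1 g)) ⟩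
    β * (d + 1#)  ≈⟨ *-congˡ (+-comm d 1#) ⟩
    β * fromℕ (suc (toℕ a))  ≤⟨ *-monoˡ-≤ (<⇒≤ 0<β) (fromℕ-mono (Fin.toℕ<n a)) ⟩
    β * fromℕ b  ≈⟨ inverse-correct 0<b ⟩
    1#  ∎
    where
    open ≤-Reasoning
    d = fromℕ (toℕ a)
    p = b⁻^ (length g)

  private
    term : (ℕ → Fin b) → ℕ → Carrier
    term d i = fromℕ (toℕ (d i)) * b⁻^ (suc i)

    digits-of : ∀ g (d : ℕ → Fin b) → (∀ i → d (toℕ i) ≡ lookup g i) → ∑ (length g) (term d) ≈ x⟨ g ⟩
    digits-of []      d h = sym (zeroˡ 1#)
    digits-of (a ∷ g) d h = trans (∑-front (length g) (term d)) (trans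
      (+-cong (*-cong (reflexive (≡.cong (fromℕ ∘ toℕ) (h Fin.zero))) (*-identityʳ β))
        (trans (∑-cong (length g) (λ i → solve 3 (λ x β p → x :* (β :* p) := β :* (x :* p)) refl (fromℕ (toℕ (d (suc i)))) β (b⁻^ (suc i))))
          (trans (∑-* (length g) β (term (d ∘ suc))) (*-congˡ (digits-of g (d ∘ suc) (h ∘ Fin.suc))))))
      (trans (solve 3 (λ a β x → a :* β :+ β :* x := β :* (a :+ x)) refl (fromℕ (toℕ a)) β x⟨ g ⟩) (sym (x-∷ a g))))

    periodic-digit : ∀ g (g≢[] : g ≢ []) i → periodic g g≢[] (toℕ i) ≡ lookup g i
    periodic-digit []        g≢[] i = ⊥-elim (g≢[] ≡.refl)
    periodic-digit g@(_ ∷ _) _    i = ≡.cong (lookup g) (Fin.toℕ-injective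
      (≡.trans (Fin.toℕ-fromℕ< (m%n<n (toℕ i) (length g))) (m<n⇒m%n≡m (Fin.toℕ<n i))))

    periodic-shift : ∀ g (g≢[] : g ≢ []) i → periodic g g≢[] (length g ℕ.+ i) ≡ periodic g g≢[] i
    periodic-shift []        g≢[] i = ⊥-elim (g≢[] ≡.refl)
    periodic-shift g@(_ ∷ _) _    i = ≡.cong (lookup g) (Fin.toℕ-injective
      (≡.trans (Fin.toℕ-fromℕ< (m%n<n (length g ℕ.+ i) (length g)))
        (≡.trans (≡.cong (_% length g) (ℕ.+-comm (length g) i))
          (≡.trans ([m+n]%n≡m%n i (length g)) (≡.sym (Fin.toℕ-fromℕ< (m%n<n i (length g))))))))

  HasDigits⇒Series : ∀ {x} d → HasDigits x d → Series (term d) x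
  HasDigits⇒Series d h = lim λ ε 0<ε → map₂ (λ p n N≤n →
    <⇒≤ (<-resp (∣∣-cong (+-congʳ (Σ-upTo n (term d)))) refl (p n N≤n))) (h ε 0<ε)

  -- Splitting one period off the expansion leaves the same expansion scaled by b^(-|g|); both sides
  -- are limits of the same partial sums.
  periodic-fixed : ∀ {g} (g≢[] : g ≢ []) {x} → HasDigits x (periodic g g≢[]) → x ≈ x⟨ g ⟩ + b⁻^ (length g) * x
  periodic-fixed {g} g≢[] {x} h = lim-unique
    (lim-shift (length g) (HasDigits⇒Series d h))
    (lim-cong (always (λ n → sym (split n))) refl (lim-+ (lim-const x⟨ g ⟩) (lim-* (b⁻^ (length g)) (HasDigits⇒Series d h))))
    where
    d = periodic g g≢[]
    split : ∀ n → ∑ (length g ℕ.+ n) (term d) ≈ x⟨ g ⟩ + b⁻^ (length g) * ∑ n (term d)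
    split n = trans (∑-split (length g) n (term d)) (+-cong (digits-of g d (periodic-digit g g≢[]))
      (trans (∑-cong n (λ i → trans (*-cong (reflexive (≡.cong (fromℕ ∘ toℕ) (periodic-shift g g≢[] i)))
          (trans (reflexive (≡.cong b⁻^ (≡.sym (ℕ.+-suc (length g) i)))) (^-homo-* β (length g) (suc i))))
        (solve 3 (λ x p q → x :* (p :* q) := p :* (x :* q)) refl (fromℕ (toℕ (d i))) (b⁻^ (length g)) (b⁻^ (suc i)))))
      (∑-* n (b⁻^ (length g)) (term d))))

-- Coefficients of polynomials that converge pointwise

module PolynomialLimits {c ℓ₁ ℓ₂ : Level} (ℝ : RealField c ℓ₁ ℓ₂) (N : Net) where
  open FiniteSums ℝ
  open Limits ℝ N

  private
    1≤2^ : ∀ n → 1# ≤ 2# ^ n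
    1≤2^ zero    = ≤-refl
    1≤2^ (suc n) = ≤-trans (1≤2^ n) (≤-by (≤-trans 0≤1 (1≤2^ n)) (solve 1 (λ p → :2 :* p := p :+ p) refl (2# ^ n)))

    2^-gap : ∀ {k n} → k ℕ.< n → 1# ≤ 2# ^ n - 2# ^ k
    2^-gap {zero}  {suc n} _         = ≤-by (0≤+ (≤⇒0≤- (1≤2^ n)) (≤⇒0≤- (1≤2^ n)))
      (solve 1 (λ p → :2 :* p :- :1 := :1 :+ ((p :- :1) :+ (p :- :1))) refl (2# ^ n))
    2^-gap {suc k} {suc n} (s≤s k<n) = ≤-trans (2^-gap k<n) (≤-by (≤-trans 0≤1 (2^-gap k<n))
      (solve 2 (λ p q → :2 :* p :- :2 :* q := (p :- q) :+ (p :- q)) refl (2# ^ n) (2# ^ k)))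

  -- 2ⁿ p(y) − p(2y) has no term of degree n, and its other coefficients are at
  -- least those of p in absolute value.
  coefficients→0 : ∀ n (δ : ℕ → Index → Carrier) → (∀ y → Lim (λ j → ∑ n (λ k → δ k j * y ^ k)) 0#) →
                   ∀ k → k ℕ.< n → Lim (δ k) 0#
  coefficients→0 (suc n) δ h = λ k k≤n → [ lower k , (λ { ≡.refl → top-coefficient }) ]′ (ℕ.m≤n⇒m<n∨m≡n (ℕ.≤-pred k≤n))
    where
    p : Index → Carrier → Carrier
    p j y = ∑ (suc n) (λ k → δ k j * y ^ k)
    δ′ : ℕ → Index → Carrier
    δ′ k j = (2# ^ n - 2# ^ k) * δ k j
    scaled : ∀ j y → 2# ^ n * p j y - p j (2# * y) ≈ ∑ n (λ k → δ′ k j * y ^ k)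
    scaled j y = begin-equality
      2# ^ n * p j y - p j (2# * y)
        ≈⟨ +-cong (sym (∑-* (suc n) (2# ^ n) _)) (-‿cong (∑-cong (suc n) (λ k → *-congˡ (^-distrib-* 2# y k)))) ⟩
      ∑ (suc n) (λ k → 2# ^ n * (δ k j * y ^ k)) - ∑ (suc n) (λ k → δ k j * (2# ^ k * y ^ k))
        ≈⟨ ∑-- (suc n) _ _ ⟨
      ∑ (suc n) (λ k → 2# ^ n * (δ k j * y ^ k) - δ k j * (2# ^ k * y ^ k))
        ≈⟨ ∑-cong (suc n) (λ k → solve 4 (λ a b d q → a :* (d :* q) :- d :* (b :* q) := ((a :- b) :* d) :* q) refl
             (2# ^ n) (2# ^ k) (δ k j) (y ^ k)) ⟩
      ∑ n (λ k → δ′ k j * y ^ k) + δ′ n j * y ^ n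
        ≈⟨ +-congˡ (solve 3 (λ a d q → ((a :- a) :* d) :* q := :0) refl (2# ^ n) (δ n j) (y ^ n)) ⟩
      ∑ n (λ k → δ′ k j * y ^ k) + 0#
        ≈⟨ +-identityʳ _ ⟩
      ∑ n (λ k → δ′ k j * y ^ k) ∎
      where open ≤-Reasoning
    lower′ : ∀ k → k ℕ.< n → Lim (δ′ k) 0#
    lower′ = coefficients→0 n δ′ λ y → lim-cong (always (λ j → scaled j y))
      (solve 1 (λ a → a :* :0 :- :0 := :0) refl (2# ^ n)) (lim-- (lim-* (2# ^ n) (h y)) (h (2# * y)))
    lower : ∀ k → k ℕ.< n → Lim (δ k) 0#
    lower k k<n = lim λ ε 0<ε → ev-map (λ j q → ≤-trans (smaller j) q) (near (lower′ k k<n) ε 0<ε)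
      where
      smaller : ∀ j → ∣ δ k j - 0# ∣ ≤ ∣ δ′ k j - 0# ∣
      smaller j = begin
        ∣ δ k j - 0# ∣  ≈⟨ ∣∣-cong (x-0≈x (δ k j)) ⟩
        ∣ δ k j ∣  ≈⟨ *-identityˡ _ ⟨
        1# * ∣ δ k j ∣  ≤⟨ *-monoʳ-≤ (0≤∣∣ _) (2^-gap k<n) ⟩
        (2# ^ n - 2# ^ k) * ∣ δ k j ∣  ≈⟨ ∣c*x∣ (δ k j) (≤-trans 0≤1 (2^-gap k<n)) ⟨
        ∣ δ′ k j ∣  ≈⟨ ∣∣-cong (x-0≈x (δ′ k j)) ⟨
        ∣ δ′ k j - 0# ∣  ∎
        where open ≤-Reasoning
    -- At y = 1 the polynomial is the sum of its coefficients, and all but the top one are already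
    -- known to tend to zero.
    top-coefficient : Lim (δ n) 0#
    top-coefficient = lim-cong
      (always (λ j → trans (+-cong (∑-cong (suc n) (λ k → trans (*-congˡ (1^ k)) (*-identityʳ _))) (-‿cong refl))
        (solve 2 (λ s d → (s :+ d) :- s := d) refl (∑ n (λ k → δ k j)) (δ n j))))
      (trans (+-congˡ (-‿cong (∑-0 n (λ _ _ → refl)))) (solve 0 (:0 :- :0 := :0) refl))
      (lim-- (h 1#) (lim-∑ n {f = δ} {l = λ _ → 0#} lower))

-- Discrete Gronwall inequalities

module DiscreteGronwall {c ℓ₁ ℓ₂ : Level} (ℝ : RealField c ℓ₁ ℓ₂)
         (θ : RealField.Carrier ℝ) (0≤θ : RealField._≤_ ℝ (RealField.0# ℝ) θ) (θ<1 : RealField._<_ ℝ θ (RealField.1# ℝ))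
         (C : RealField.Carrier ℝ) (0≤C : RealField._≤_ ℝ (RealField.0# ℝ) C) where
  open FiniteSums ℝ
  open Sequences ℝ
  open Limits ℝ ℕ-net using (near; lim-*)
  open Geometric θ 0≤θ θ<1

  -- The Gronwall factor: the growth accumulated over the first n steps, a discrete counterpart of
  -- the exponential of an integral.
  ∏ : ℕ → Carrier
  ∏ zero    = 1#
  ∏ (suc n) = ∏ n * (1# + C * θ ^ n)

  private
    0≤Cθ^ : ∀ n → 0# ≤ C * θ ^ n
    0≤Cθ^ n = 0≤* 0≤C (0≤^ n 0≤θ)

    factor≥1 : ∀ n → 1# ≤ 1# + C * θ ^ n
    factor≥1 n = ≤-by (0≤Cθ^ n) refl

  1≤∏ : ∀ n → 1# ≤ ∏ n
  1≤∏ zero    = ≤-refl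
  1≤∏ (suc n) = ≤-trans (1≤∏ n) (≤-resp (*-identityʳ _) refl (*-monoˡ-≤ (≤-trans 0≤1 (1≤∏ n)) (factor≥1 n)))

  0≤∏ : ∀ n → 0# ≤ ∏ n
  0≤∏ n = ≤-trans 0≤1 (1≤∏ n)

  private
    ∏-mono : ∀ m n → ∏ m ≤ ∏ (m ℕ.+ n)
    ∏-mono m zero    = ≤-reflexive (reflexive (≡.cong ∏ (≡.sym (ℕ.+-identityʳ m))))
    ∏-mono m (suc n) = ≤-trans (∏-mono m n) (≤-trans (≤-resp (*-identityʳ _) refl (*-monoˡ-≤ (0≤∏ (m ℕ.+ n)) (factor≥1 (m ℕ.+ n))))
      (≤-reflexive (reflexive (≡.cong ∏ (≡.sym (ℕ.+-suc m n))))))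

    -- (1 + x)(1 − s − x) ≤ 1 − s for s, x ≥ 0.
    ∏-tail : ∀ N n → ∏ (N ℕ.+ n) * (1# - ∑ n (λ i → C * θ ^ (N ℕ.+ i))) ≤ ∏ N
    ∏-tail N zero    = ≤-reflexive (trans (*-cong (reflexive (≡.cong ∏ (ℕ.+-identityʳ N))) refl)
      (solve 1 (λ p → p :* (:1 :- :0) := p) refl (∏ N)))
    ∏-tail N (suc n) = ≤-trans (≤-by (0≤* (0≤∏ (N ℕ.+ n)) (0≤* (0≤Cθ^ (N ℕ.+ n))
        (0≤+ (∑-nonneg n (λ i → 0≤Cθ^ (N ℕ.+ i))) (0≤Cθ^ (N ℕ.+ n)))))
      (trans (solve 3 (λ p s x → p :* (:1 :- s) := (p :* (:1 :+ x)) :* (:1 :- (s :+ x)) :+ p :* (x :* (s :+ x))) refl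
          (∏ (N ℕ.+ n)) (∑ n (λ i → C * θ ^ (N ℕ.+ i))) (C * θ ^ (N ℕ.+ n)))
        (+-congʳ (*-congʳ (reflexive (≡.cong ∏ (≡.sym (ℕ.+-suc N n)))))))) (∏-tail N n)

  -- From the index N at which the tail of Σ C θⁱ has dropped to ½, `∏-tail` keeps the product
  -- within twice `∏ N`; earlier products are smaller by monotonicity.
  ∏-bounded : Σ[ P ∈ Carrier ] (∀ n → ∏ n ≤ P)
  ∏-bounded = 2# * ∏ N , λ n → begin
      ∏ n  ≤⟨ ∏-mono n N ⟩
      ∏ (n ℕ.+ N)  ≈⟨ reflexive (≡.cong ∏ (ℕ.+-comm n N)) ⟩
      ∏ (N ℕ.+ n)  ≈⟨ trans (trans (sym (*-identityˡ _)) (*-congʳ (sym (inverse-correctʳ 0<2)))) (*-assoc _ ½ _) ⟩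
      2# * (½ * ∏ (N ℕ.+ n))  ≤⟨ *-monoˡ-≤ (<⇒≤ 0<2) (≤-trans (half n) (∏-tail N n)) ⟩
      2# * ∏ N  ∎
    where
    open ≤-Reasoning
    eventually-small = near (lim-* (C * γ) θ^→0) ½ 0<½
    N = proj₁ eventually-small
    CγθN≤½ : (C * γ) * θ ^ N ≤ ½
    CγθN≤½ = ≤-trans (x≤∣x∣ _) (≤-resp (∣∣-cong (solve 2 (λ x a → x :- a :* :0 := x) refl ((C * γ) * θ ^ N) (C * γ))) refl
      (proj₂ eventually-small N ℕ.≤-refl))
    tail≤½ : ∀ n → ∑ n (λ i → C * θ ^ (N ℕ.+ i)) ≤ ½
    tail≤½ n = begin
      ∑ n (λ i → C * θ ^ (N ℕ.+ i))  ≈⟨ ∑-cong n (λ i → trans (*-congˡ (^-homo-* θ N i)) (sym (*-assoc C _ _))) ⟩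
      ∑ n (λ i → (C * θ ^ N) * θ ^ i)  ≈⟨ ∑-* n _ _ ⟩
      (C * θ ^ N) * ∑ n (θ ^_)  ≤⟨ *-monoˡ-≤ (0≤Cθ^ N) (∑θ^≤γ n) ⟩
      (C * θ ^ N) * γ  ≈⟨ solve 3 (λ D t g → (D :* t) :* g := (D :* g) :* t) refl C (θ ^ N) γ ⟩
      (C * γ) * θ ^ N  ≤⟨ CγθN≤½ ⟩
      ½  ∎
    half : ∀ n → ½ * ∏ (N ℕ.+ n) ≤ ∏ (N ℕ.+ n) * (1# - ∑ n (λ i → C * θ ^ (N ℕ.+ i)))
    half n = ≤-resp (*-comm _ ½) refl (*-monoˡ-≤ (0≤∏ (N ℕ.+ n)) (≤-by (≤⇒0≤- (tail≤½ n))
      (trans (+-congʳ (trans (sym (½+½ 1#)) (+-cong (*-identityʳ ½) (*-identityʳ ½))))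
        (solve 2 (λ h s → (h :+ h) :- s := h :+ (h :- s)) refl ½ (∑ n (λ i → C * θ ^ (N ℕ.+ i)))))))

  P : Carrier
  P = proj₁ ∏-bounded

  ∏≤P : ∀ n → ∏ n ≤ P
  ∏≤P = proj₂ ∏-bounded

  0≤P : 0# ≤ P
  0≤P = ≤-trans (0≤∏ 0) (∏≤P 0)

  private
    θ^θ^≤ : ∀ n → θ ^ n * θ ^ n ≤ θ ^ n
    θ^θ^≤ n = ≤-resp refl (*-identityʳ _) (*-monoˡ-≤ (0≤^ n 0≤θ) (^≤1 n 0≤θ (<⇒≤ θ<1)))

  module Downward (m : ℕ) (v : ℕ → Carrier) (0≤v : ∀ k → 0# ≤ v k)
    (step : ∀ k → k ℕ.< m → v k ≤ C * θ ^ k * (∑ (suc m) (λ j → θ ^ j * v j) - ∑ (suc k) (λ j → θ ^ j * v j))) where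

    private
      f : ℕ → Carrier
      f j = θ ^ j * v j

      0≤f : ∀ j → 0# ≤ f j
      0≤f j = 0≤* (0≤^ j 0≤θ) (0≤v j)

      -- The sum over k ≤ j ≤ m, written as a difference of initial sums to match `step`.
      V : ℕ → Carrier
      V k = ∑ (suc m) f - ∑ k f

      0≤V : ∀ {k} → k ℕ.≤ suc m → 0# ≤ V k
      0≤V k≤ = ≤⇒0≤- (∑-extend 0≤f k≤)

      -- By `step`, V k ≤ (1 + C θᵏ) V (k+1). So V k · ∏ k does not decrease with k, up to k = m,
      -- where V m is the single term f m.
      V∏ : ∀ n k → n ℕ.+ k ≡ m → V k * ∏ k ≤ f m * ∏ m
      V∏ zero    k ≡.refl = ≤-reflexive (*-congʳ (solve 2 (λ s x → (s :+ x) :- s := x) refl (∑ m f) (f m)))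
      V∏ (suc n) k eq = ≤-trans (≤-by (0≤* (≤⇒0≤- f≤) (0≤∏ k)) (solve 4 (λ s x a p →
             (s :- x) :* (p :* (:1 :+ a)) := s :* p :+ (a :* (s :- x) :- x) :* p)
             refl (V k) (f k) (C * θ ^ k) (∏ k)))
          (≤-trans (≤-reflexive (*-congʳ (solve 3 (λ s u x → (s :- u) :- x := s :- (u :+ x)) refl (∑ (suc m) f) (∑ k f) (f k))))
            (V∏ n (suc k) (≡.trans (ℕ.+-suc n k) eq)))
        where
        k<m : k ℕ.< m
        k<m = ℕ.≤-trans (s≤s (ℕ.m≤n+m k n)) (ℕ.≤-reflexive eq)
        f≤ : f k ≤ C * θ ^ k * (V k - f k)
        f≤ = begin
          θ ^ k * v k  ≤⟨ *-monoˡ-≤ (0≤^ k 0≤θ) (step k k<m) ⟩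
          θ ^ k * (C * θ ^ k * V (suc k))  ≈⟨ solve 3 (λ t c s → t :* (c :* t :* s) := (c :* s) :* (t :* t)) refl (θ ^ k) C (V (suc k)) ⟩
          (C * V (suc k)) * (θ ^ k * θ ^ k)  ≤⟨ *-monoˡ-≤ (0≤* 0≤C (0≤V (s≤s (ℕ.<⇒≤ k<m)))) (θ^θ^≤ k) ⟩
          (C * V (suc k)) * θ ^ k  ≈⟨ solve 5 (λ c S u x t → (c :* (S :- (u :+ x))) :* t := c :* t :* ((S :- u) :- x)) refl
                                                            C (∑ (suc m) f) (∑ k f) (f k) (θ ^ k) ⟩
          C * θ ^ k * (V k - f k)  ∎
          where open ≤-Reasoning

    -- The bound on V is fed back into `step`: the factor θᵏ comes from the step itself, the factor
    -- θᵐ from f m.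
    downward : ∀ k → k ℕ.< m → v k ≤ C * P * (θ ^ k * θ ^ m) * v m
    downward k k<m = begin
      v k  ≤⟨ step k k<m ⟩
      C * θ ^ k * V (suc k)  ≤⟨ *-monoˡ-≤ (0≤Cθ^ k) V≤ ⟩
      C * θ ^ k * (f m * P)  ≈⟨ solve 5 (λ c t p u v → c :* t :* ((u :* v) :* p) := c :* p :* (t :* u) :* v) refl C (θ ^ k) P (θ ^ m) (v m) ⟩
      C * P * (θ ^ k * θ ^ m) * v m  ∎
      where
      open ≤-Reasoning
      V≤ : V (suc k) ≤ f m * P
      V≤ = begin
        V (suc k)  ≈⟨ *-identityʳ _ ⟨
        V (suc k) * 1#  ≤⟨ *-monoˡ-≤ (0≤V (s≤s (ℕ.<⇒≤ k<m))) (1≤∏ (suc k)) ⟩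
        V (suc k) * ∏ (suc k)   ≤⟨ V∏ (m ℕ.∸ suc k) (suc k) (ℕ.m∸n+n≡m k<m) ⟩
        f m * ∏ m  ≤⟨ *-monoˡ-≤ (0≤f m) (∏≤P m) ⟩
        f m * P  ∎

  -- The forward version serves row k of an inverse matrix, where each entry is driven by the
  -- earlier ones and the diagonal entry 1 of the identity starts the recursion.
  module Upward (k : ℕ) (v : ℕ → Carrier) (0≤v : ∀ m → 0# ≤ v m) (below : ∀ m → m ℕ.< k → v m ≈ 0#) (at : v k ≤ 1#)
    (step : ∀ m → k ℕ.< m → v m ≤ C * θ ^ m * ∑ m (λ j → θ ^ j * v j)) where

    private
      f : ℕ → Carrier
      f j = θ ^ j * v j

      0≤f : ∀ j → 0# ≤ f j
      0≤f j = 0≤* (0≤^ j 0≤θ) (0≤v j)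

      -- Mirror image of `V∏`: all terms before k vanish, the sum starts with at most θᵏ, and each
      -- further index n multiplies the bound by 1 + C θⁿ.
      U≤ : ∀ i → ∑ (suc k ℕ.+ i) f ≤ θ ^ k * ∏ (suc k ℕ.+ i)
      U≤ zero    = ≡.subst (λ n → ∑ n f ≤ θ ^ k * ∏ n) (≡.sym (ℕ.+-identityʳ (suc k))) (begin
        ∑ k f + f k  ≈⟨ trans (+-congʳ (∑-0 k (λ i i<k → trans (*-congˡ (below i i<k)) (zeroʳ _)))) (+-identityˡ _) ⟩
        θ ^ k * v k  ≤⟨ *-monoˡ-≤ (0≤^ k 0≤θ) (≤-trans at (1≤∏ (suc k))) ⟩
        θ ^ k * ∏ (suc k)  ∎)
        where open ≤-Reasoning
      U≤ (suc i) = ≡.subst (λ n → ∑ n f ≤ θ ^ k * ∏ n) (≡.sym (ℕ.+-suc (suc k) i)) (begin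
        ∑ n f + θ ^ n * v n  ≤⟨ +-monoʳ-≤ _ (*-monoˡ-≤ (0≤^ n 0≤θ) (step n (s≤s (ℕ.m≤m+n k i)))) ⟩
        ∑ n f + θ ^ n * (C * θ ^ n * ∑ n f)  ≈⟨ +-congˡ (solve 3 (λ t c s → t :* (c :* t :* s) := (c :* s) :* (t :* t)) refl (θ ^ n) C (∑ n f)) ⟩
        ∑ n f + (C * ∑ n f) * (θ ^ n * θ ^ n)  ≤⟨ +-monoʳ-≤ _ (*-monoˡ-≤ (0≤* 0≤C (∑-nonneg n 0≤f)) (θ^θ^≤ n)) ⟩
        ∑ n f + (C * ∑ n f) * θ ^ n  ≈⟨ solve 3 (λ s c t → s :+ (c :* s) :* t := s :* (:1 :+ c :* t)) refl (∑ n f) C (θ ^ n) ⟩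
        ∑ n f * (1# + C * θ ^ n)  ≤⟨ *-monoʳ-≤ (≤-trans 0≤1 (factor≥1 n)) (U≤ i) ⟩
        (θ ^ k * ∏ n) * (1# + C * θ ^ n)  ≈⟨ *-assoc _ _ _ ⟩
        θ ^ k * ∏ (suc n)  ∎)
        where
        open ≤-Reasoning
        n = suc k ℕ.+ i

    upward : ∀ m → k ℕ.< m → v m ≤ C * P * (θ ^ k * θ ^ m)
    upward m k<m = begin
      v m  ≤⟨ step m k<m ⟩
      C * θ ^ m * ∑ m f  ≤⟨ *-monoˡ-≤ (0≤Cθ^ m) (≡.subst (λ n → ∑ n f ≤ θ ^ k * ∏ n) (ℕ.m+[n∸m]≡n k<m) (U≤ (m ℕ.∸ suc k))) ⟩
      C * θ ^ m * (θ ^ k * ∏ m)  ≤⟨ *-monoˡ-≤ (0≤Cθ^ m) (*-monoˡ-≤ (0≤^ k 0≤θ) (∏≤P m)) ⟩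
      C * θ ^ m * (θ ^ k * P)  ≈⟨ solve 4 (λ c t u p → c :* t :* (u :* p) := c :* p :* (u :* t)) refl C (θ ^ m) (θ ^ k) P ⟩
      C * P * (θ ^ k * θ ^ m)  ∎
      where open ≤-Reasoning

-- Finite subsets as a net, list sums, and real or imaginary parts

finite-subsets : {I : Set} → DecidableEquality I → (I → Set) → Net
finite-subsets {I} _≟_ P = record
  { Index = FiniteSubset
  ; Tail  = FiniteSubset
  ; _∋_   = λ F G → proj₁ F ⊆ proj₁ G
  ; top   = [] , [] , []
  ; meet  = λ (F , _ , p) (G , _ , q) →
      -- The union has to be free of repetitions again, which is where decidable equality of the
      -- indices is used.
      (deduplicate _≟_ (F ++ G) , deduplicate-! _≟_ (F ++ G) , All.deduplicate⁺ _≟_ (All.++⁺ p q)) ,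
      λ _ F∪G⊆H → (λ i∈F → F∪G⊆H (∈-deduplicate⁺ _≟_ (xs⊆xs++ys F G i∈F)))
                , (λ i∈G → F∪G⊆H (∈-deduplicate⁺ _≟_ (xs⊆ys++xs G F i∈G)))
  ; point = λ F → F , id
  }
  where
  FiniteSubset : Set
  FiniteSubset = Σ[ F ∈ List I ] Unique F × All P F

module ListSums {c ℓ₁ ℓ₂ : Level} (ℝ : RealField c ℓ₁ ℓ₂) {I : Set} where
  open FiniteSums ℝ
  open Complex ℝ using (module ℝΣ)
  open ℝΣ using (Σ[_])

  Σ-cong : ∀ {F} {f g : I → Carrier} → All (λ i → f i ≈ g i) F → Σ[ F ] f ≈ Σ[ F ] g
  Σ-cong []       = refl
  Σ-cong (p ∷ ps) = +-cong p (Σ-cong ps)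

  Σ-cong′ : ∀ F {f g : I → Carrier} → (∀ i → f i ≈ g i) → Σ[ F ] f ≈ Σ[ F ] g
  Σ-cong′ F h = Σ-cong (All.universal h F)

  Σ-mono : ∀ {F} {f g : I → Carrier} → All (λ i → f i ≤ g i) F → Σ[ F ] f ≤ Σ[ F ] g
  Σ-mono []       = ≤-refl
  Σ-mono (p ∷ ps) = +-mono-≤ p (Σ-mono ps)

  Σ-* : ∀ F a (f : I → Carrier) → Σ[ F ] (λ i → a * f i) ≈ a * Σ[ F ] f
  Σ-* []      a f = sym (zeroʳ a)
  Σ-* (i ∷ F) a f = trans (+-congˡ (Σ-* F a f)) (sym (distribˡ a (f i) _))

  Σ-- : ∀ F (f g : I → Carrier) → Σ[ F ] (λ i → f i - g i) ≈ Σ[ F ] f - Σ[ F ] g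
  Σ-- []      f g = solve 0 (:0 := :0 :- :0) refl
  Σ-- (i ∷ F) f g = trans (+-congˡ (Σ-- F f g))
    (solve 4 (λ x y s t → (x :- y) :+ (s :- t) := (x :+ s) :- (y :+ t)) refl (f i) (g i) (Σ[ F ] f) (Σ[ F ] g))

  ∣Σ∣≤ : ∀ F (f : I → Carrier) → ∣ Σ[ F ] f ∣ ≤ Σ[ F ] (λ i → ∣ f i ∣)
  ∣Σ∣≤ []      f = ≤-reflexive (∣∣-nonneg ≤-refl)
  ∣Σ∣≤ (i ∷ F) f = ≤-trans (∣x+y∣≤ (f i) _) (+-monoʳ-≤ _ (∣Σ∣≤ F f))

  Σ-∑-swap : ∀ F n (f : I → ℕ → Carrier) → Σ[ F ] (λ i → ∑ n (f i)) ≈ ∑ n (λ k → Σ[ F ] (λ i → f i k))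
  Σ-∑-swap []      n f = sym (∑-0 n (λ _ _ → refl))
  Σ-∑-swap (i ∷ F) n f = trans (+-congˡ (Σ-∑-swap F n f)) (sym (∑-+ n (f i) _))

  Σ-nonneg : ∀ F {f : I → Carrier} → (∀ i → 0# ≤ f i) → 0# ≤ Σ[ F ] f
  Σ-nonneg []      h = ≤-refl
  Σ-nonneg (i ∷ F) h = 0≤+ (h i) (Σ-nonneg F h)

  Σ-term≤ : ∀ {F i} {f : I → Carrier} → (∀ i → 0# ≤ f i) → i ∈ F → f i ≤ Σ[ F ] f
  Σ-term≤ {i ∷ F} h (here ≡.refl) = ≤-by (Σ-nonneg F h) refl
  Σ-term≤ {j ∷ F} h (there i∈F)   = ≤-trans (Σ-term≤ h i∈F) (≤-by (h j) (+-comm _ _))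

module Parts {c ℓ₁ ℓ₂ : Level} (ℝ : RealField c ℓ₁ ℓ₂) where
  open ComplexNumbers ℝ

  -- Real and imaginary part under one interface: both commute with real scalars and are bounded by
  -- the modulus. A complex estimate becomes two real ones, and the modulus itself, a square root,
  -- never appears.
  record Part : Set (lsuc 0ℓ ⊔ c ⊔ ℓ₁ ⊔ ℓ₂) where
    field
      π       : ℂ → Carrier
      π-cong  : ∀ {z u} → z ≈ᶜ u → π z ≈ π u
      π-∑     : ∀ n f → π (∑ᶜ n f) ≡ ∑ n (π ∘ f)
      π-Σ     : ∀ {I : Set} (is : List I) (f : I → ℂ) → π (ℂΣ.Σ[ is ] f) ≡ ℝΣ.Σ[ is ] (π ∘ f)
      π-ofℝ*  : ∀ x z → π (ofℝ x *ᶜ z) ≈ x * π z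
      π-*ofℝ  : ∀ z x → π (z *ᶜ ofℝ x) ≈ x * π z
      π-+     : ∀ z u → π (z +ᶜ u) ≡ π z + π u
      π--     : ∀ z u → π (z -ᶜ u) ≡ π z - π u
      ∣π∣≤    : ∀ {z a} → 0# ≤ a → ∣ z ∣² ≤ a * a → ∣ π z ∣ ≤ a

  re-part im-part : Part
  re-part = record
    { π = re ; π-cong = proj₁ ; π-∑ = re-∑ ; π-Σ = re-Σ ; π-ofℝ* = re-ofℝ* ; π-*ofℝ = re-*ofℝ
    ; π-+ = λ _ _ → ≡.refl ; π-- = λ _ _ → ≡.refl ; ∣π∣≤ = λ {z} → ∣re∣≤ {z} }
  im-part = record
    { π = im ; π-cong = proj₂ ; π-∑ = im-∑ ; π-Σ = im-Σ ; π-ofℝ* = im-ofℝ* ; π-*ofℝ = im-*ofℝ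
    ; π-+ = λ _ _ → ≡.refl ; π-- = λ _ _ → ≡.refl ; ∣π∣≤ = λ {z} → ∣im∣≤ {z} }

module Restriction {c ℓ₁ ℓ₂ : Level} (ℝ : RealField c ℓ₁ ℓ₂) where
  open OrderedField ℝ

  restrict : ∀ {P : Set} → Dec P → Carrier → Carrier
  restrict (yes _) x = x
  restrict (no  _) x = 0#

  restrict-yes : ∀ {P : Set} (d : Dec P) {x} → P → restrict d x ≈ x
  restrict-yes (yes _) p = refl
  restrict-yes (no ¬p) p = ⊥-elim (¬p p)

  restrict-no : ∀ {P : Set} (d : Dec P) {x} → ¬ P → restrict d x ≈ 0#
  restrict-no (yes p) ¬p = ⊥-elim (¬p p)
  restrict-no (no _)  ¬p = refl

  restrict-bound : ∀ {P : Set} (d : Dec P) {x B} → 0# ≤ B → (P → ∣ x ∣ ≤ B) → ∣ restrict d x ∣ ≤ B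
  restrict-bound (yes p) 0≤B h = h p
  restrict-bound (no _)  0≤B h = ≤-trans (≤-reflexive (∣∣-nonneg ≤-refl)) 0≤B

-- The eigenvalue equation and the decay of centred coefficients

module EigenvalueEquation {c ℓ₁ ℓ₂ : Level} (ℝ : RealField c ℓ₁ ℓ₂)
  (b : ℕ) (1<b : 1 ℕ.< b) (w : List (Fin b)) (w≢[] : w ≢ [])
  (g_w : List (Fin b)) (shortest : Words.IsShortest𝒢 b w g_w)
  (x_w : RealField.Carrier ℝ)
  (digits : Setting.HasDigits ℝ b 1<b w x_w (Words.periodic b w g_w (proj₁ (proj₁ shortest))))
  (Λ : ℕ → RealField.Carrier ℝ) (isΛ : ∀ n → 1 ℕ.≤ n → Setting.Isλ ℝ b 1<b w n (Λ n))
  (R : RealField.Carrier ℝ)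
  (R_w<R : RealField._<_ ℝ (RealField._∨_ ℝ x_w (RealField._-_ ℝ (RealField.1# ℝ) x_w)) R)
  where

  open ComplexNumbers ℝ
  open Coefficients ℝ
  open Words b w
  open Setting ℝ b 1<b w
  open Expansions ℝ b 1<b w
  open Occurrences b w w≢[]
  open ListSums ℝ {Word}
  open ℝΣ using (Σ[_])

  net : Net
  net = finite-subsets (List.≡-dec Fin._≟_) 𝒢

  open Limits ℝ net
  open PolynomialLimits ℝ net

  HasSumOver⇒Lim : ∀ {f : Word → Carrier} {l} → ℝΣ.HasSumOver 𝒢 f l → Lim (λ F → Σ[ proj₁ F ] f) l
  HasSumOver⇒Lim h = lim λ ε 0<ε → let F , u , a , p = h ε 0<ε in
    (F , u , a) , λ (F′ , u′ , a′) F⊆F′ → <⇒≤ (p F′ u′ a′ F⊆F′)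

  private
    R_w = x_w ∨ (1# - x_w)

    0<R : 0# < R
    0<R = max[x,1-x]<R⇒0<R R_w<R

    0≤R : 0# ≤ R
    0≤R = <⇒≤ 0<R

    -- Twice the maximum is at least x_w + (1 - x_w) = 1.
    0≤R_w : 0# ≤ R_w
    0≤R_w = *-cancelˡ-≤ 0<2 (≤-trans (≤-reflexive (zeroʳ _)) (≤-trans 0≤1
      (≤-resp (solve 1 (λ x → x :+ (:1 :- x) := :1) refl x_w) (solve 1 (λ r → r :+ r := :2 :* r) refl R_w)
        (+-mono-≤ (∨-upperˡ x_w _) (∨-upperʳ x_w _)))))

    Q = R_w + ½ * (R - R_w)

    0≤Q : 0# ≤ Q
    0≤Q = 0≤+ 0≤R_w (<⇒≤ (0<½* (<⇒0<- R_w<R)))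

    Q<R : Q < R
    Q<R = <-by (0<½* (<⇒0<- R_w<R)) (trans (solve 2 (λ r R → R := r :+ (R :- r)) refl R_w R)
      (trans (+-congˡ (sym (½+½ (R - R_w)))) (sym (+-assoc R_w _ _))))

    R⁻¹ = inverse 0<R

    ρ = Q * R⁻¹

    0≤ρ : 0# ≤ ρ
    0≤ρ = 0≤* 0≤Q (<⇒≤ (0<inverse 0<R))

    ρ<1 : ρ < 1#
    ρ<1 = <-resp (*-comm _ _) (inverse-correct 0<R) (*-monoˡ-< (0<inverse 0<R) Q<R)

  -- The arithmetic mean of 1 and ρ = Q/R stands in for their geometric mean: its square is at least
  -- ρ, and it is still below 1. A factor ρʲ can thus be shared out as two factors θʲ.
  θ : Carrier
  θ = ½ * (1# + ρ)

  0≤θ : 0# ≤ θ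
  0≤θ = 0≤* (<⇒≤ 0<½) (0≤+ 0≤1 0≤ρ)

  θ<1 : θ < 1#
  θ<1 = <-≤-trans (*-monoˡ-< 0<½ (<-resp (+-comm ρ 1#) refl (+-monoˡ-< 1# ρ<1))) (≤-reflexive (inverse-correct 0<2))

  s : Word → Carrier
  s g = b⁻^ (length g)

  -- T_g(x_w) - x_w, so that in the coordinate y = x - x_w the map T_g reads y ↦ `offset g` + `s g`
  -- · y.
  offset : Word → Carrier
  offset g = x⟨ g ⟩ + s g * x_w - x_w

  private
    Q≤θ²R : Q ≤ θ * θ * R
    Q≤θ²R = ≤-resp (trans (*-assoc Q R⁻¹ R) (trans (*-congˡ (inverse-correct 0<R)) (*-identityʳ Q))) refl (*-monoʳ-≤ 0≤R ρ≤θ²)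
      where
      ρ≤θ² : ρ ≤ θ * θ
      ρ≤θ² = ≤-by (0≤square (½ * (1# - ρ)))
        (trans (solve 2 (λ h p → (h :* (:1 :+ p)) :* (h :* (:1 :+ p)) := (h :* :2) :* (h :* :2) :* p :+ (h :* (:1 :- p)) :* (h :* (:1 :- p)))
            refl ½ ρ)
          (+-congʳ (trans (*-congʳ (trans (*-cong (inverse-correct 0<2) (inverse-correct 0<2)) (*-identityˡ 1#))) (*-identityˡ ρ))))

    0<s : ∀ g → 0# < s g
    0<s g = 0<b⁻^ (length g)

    0≤s : ∀ g → 0# ≤ s g
    0≤s g = <⇒≤ (0<s g)

    s_w = s g_w

    s<1 : ∀ {g} → g ≢ [] → s g < 1#
    s<1 {[]}    g≢[] = ⊥-elim (g≢[] ≡.refl)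
    s<1 {_ ∷ g} _    = ≤-<-trans (b⁻^-suc≤½ (length g)) ½<1

    s_w<1 : s_w < 1#
    s_w<1 = s<1 (proj₁ (proj₁ shortest))

    t : Word → ℕ → ℕ → Carrier
    t g = powerCoeff (offset g) (s g)

    fixed : x_w ≈ x⟨ g_w ⟩ + s_w * x_w
    fixed = periodic-fixed (proj₁ (proj₁ shortest)) digits

    -- T_(g_w) fixes x_w, so applying it before T_h does not change where x_w goes.
    offset-suffix : ∀ h → offset (h ++ g_w) ≈ offset h
    offset-suffix h = +-congʳ (trans (+-cong (x-++ h g_w) (*-congʳ (b⁻^-length-++ h g_w)))
      (trans (solve 5 (λ x p y q z → (x :+ p :* y) :+ (p :* q) :* z := x :+ p :* (y :+ q :* z)) refl
          x⟨ h ⟩ (s h) x⟨ g_w ⟩ s_w x_w)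
        (+-congˡ (*-congˡ (sym fixed)))))

    -- Since T_h preserves [0,1], x_w moves by at most (1 - s)(1 - x_w) to the right and (1 - s) x_w
    -- to the left. Here lies the origin of the maximum `R_w`.
    ∣offset∣≤ : ∀ h → ∣ offset h ∣ ≤ (1# - s h) * R_w
    ∣offset∣≤ h = ∣∣≤
      (≤-trans (≤-by (≤⇒0≤- (x+b⁻^≤1 h)) (solve 3 (λ x p z → (:1 :- p) :* (:1 :- z) := (x :+ p :* z :- z) :+ (:1 :- (x :+ p)))
          refl x⟨ h ⟩ (s h) x_w)) (*-monoˡ-≤ (≤⇒0≤- (b⁻^≤1 (length h))) (∨-upperʳ x_w _)))
      (≤-trans (≤-by (0≤x h) (solve 3 (λ x p z → (:1 :- p) :* z := :- (x :+ p :* z :- z) :+ x)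
          refl x⟨ h ⟩ (s h) x_w)) (*-monoˡ-≤ (≤⇒0≤- (b⁻^≤1 (length h))) (∨-upperˡ x_w _)))

    -- The left side is at most (1 - s) R_w + s R, a mean whose weight on R is at most ½ as the word
    -- is non-empty; Q is the mean with weight exactly ½.
    contraction : ∀ a h → ∣ offset (a ∷ h) ∣ + R * s (a ∷ h) ≤ Q
    contraction a h = ≤-trans (+-monoˡ-≤ _ (∣offset∣≤ (a ∷ h))) (≤-by
      (0≤* (≤⇒0≤- (b⁻^-suc≤½ (length h))) (<⇒≤ (<⇒0<- R_w<R)))
      (solve 4 (λ r R p h → r :+ h :* (R :- r) := ((:1 :- p) :* r :+ R :* p) :+ (h :- p) :* (R :- r)) refl R_w R (s (a ∷ h)) ½))

    -- For g = h g_w the scale is `s_w * s h`, and `powerCoeff-bound` with p = `s_w` extracts the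
    -- factor `s_w ^ k`. An empty h does not contract, but then the offset is zero and the
    -- coefficients with k < j vanish.
    t-bound : ∀ {g} → 𝒢 g → ∀ {j k} → k ℕ.< j → R ^ k * ∣ t g j k ∣ ≤ s_w ^ k * Q ^ j
    t-bound {g} 𝒢g {j} {k} k<j = via-suffix (shortest-is-suffix shortest 𝒢g)
      where
      open ≤-Reasoning
      offset≈0 : offset g_w ≈ 0#
      offset≈0 = trans (offset-suffix []) (solve 1 (λ z → :0 :* :1 :+ :1 :* z :- z := :0) refl x_w)
      via-suffix : ∃[ h ] g ≡ h ++ g_w → R ^ k * ∣ t g j k ∣ ≤ s_w ^ k * Q ^ j
      via-suffix ([] , ≡.refl) = ≤-trans (≤-reflexive (trans (*-congˡ (trans (∣∣-cong (powerCoeff-centred (s g_w) offset≈0 k<j)) (∣∣-nonneg ≤-refl))) (zeroʳ _)))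
                          (0≤* (0≤^ k (0≤s g_w)) (0≤^ j 0≤Q))
      via-suffix (a ∷ h , ≡.refl) = begin
        R ^ k * ∣ t ((a ∷ h) ++ g_w) j k ∣
          ≈⟨ *-congˡ (∣∣-cong (powerCoeff-cong (offset-suffix (a ∷ h)) (trans (b⁻^-length-++ (a ∷ h) g_w) (*-comm _ _)) j k)) ⟩
        R ^ k * ∣ powerCoeff (offset (a ∷ h)) (s_w * s (a ∷ h)) j k ∣
          ≤⟨ powerCoeff-bound (0≤s g_w) (0≤s (a ∷ h)) 0≤R j k ⟩
        s_w ^ k * (∣ offset (a ∷ h) ∣ + R * s (a ∷ h)) ^ j
          ≤⟨ *-monoˡ-≤ (0≤^ k (0≤s g_w)) (^-monoˡ-≤ j (0≤+ (0≤∣∣ _) (0≤* 0≤R (0≤s (a ∷ h)))) (contraction a h)) ⟩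
        s_w ^ k * Q ^ j ∎

    Λ-lim : ∀ k → Lim (λ F → Σ[ proj₁ F ] (λ g → s g ^ suc k)) (Λ (suc k))
    Λ-lim k = lim-cong (always (λ F → Σ-cong′ (proj₁ F) (λ g →
        trans (reflexive (≡.cong b⁻^ (ℕ.*-comm (suc k) (length g)))) (sym (^-assocʳ β (length g) (suc k)))))) refl
      (HasSumOver⇒Lim (isΛ (suc k) (s≤s z≤n)))

    Λ₁-lim : Lim (λ F → Σ[ proj₁ F ] s) (Λ 1)
    Λ₁-lim = lim-cong (always (λ F → Σ-cong′ (proj₁ F) (λ g → *-identityʳ (s g)))) refl (Λ-lim 0)

    0≤Λ₁ : 0# ≤ Λ 1
    0≤Λ₁ = lim-≤ (always (λ F → Σ-nonneg (proj₁ F) 0≤s)) (lim-const 0#) Λ₁-lim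

    -- Every word contributes a non-negative difference of powers, so over any finite set containing
    -- `g_w` the sum is at least the term of `g_w`, which is smallest when m = k + 1.
    Λ-gap : ∀ {k m} → k ℕ.< m → s_w ^ suc k * (1# - s_w) ≤ Λ (suc k) - Λ (suc m)
    Λ-gap {k} {m} k<m = lim-≤
      (((g_w ∷ []) , [] ∷ [] , proj₁ shortest ∷ []) , λ F g_w∈F → ≤-trans gap-at-g_w
        (≤-trans (Σ-term≤ {f = λ g → s g ^ suc k - s g ^ suc m} nonneg (g_w∈F (here ≡.refl))) (≤-reflexive (Σ-- (proj₁ F) _ _))))
      (lim-const _) (lim-- (Λ-lim k) (Λ-lim m))
      where
      nonneg : ∀ g → 0# ≤ s g ^ suc k - s g ^ suc m
      nonneg g = ≤⇒0≤- (^-antitone (0≤s g) (b⁻^≤1 (length g)) (ℕ.<⇒≤ (s≤s k<m)))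
      gap-at-g_w : s_w ^ suc k * (1# - s_w) ≤ s_w ^ suc k - s_w ^ suc m
      gap-at-g_w = ≤-by (≤⇒0≤- (^-antitone {m = suc (suc k)} {suc m} (0≤s g_w) (<⇒≤ s_w<1) (s≤s k<m)))
        (solve 3 (λ q s r → s :* q :- r := (s :* q) :* (:1 :- s) :+ (s :* (s :* q) :- r)) refl (s_w ^ k) s_w (s_w ^ suc m))

    0<s_w[1-s_w] : 0# < s_w * (1# - s_w)
    0<s_w[1-s_w] = *-pos (0<s g_w) (<⇒0<- s_w<1)

  -- `Λ 1` is the total weight Σ s(g) in the row estimate; s_w (1 - s_w) is what remains of the gap
  -- once `s_w ^ k` has been cancelled.
  C : Carrier
  C = Λ 1 * inverse 0<s_w[1-s_w]

  0≤C : 0# ≤ C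
  0≤C = 0≤* 0≤Λ₁ (<⇒≤ (0<inverse 0<s_w[1-s_w]))

  open DiscreteGronwall ℝ θ 0≤θ θ<1 C 0≤C public

  -- The eigenvalue equation for real coefficients a in the coordinate y, with powers composed with
  -- T_g expanded by `powerCoeff`. It is applied once to the real and once to the imaginary parts of
  -- the coefficients.
  module Column (m : ℕ) (a : ℕ → Carrier)
    (eigen : ∀ y → Lim (λ F → Σ[ proj₁ F ] (λ g → s g * ∑ (suc m) (λ j → a j * ∑ (suc m) (λ k → t g j k * y ^ k))))
                       (Λ (suc m) * ∑ (suc m) (λ k → a k * y ^ k))) where

    private
      applied : Word → ℕ → Carrier
      applied g k = ∑ (suc m) (λ j → a j * t g j k)

      -- The coefficient of yᵏ in the partial sum over F that approximates the operator.
      κ : ℕ → List Word → Carrier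
      κ k F = Σ[ F ] (λ g → s g * applied g k)

      κ-sum : ∀ F y → Σ[ F ] (λ g → s g * ∑ (suc m) (λ j → a j * ∑ (suc m) (λ k → t g j k * y ^ k))) ≈
                      ∑ (suc m) (λ k → κ k F * y ^ k)
      κ-sum F y = trans (Σ-cong′ F λ g → trans (*-congˡ (trans
            (∑-cong (suc m) λ j → trans (sym (∑-* (suc m) (a j) _)) (∑-cong (suc m) (λ k →
              solve 3 (λ a t y → a :* (t :* y) := y :* (a :* t)) refl (a j) (t g j k) (y ^ k))))
            (trans (∑-swap (suc m) (suc m) _) (∑-cong (suc m) (λ k → ∑-* (suc m) (y ^ k) _)))))
          (trans (sym (∑-* (suc m) (s g) _)) (∑-cong (suc m) (λ k →
            solve 3 (λ s y x → s :* (y :* x) := y :* (s :* x)) refl (s g) (y ^ k) (applied g k)))))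
        (trans (Σ-∑-swap F (suc m) _) (∑-cong (suc m) (λ k → trans (Σ-* F (y ^ k) _) (*-comm _ _))))

      -- The hypothesis holds pointwise in y; `coefficients→0`, applied to the difference of its two
      -- sides, turns it into one limit per coefficient.
      κ-lim : ∀ k → k ℕ.< suc m → Lim (λ F → κ k (proj₁ F)) (Λ (suc m) * a k)
      κ-lim k k≤m = lim-cong (always (λ F → solve 2 (λ x y → (x :- y) :+ y := x) refl (κ k (proj₁ F)) (Λ (suc m) * a k)))
        (+-identityˡ _)
        (lim-+ (coefficients→0 (suc m) (λ k F → κ k (proj₁ F) - Λ (suc m) * a k) small k k≤m) (lim-const (Λ (suc m) * a k)))
        where
        small : ∀ y → Lim (λ F → ∑ (suc m) (λ k → (κ k (proj₁ F) - Λ (suc m) * a k) * y ^ k)) 0#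
        small y = lim-cong (always (λ F → trans (+-cong (κ-sum (proj₁ F) y) (-‿cong (trans (sym (∑-* (suc m) _ _)) refl)))
            (trans (sym (∑-- (suc m) _ _)) (∑-cong (suc m) (λ k →
              solve 4 (λ x l a y → x :* y :- l :* (a :* y) := (x :- l :* a) :* y) refl (κ k (proj₁ F)) (Λ (suc m)) (a k) (y ^ k))))))
          (-‿inverseʳ _) (lim-- (eigen y) (lim-const (Λ (suc m) * ∑ (suc m) (λ k → a k * y ^ k))))

    v : ℕ → Carrier
    v j = R ^ j * ∣ a j ∣

    0≤v : ∀ j → 0# ≤ v j
    0≤v j = 0≤* (0≤^ j 0≤R) (0≤∣∣ (a j))

    private
      W : ℕ → Carrier
      W k = ∑ (m ℕ.∸ k) (λ i → ∣ a (suc k ℕ.+ i) ∣ * Q ^ (suc k ℕ.+ i))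

      split : ∀ {k} → k ℕ.< m → ∀ f → ∑ (suc m) f ≈ ∑ k f + f k + ∑ (m ℕ.∸ k) (λ i → f (suc k ℕ.+ i))
      split {k} k<m f = trans (reflexive (≡.cong (λ n → ∑ n f) (≡.cong suc (≡.sym (ℕ.m+[n∸m]≡n (ℕ.<⇒≤ k<m))))))
        (∑-split (suc k) (m ℕ.∸ k) f)

      -- Degrees below k contribute nothing to yᵏ and degree k contributes the subtracted diagonal,
      -- so only j > k remains, where `t-bound` applies.
      off-diagonal : ∀ {g} → 𝒢 g → ∀ {k} → k ℕ.< m →
                     R ^ k * ∣ applied g k - a k * s g ^ k ∣ ≤ s_w ^ k * W k
      off-diagonal {g} 𝒢g {k} k<m = begin
        R ^ k * ∣ applied g k - a k * s g ^ k ∣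
          ≈⟨ *-congˡ (∣∣-cong (trans (+-cong (split k<m _) (-‿cong (*-congˡ (sym (powerCoeff-diagonal (offset g) (s g) k)))))
               (trans (+-congʳ (+-congʳ (+-congʳ (∑-0 k (λ j j<k → trans (*-congˡ (powerCoeff-above (offset g) (s g) j<k)) (zeroʳ _))))))
                 (solve 2 (λ x y → (:0 :+ x) :+ y :- x := y) refl (a k * t g k k) (∑ (m ℕ.∸ k) (λ i → a (j i) * t g (j i) k)))))) ⟩
        R ^ k * ∣ ∑ (m ℕ.∸ k) (λ i → a (j i) * t g (j i) k) ∣
          ≤⟨ *-monoˡ-≤ (0≤^ k 0≤R) (∣∑∣≤ (m ℕ.∸ k) _) ⟩
        R ^ k * ∑ (m ℕ.∸ k) (λ i → ∣ a (j i) * t g (j i) k ∣)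
          ≈⟨ ∑-* (m ℕ.∸ k) (R ^ k) _ ⟨
        ∑ (m ℕ.∸ k) (λ i → R ^ k * ∣ a (j i) * t g (j i) k ∣)
          ≤⟨ ∑-mono (m ℕ.∸ k) (λ i _ → term i) ⟩
        ∑ (m ℕ.∸ k) (λ i → s_w ^ k * (∣ a (j i) ∣ * Q ^ j i))
          ≈⟨ ∑-* (m ℕ.∸ k) (s_w ^ k) _ ⟩
        s_w ^ k * W k ∎
        where
        open ≤-Reasoning
        j : ℕ → ℕ
        j i = suc k ℕ.+ i
        term : ∀ i → R ^ k * ∣ a (j i) * t g (j i) k ∣ ≤ s_w ^ k * (∣ a (j i) ∣ * Q ^ j i)
        term i = ≤-trans (≤-reflexive (trans (*-congˡ (∣x*y∣ (a (j i)) _))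
              (solve 3 (λ r a t → r :* (a :* t) := a :* (r :* t)) refl (R ^ k) (∣ a (j i) ∣) (∣ t g (j i) k ∣))))
          (≤-trans (*-monoˡ-≤ (0≤∣∣ (a (j i))) (t-bound 𝒢g (s≤s (ℕ.m≤m+n k i))))
            (≤-reflexive (solve 3 (λ a p q → a :* (p :* q) := p :* (a :* q)) refl (∣ a (j i) ∣) (s_w ^ k) (Q ^ j i))))

      κ-estimate : ∀ {k} → k ℕ.< m → ∀ {F} → All 𝒢 F →
        ∣ R ^ k * (κ k F - a k * Σ[ F ] (λ g → s g ^ suc k)) ∣ ≤ (s_w ^ k * W k) * Σ[ F ] s
      κ-estimate {k} k<m {F} 𝒢F = begin
        ∣ R ^ k * (κ k F - a k * Σ[ F ] (λ g → s g ^ suc k)) ∣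
          ≈⟨ ∣∣-cong (trans (*-congˡ (trans (+-congˡ (-‿cong (sym (Σ-* F (a k) _)))) (sym (Σ-- F _ _)))) (sym (Σ-* F (R ^ k) _))) ⟩
        ∣ Σ[ F ] (λ g → R ^ k * (s g * applied g k - a k * s g ^ suc k)) ∣
          ≤⟨ ∣Σ∣≤ F _ ⟩
        Σ[ F ] (λ g → ∣ R ^ k * (s g * applied g k - a k * s g ^ suc k) ∣)
          ≤⟨ Σ-mono (All.map term 𝒢F) ⟩
        Σ[ F ] (λ g → (s_w ^ k * W k) * s g)
          ≈⟨ Σ-* F (s_w ^ k * W k) s ⟩
        (s_w ^ k * W k) * Σ[ F ] s ∎
        where
        open ≤-Reasoning
        term : ∀ {g} → 𝒢 g → ∣ R ^ k * (s g * applied g k - a k * s g ^ suc k) ∣ ≤ (s_w ^ k * W k) * s g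
        term {g} 𝒢g = ≤-trans (≤-reflexive (trans (∣∣-cong (solve 5 (λ r s x a q → r :* (s :* x :- a :* (s :* q)) := (s :* r) :* (x :- a :* q))
              refl (R ^ k) (s g) (applied g k) (a k) (s g ^ k)))
            (trans (∣c*x∣ _ (0≤* (0≤s g) (0≤^ k 0≤R))) (*-assoc _ _ _))))
          (≤-trans (*-monoˡ-≤ (0≤s g) (off-diagonal 𝒢g k<m)) (≤-reflexive (*-comm _ _)))

      -- In the limit the diagonal parts add up to `Λ (suc k)`, so the left side is the eigenvalue
      -- gap times a k, up to sign and Rᵏ.
      limit-estimate : ∀ {k} → k ℕ.< m → ∣ R ^ k * (Λ (suc m) * a k - a k * Λ (suc k)) ∣ ≤ (s_w ^ k * W k) * Λ 1
      limit-estimate {k} k<m = lim-∣∣≤ (always (λ (F , _ , 𝒢F) → κ-estimate k<m 𝒢F))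
        (lim-* (R ^ k) (lim-- (κ-lim k (ℕ.<⇒≤ (s≤s k<m))) (lim-* (a k) (Λ-lim k)))) (lim-* (s_w ^ k * W k) Λ₁-lim)

      -- Gap and row estimate both carry `s_w ^ k`. Cancelling it makes C independent of k and m.
      v≤CW : ∀ {k} → k ℕ.< m → v k ≤ C * W k
      v≤CW {k} k<m = *-cancelˡ-≤ 0<s_w[1-s_w] (*-cancelˡ-≤ (0<^ k (0<s g_w)) (begin
        s_w ^ k * (s_w * (1# - s_w) * v k)
          ≈⟨ solve 3 (λ q s v → q :* (s :* (:1 :- s) :* v) := (s :* q) :* (:1 :- s) :* v) refl (s_w ^ k) s_w (v k) ⟩
        s_w ^ suc k * (1# - s_w) * v k
          ≤⟨ *-monoʳ-≤ (0≤v k) (Λ-gap k<m) ⟩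
        (Λ (suc k) - Λ (suc m)) * v k
          ≈⟨ solve 3 (λ g r x → g :* (r :* x) := r :* (g :* x)) refl (Λ (suc k) - Λ (suc m)) (R ^ k) (∣ a k ∣) ⟩
        R ^ k * ((Λ (suc k) - Λ (suc m)) * ∣ a k ∣)
          ≈⟨ *-congˡ (∣c*x∣ (a k) 0≤gap) ⟨
        R ^ k * ∣ (Λ (suc k) - Λ (suc m)) * a k ∣
          ≈⟨ *-congˡ (trans (∣∣-cong (solve 3 (λ x y a → (x :- y) :* a := :- (y :* a :- a :* x)) refl (Λ (suc k)) (Λ (suc m)) (a k))) (∣-∣ _)) ⟩
        R ^ k * ∣ Λ (suc m) * a k - a k * Λ (suc k) ∣
          ≈⟨ ∣c*x∣ _ (0≤^ k 0≤R) ⟨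
        ∣ R ^ k * (Λ (suc m) * a k - a k * Λ (suc k)) ∣
          ≤⟨ limit-estimate k<m ⟩
        (s_w ^ k * W k) * Λ 1
          ≈⟨ solve 3 (λ q w l → (q :* w) :* l := q :* (:1 :* (l :* w))) refl (s_w ^ k) (W k) (Λ 1) ⟩
        s_w ^ k * (1# * (Λ 1 * W k))
          ≈⟨ *-congˡ (trans (*-congʳ (sym (inverse-correctʳ 0<s_w[1-s_w])))
               (solve 4 (λ d i l w → (d :* i) :* (l :* w) := d :* ((l :* i) :* w)) refl (s_w * (1# - s_w)) (inverse 0<s_w[1-s_w]) (Λ 1) (W k))) ⟩
        s_w ^ k * (s_w * (1# - s_w) * (C * W k)) ∎))
        where
        open ≤-Reasoning
        0≤gap : 0# ≤ Λ (suc k) - Λ (suc m)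
        0≤gap = ≤-trans (0≤* (0≤^ (suc k) (0≤s g_w)) (<⇒≤ (<⇒0<- s_w<1))) (Λ-gap k<m)

      -- Q ≤ θ² R turns Qʲ into θʲ θʲ Rʲ. One θʲ is kept as a weight inside the sum, the other is at
      -- most θᵏ because j exceeds k.
      W≤ : ∀ {k} → k ℕ.< m → W k ≤ θ ^ k * (∑ (suc m) (λ j → θ ^ j * v j) - ∑ (suc k) (λ j → θ ^ j * v j))
      W≤ {k} k<m = begin
        W k
          ≤⟨ ∑-mono (m ℕ.∸ k) (λ i _ → term (suc k ℕ.+ i) (ℕ.≤-trans (ℕ.n≤1+n k) (ℕ.m≤m+n (suc k) i))) ⟩
        ∑ (m ℕ.∸ k) (λ i → θ ^ k * f (suc k ℕ.+ i))
          ≈⟨ ∑-* (m ℕ.∸ k) (θ ^ k) _ ⟩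
        θ ^ k * ∑ (m ℕ.∸ k) (λ i → f (suc k ℕ.+ i))
          ≈⟨ *-congˡ (trans (+-congʳ (split k<m f)) (solve 2 (λ x y → (x :+ y) :- x := y) refl (∑ (suc k) f) _)) ⟨
        θ ^ k * (∑ (suc m) f - ∑ (suc k) f) ∎
        where
        open ≤-Reasoning
        f : ℕ → Carrier
        f j = θ ^ j * v j
        term : ∀ j → k ℕ.≤ j → ∣ a j ∣ * Q ^ j ≤ θ ^ k * f j
        term j k≤j = begin
          ∣ a j ∣ * Q ^ j  ≤⟨ *-monoˡ-≤ (0≤∣∣ (a j)) (^-monoˡ-≤ j 0≤Q Q≤θ²R) ⟩
          ∣ a j ∣ * (θ * θ * R) ^ j  ≈⟨ *-congˡ (trans (^-distrib-* (θ * θ) R j) (*-congʳ (^-distrib-* θ θ j))) ⟩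
          ∣ a j ∣ * (θ ^ j * θ ^ j * R ^ j)  ≈⟨ solve 3 (λ a t r → a :* (t :* t :* r) := t :* (t :* (r :* a))) refl (∣ a j ∣) (θ ^ j) (R ^ j) ⟩
          θ ^ j * f j  ≤⟨ *-monoʳ-≤ (0≤* (0≤^ j 0≤θ) (0≤v j)) (^-antitone 0≤θ (<⇒≤ θ<1) k≤j) ⟩
          θ ^ k * f j  ∎

    open Downward m v 0≤v (λ k k<m → ≤-trans (v≤CW k<m) (≤-trans (*-monoˡ-≤ 0≤C (W≤ k<m)) (≤-reflexive (sym (*-assoc C _ _))))) public
      using (downward)

  module Eigenpolynomials (𝓑 : ∀ m → MonicPoly m) (eigen : ∀ m → IsEigenfunction (Λ (suc m)) (eval (𝓑 m))) where
    open Parts ℝ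
    open Restriction ℝ
    open Hardy ℝ x_w R 0<R using (R⁻^; e; normalized)

    private
      α : ℕ → ℕ → ℂ
      α m = centredCoeff x_w (𝓑 m)

    module _ (part : Part) (m : ℕ) where
      open Part part

      private
        part-lim : ∀ {f : Word → ℂ} {l} → ℂΣ.HasSumOver 𝒢 f l → Lim (λ F → Σ[ proj₁ F ] (π ∘ f)) (π l)
        part-lim {f} {l} h = lim λ ε 0<ε → let F , u , a , p = h ε 0<ε in
          (F , u , a) , λ (F′ , u′ , a′) F⊆F′ → ≤-resp
            (∣∣-cong (trans (reflexive (π-- _ l)) (+-congʳ (reflexive (π-Σ F′ f))))) refl
            (∣π∣≤ (<⇒≤ 0<ε) (<⇒≤ (p F′ u′ a′ F⊆F′)))

        π-eval : ∀ z (p : ℕ → Carrier) → (∀ j → j ℕ.< suc m → (z -ᶜ ofℝ x_w) ^ᶜ j ≈ᶜ ofℝ (p j)) →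
                 π (eval (𝓑 m) z) ≈ ∑ (suc m) (λ j → π (α m j) * p j)
        π-eval z p h = trans (π-cong (eval-centred x_w (𝓑 m) z)) (trans (reflexive (π-∑ (suc m) _))
          (∑-cong< (suc m) (λ j j≤m → trans (π-cong (ℂR.*-congˡ (h j j≤m))) (trans (π-*ofℝ (α m j) (p j)) (*-comm _ _)))))

        powers : ∀ a s y {z} → z -ᶜ ofℝ x_w ≈ᶜ ofℝ a +ᶜ ofℝ s *ᶜ ofℝ y → ∀ j → j ℕ.< suc m →
                 (z -ᶜ ofℝ x_w) ^ᶜ j ≈ᶜ ofℝ (∑ (suc m) (λ k → powerCoeff a s j k * y ^ k))
        powers a s y {z} z≈ j j≤m = ℂR.trans (^ᶜ-cong j z≈) (ℂR.trans (power-expansion a s (ofℝ y) j (suc m) j≤m)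
          (ℂR.trans (∑ᶜ-cong (suc m) (λ k → ℂR.trans (ℂR.*-congˡ (ℂR.sym (ofℝ-^ y k))) (ℂR.sym (ofℝ-* _ (y ^ k)))))
            (ℂR.sym (ofℝ-∑ (suc m) _))))

      -- The equation is evaluated at the real points x_w + y only. The maps T_g are real, so all
      -- powers there are real and taking a part of the equation just takes that part of the
      -- coefficients.
      column : ∀ k → k ℕ.< m → R ^ k * ∣ π (α m k) ∣ ≤ C * P * (θ ^ k * θ ^ m) * (R ^ m * ∣ π (α m m) ∣)
      column = Column.downward m (π ∘ α m) λ y → lim-cong
        (always λ F → Σ-cong′ (proj₁ F) λ g → trans (π-ofℝ* _ (eval (𝓑 m) (image g y))) (*-congˡ
          (π-eval (image g y) _ (powers (offset g) (s g) y (image-offset g y)))))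
        (trans (π-ofℝ* (Λ (suc m)) _) (*-congˡ (π-eval (ofℝ (x_w + y)) (y ^_) (λ j _ →
          ℂR.trans (^ᶜ-cong j (solve 2 (λ x y → (x :+ y) :- x := y) refl x_w y , -‿inverseʳ 0#)) (ℂR.sym (ofℝ-^ y j))))))
        (part-lim (eigen m (ofℝ (x_w + y))))
        where
        image : Word → Carrier → ℂ
        image g y = ofℝ x⟨ g ⟩ +ᶜ ofℝ (s g) *ᶜ ofℝ (x_w + y)
        image-offset : ∀ g y → image g y -ᶜ ofℝ x_w ≈ᶜ ofℝ (offset g) +ᶜ ofℝ (s g) *ᶜ ofℝ y
        image-offset g y =
          solve 4 (λ x s a y → (x :+ (s :* (a :+ y) :- :0 :* :0)) :- a := (x :+ s :* a :- a) :+ (s :* y :- :0 :* :0)) refl x⟨ g ⟩ (s g) x_w y ,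
          solve 3 (λ s a y → (:0 :+ (s :* :0 :+ :0 :* (a :+ y))) :- :0 := :0 :+ (s :* :0 :+ :0 :* y)) refl (s g) x_w y

    -- R⁻ᵐ 𝓑ₘ = eₘ + Σ_{k<m} (N k m) eₖ
    N : ℕ → ℕ → Carrier
    N k m = restrict (k ℕ.<? m) (R ^ k * R⁻¹ ^ m * re (α m k))

    N-upper : ∀ {k m} → m ℕ.≤ k → N k m ≈ 0#
    N-upper {k} {m} m≤k = restrict-no (k ℕ.<? m) (λ k<m → ℕ.<-irrefl ≡.refl (ℕ.<-≤-trans k<m m≤k))

    private
      N-below : ∀ {k m} → k ℕ.< m → N k m ≈ R ^ k * R⁻¹ ^ m * re (α m k)
      N-below {k} {m} k<m = restrict-yes (k ℕ.<? m) k<m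

      0≤R⁻¹ : 0# ≤ R⁻¹
      0≤R⁻¹ = <⇒≤ (0<inverse 0<R)

    K : Carrier
    K = C * P

    0≤K : 0# ≤ K
    0≤K = 0≤* 0≤C 0≤P

    N-bound : ∀ k m → ∣ N k m ∣ ≤ K * (θ ^ k * θ ^ m)
    N-bound k m = restrict-bound (k ℕ.<? m) (0≤* 0≤K (0≤* (0≤^ k 0≤θ) (0≤^ m 0≤θ))) λ k<m → begin
      ∣ R ^ k * R⁻¹ ^ m * re (α m k) ∣  ≈⟨ ∣c*x∣ _ (0≤* (0≤^ k (<⇒≤ 0<R)) (0≤^ m 0≤R⁻¹)) ⟩
      R ^ k * R⁻¹ ^ m * ∣ re (α m k) ∣  ≈⟨ solve 3 (λ r i a → r :* i :* a := i :* (r :* a)) refl (R ^ k) (R⁻¹ ^ m) _ ⟩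
      R⁻¹ ^ m * (R ^ k * ∣ re (α m k) ∣)  ≤⟨ *-monoˡ-≤ (0≤^ m 0≤R⁻¹) (column re-part m k k<m) ⟩
      R⁻¹ ^ m * (K * (θ ^ k * θ ^ m) * (R ^ m * ∣ re (α m m) ∣))  ≈⟨ solve 4 (λ i x r a → i :* (x :* (r :* a)) := x :* ((i :* r) :* a)) refl
                                                                         (R⁻¹ ^ m) (K * (θ ^ k * θ ^ m)) (R ^ m) (∣ re (α m m) ∣) ⟩
      K * (θ ^ k * θ ^ m) * ((R⁻¹ ^ m * R ^ m) * ∣ re (α m m) ∣)    ≈⟨ *-congˡ (*-cong (inverse^-correct 0<R m)
                                                                         (trans (∣∣-cong (proj₁ (centredCoeff-top x_w (𝓑 m)))) (∣∣-nonneg 0≤1))) ⟩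
      K * (θ ^ k * θ ^ m) * (1# * 1#)  ≈⟨ trans (*-congˡ (*-identityˡ 1#)) (*-identityʳ _) ⟩
      K * (θ ^ k * θ ^ m)  ∎
      where open ≤-Reasoning

    private
      -- `column` bounds the lower coefficients by the leading one, and the leading coefficient 1
      -- has imaginary part 0. Hence the matrix `N` may be taken real.
      im-α : ∀ {k m} → k ℕ.< m → im (α m k) ≈ 0#
      im-α {k} {m} k<m = ∣x∣≤0⇒x≈0 (*-cancelˡ-≤ (0<^ k 0<R) (≤-trans (column im-part m k k<m) (≤-reflexive
        (trans (*-congˡ (*-congˡ (trans (∣∣-cong (proj₂ (centredCoeff-top x_w (𝓑 m)))) (∣∣-nonneg ≤-refl))))
          (solve 3 (λ x r q → x :* (r :* :0) := q :* :0) refl (K * (θ ^ k * θ ^ m)) (R ^ m) (R ^ k))))))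

    normalized-expansion : ∀ m z → normalized 𝓑 m z ≈ᶜ e m z +ᶜ ∑ᶜ m (λ k → ofℝ (N k m) *ᶜ e k z)
    normalized-expansion m (z , z∈D) = begin
      R⁻^ m *ᶜ eval (𝓑 m) z
        ≈⟨ ℂR.*-congˡ (eval-centred x_w (𝓑 m) z) ⟩
      R⁻^ m *ᶜ (∑ᶜ m (λ k → α m k *ᶜ y ^ᶜ k) +ᶜ α m m *ᶜ y ^ᶜ m)
        ≈⟨ ℂR.trans (ℂR.distribˡ (R⁻^ m) _ _) (ℂR.+-comm _ _) ⟩
      R⁻^ m *ᶜ (α m m *ᶜ y ^ᶜ m) +ᶜ R⁻^ m *ᶜ ∑ᶜ m (λ k → α m k *ᶜ y ^ᶜ k)
        ≈⟨ ℂR.+-cong (ℂR.*-congˡ (ℂR.trans (ℂR.*-congʳ (centredCoeff-top x_w (𝓑 m))) (ℂR.*-identityˡ _)))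
                     (ℂR.trans (ℂR.sym (∑ᶜ-* m (R⁻^ m) _)) (∑ᶜ-cong< m (λ k k<m → term k k<m))) ⟩
      e m (z , z∈D) +ᶜ ∑ᶜ m (λ k → ofℝ (N k m) *ᶜ e k (z , z∈D)) ∎
      where
      open import Relation.Binary.Reasoning.Setoid ℂR.setoid
      y = z -ᶜ ofℝ x_w
      real : ∀ k → k ℕ.< m → α m k ≈ᶜ ofℝ (re (α m k))
      real k k<m = refl , im-α k<m
      coefficient : ∀ k → k ℕ.< m → R⁻^ m *ᶜ α m k ≈ᶜ ofℝ (N k m) *ᶜ R⁻^ k
      coefficient k k<m = ℂR.trans (ℂR.*-congˡ (real k k<m)) (ℂR.trans (ℂR.sym (ofℝ-* (R⁻¹ ^ m) _)) (ℂR.trans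
        (ofℝ-cong (trans (trans (sym (*-identityˡ _)) (*-congʳ (sym (inverse^-correct 0<R k))))
          (trans (solve 4 (λ i r j a → (i :* r) :* (j :* a) := (r :* j :* a) :* i) refl (R⁻¹ ^ k) (R ^ k) (R⁻¹ ^ m) (re (α m k)))
            (*-congʳ (sym (N-below k<m))))))
        (ofℝ-* (N k m) (R⁻¹ ^ k))))
      term : ∀ k → k ℕ.< m → R⁻^ m *ᶜ (α m k *ᶜ y ^ᶜ k) ≈ᶜ ofℝ (N k m) *ᶜ e k (z , z∈D)
      term k k<m = ℂR.trans (ℂR.sym (ℂR.*-assoc _ _ _)) (ℂR.trans (ℂR.*-congʳ (coefficient k k<m)) (ℂR.*-assoc _ _ _))

-- Real series and uniqueness of power series coefficients

module SeriesLemmas {c ℓ₁ ℓ₂ : Level} (ℝ : RealField c ℓ₁ ℓ₂) where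
  open FiniteSums ℝ
  open Sequences ℝ
  open Limits ℝ ℕ-net

  series-cong : ∀ {f g s u} → (∀ k → f k ≈ g k) → s ≈ u → Series f s → Series g u
  series-cong h = lim-cong (always (λ n → ∑-cong n h))

  series-+ : ∀ {f g s u} → Series f s → Series g u → Series (λ k → f k + g k) (s + u)
  series-+ {f} {g} p q = lim-cong (always (λ n → sym (∑-+ n f g))) refl (lim-+ p q)

  series-* : ∀ {f s} a → Series f s → Series (λ k → a * f k) (a * s)
  series-* {f} a p = lim-cong (always (λ n → sym (∑-* n a f))) refl (lim-* a p)

  series-- : ∀ {f g s u} → Series f s → Series g u → Series (λ k → f k - g k) (s - u)
  series-- {f} {g} p q = lim-cong (always (λ n → sym (∑-- n f g))) refl (lim-- p q)

  series-tail : ∀ {f g s} n → Series f s → (∀ k → k ℕ.< n → g k ≈ 0#) → (∀ k → n ℕ.≤ k → g k ≈ f k) → Series g (s - ∑ n f)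
  series-tail {f} {g} n p below above = lim-cong
    (n , λ N n≤N → ≡.subst (λ N → ∑ N f - ∑ n f ≈ ∑ N g) (ℕ.m+[n∸m]≡n n≤N) (partial (N ℕ.∸ n)))
    refl (lim-- p (lim-const (∑ n f)))
    where
    partial : ∀ i → ∑ (n ℕ.+ i) f - ∑ n f ≈ ∑ (n ℕ.+ i) g
    partial i = trans (+-congʳ (∑-split n i f)) (trans (solve 2 (λ x y → (x :+ y) :- x := y) refl (∑ n f) _)
      (trans (∑-cong i (λ j → sym (above (n ℕ.+ j) (ℕ.m≤m+n n j))))
        (sym (trans (∑-split n i g) (trans (+-congʳ (∑-0 n below)) (+-identityˡ _))))))

  series-finite : ∀ {f} n → (∀ k → n ℕ.≤ k → f k ≈ 0#) → Series f (∑ n f)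
  series-finite {f} n h = lim-cong
    (n , λ N n≤N → ≡.subst (λ N → ∑ n f ≈ ∑ N f) (ℕ.m+[n∸m]≡n n≤N) (sym (partial (N ℕ.∸ n))))
    refl (lim-const (∑ n f))
    where
    partial : ∀ i → ∑ (n ℕ.+ i) f ≈ ∑ n f
    partial i = trans (∑-split n i f) (trans (+-congˡ (∑-0 i (λ j _ → h (n ℕ.+ j) (ℕ.m≤m+n n j)))) (+-identityʳ _))

  partial≤series : ∀ {f s} → (∀ k → 0# ≤ f k) → Series f s → ∀ n → ∑ n f ≤ s
  partial≤series h p n = lim-≤ (n , λ N n≤N → ∑-extend h n≤N) (lim-const _) p

  series≤ : ∀ {f s B} → (∀ n → ∑ n f ≤ B) → Series f s → s ≤ B
  series≤ h p = lim-≤ (always h) p (lim-const _)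

  -- 2 l x ≤ l² + x², at the limit x → l.
  limit-square≤ : ∀ {f l B} → (∀ n → f n * f n ≤ B) → Lim f l → l * l ≤ B
  limit-square≤ {f} {l} {B} h p = ≤-by (≤⇒0≤- 2l²≤)
    (solve 2 (λ l B → B := l :* l :+ ((l :* l :+ B) :- :2 :* l :* l)) refl l B)
    where
    2l²≤ : 2# * l * l ≤ l * l + B
    2l²≤ = lim-≤ (always (λ n → ≤-trans (≤-by (0≤square (l - f n))
        (solve 2 (λ l x → l :* l :+ x :* x := :2 :* l :* x :+ (l :- x) :* (l :- x)) refl l (f n))) (+-monoʳ-≤ (l * l) (h n))))
      (lim-* (2# * l) p) (lim-const (l * l + B))

  -- A power series vanishing near 0 has vanishing coefficients: if all earlier ones
  -- vanish, the k-th is bounded by a multiple of y for every small y > 0.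
  module VanishingPowerSeries (σ : Carrier) (0<σ : 0# < σ) (σ<1 : σ < 1#) {u : ℕ → Carrier} {X : Carrier}
    (u≤X : ∀ k → ∣ u k ∣ ≤ X) (h : ∀ y → 0# < y → y < 1# → Series (λ k → u k * y ^ k) 0#) where
    private
      0≤σ = <⇒≤ 0<σ

    open Geometric σ 0≤σ σ<1

    private
      0≤X : 0# ≤ X
      0≤X = ≤-trans (0≤∣∣ (u 0)) (u≤X 0)

      module At (y : Carrier) (0<y : 0# < y) (y≤σ : y ≤ σ) (k : ℕ) (earlier : ∀ {j} → j ℕ.< k → u j ≈ 0#) where
        open ≤-Reasoning
        0≤y = <⇒≤ 0<y
        f : ℕ → Carrier
        f j = u j * y ^ j
        head : ∑ (suc k) f ≈ u k * y ^ k
        head = trans (+-congʳ (∑-0 k (λ j j<k → trans (*-congʳ (earlier j<k)) (zeroˡ _)))) (+-identityˡ _)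
        0≤Xy^ : 0# ≤ X * y ^ suc k
        0≤Xy^ = 0≤* 0≤X (0≤^ (suc k) 0≤y)
        term : ∀ j → ∣ f (suc k ℕ.+ j) ∣ ≤ (X * y ^ suc k) * σ ^ j
        term j = begin
          ∣ u (suc k ℕ.+ j) * y ^ (suc k ℕ.+ j) ∣  ≈⟨ trans (∣x*y∣ (u (suc k ℕ.+ j)) _) (*-congˡ (∣∣-nonneg (0≤^ (suc k ℕ.+ j) 0≤y))) ⟩
          ∣ u (suc k ℕ.+ j) ∣ * y ^ (suc k ℕ.+ j)      ≤⟨ *-monoʳ-≤ (0≤^ (suc k ℕ.+ j) 0≤y) (u≤X (suc k ℕ.+ j)) ⟩
          X * y ^ (suc k ℕ.+ j)  ≈⟨ trans (*-congˡ (^-homo-* y (suc k) j)) (sym (*-assoc X _ _)) ⟩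
          (X * y ^ suc k) * y ^ j  ≤⟨ *-monoˡ-≤ 0≤Xy^ (^-monoˡ-≤ j 0≤y y≤σ) ⟩
          (X * y ^ suc k) * σ ^ j  ∎
        tail-bound : ∀ i → ∣ ∑ (suc k ℕ.+ i) f - ∑ (suc k) f ∣ ≤ (X * y ^ suc k) * γ
        tail-bound i = begin
          ∣ ∑ (suc k ℕ.+ i) f - ∑ (suc k) f ∣  ≈⟨ ∣∣-cong (trans (+-congʳ (∑-split (suc k) i f)) (solve 2 (λ x y → (x :+ y) :- x := y) refl (∑ (suc k) f) _)) ⟩
          ∣ ∑ i (λ j → f (suc k ℕ.+ j)) ∣  ≤⟨ ∣∑∣≤ i _ ⟩
          ∑ i (λ j → ∣ f (suc k ℕ.+ j) ∣)  ≤⟨ ∑-mono i (λ j _ → term j) ⟩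
          ∑ i (λ j → (X * y ^ suc k) * σ ^ j)      ≈⟨ ∑-* i (X * y ^ suc k) _ ⟩
          (X * y ^ suc k) * ∑ i (σ ^_)  ≤⟨ *-monoˡ-≤ 0≤Xy^ (∑θ^≤γ i) ⟩
          (X * y ^ suc k) * γ  ∎
        limit-bound : ∣ 0# - ∑ (suc k) f ∣ ≤ (X * y ^ suc k) * γ
        limit-bound = lim-∣∣≤ (always tail-bound)
          (lim-- (lim-shift (suc k) (h y 0<y (≤-<-trans y≤σ σ<1))) (lim-const (∑ (suc k) f))) (lim-const ((X * y ^ suc k) * γ))
        leading : ∣ u k ∣ ≤ (X * γ) * y
        leading = *-cancelˡ-≤ (0<^ k 0<y) (begin
          y ^ k * ∣ u k ∣  ≈⟨ ∣c*x∣ (u k) (0≤^ k 0≤y) ⟨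
          ∣ y ^ k * u k ∣  ≈⟨ ∣-∣ (y ^ k * u k) ⟨
          ∣ - (y ^ k * u k) ∣  ≈⟨ ∣∣-cong (trans (sym (+-identityˡ _)) (+-congˡ (-‿cong (trans (*-comm _ _) (sym head))))) ⟩
          ∣ 0# - ∑ (suc k) f ∣  ≤⟨ limit-bound ⟩
          (X * (y * y ^ k)) * γ  ≈⟨ solve 4 (λ X g y p → (X :* (y :* p)) :* g := p :* ((X :* g) :* y)) refl X γ y (y ^ k) ⟩
          y ^ k * ((X * γ) * y)  ∎)

    vanishing-power-series : ∀ k → u k ≈ 0#
    vanishing-power-series = <-rec _ vanish
      where
      vanish : ∀ k → (∀ {j} → j ℕ.< k → u j ≈ 0#) → u k ≈ 0#
      vanish k earlier = ∣x∣≤0⇒x≈0 (lim-≤ (always bound) (lim-const ∣ u k ∣)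
          (lim-cong (always (λ _ → refl)) (zeroʳ (X * γ * σ)) (lim-* (X * γ * σ) θ^→0)))
        where
        bound : ∀ n → ∣ u k ∣ ≤ (X * γ * σ) * σ ^ n
        -- y = σⁿ⁺¹ tends to zero while staying at most σ, so one geometric ratio σ controls the
        -- tail for all these y.
        bound n = ≤-trans (At.leading (σ ^ suc n) (0<^ (suc n) 0<σ)
          (≤-resp refl (*-identityʳ σ) (*-monoˡ-≤ 0≤σ (^≤1 n 0≤σ (<⇒≤ σ<1)))) k earlier)
          (≤-reflexive (sym (*-assoc (X * γ) σ (σ ^ n))))

-- Exponentially decaying triangular matrices and their inverses

module DecayingMatrices {c ℓ₁ ℓ₂ : Level} (ℝ : RealField c ℓ₁ ℓ₂)
    (θ : RealField.Carrier ℝ) (0≤θ : RealField._≤_ ℝ (RealField.0# ℝ) θ) (θ<1 : RealField._<_ ℝ θ (RealField.1# ℝ)) where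
  open FiniteSums ℝ
  open Sequences ℝ
  open Limits ℝ ℕ-net
  open SeriesLemmas ℝ
  open Restriction ℝ
  open Geometric θ 0≤θ θ<1

  -- Decay in both indices makes such a matrix Hilbert-Schmidt, hence bounded on square-summable
  -- sequences; `upper` keeps the entries of matrix products finite sums.
  record Decaying : Set (c ⊔ ℓ₁ ⊔ ℓ₂) where
    field
      entry : ℕ → ℕ → Carrier
      K     : Carrier
      0≤K   : 0# ≤ K
      bound : ∀ k m → ∣ entry k m ∣ ≤ K * (θ ^ k * θ ^ m)
      upper : ∀ {k m} → m ℕ.≤ k → entry k m ≈ 0#
  open Decaying public

  -- (1 + A)(1 + B) = 1, the sum being finite since B is upper triangular.
  RightInverse : Decaying → Decaying → Set ℓ₁
  RightInverse A B = ∀ k {m n} → m ℕ.< n → ∑ n (λ j → entry A k j * entry B j m) ≈ - (entry A k m + entry B k m)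

  module Action (A : Decaying) {u : ℕ → Carrier} {X : Carrier} (u≤X : ∀ m → ∣ u m ∣ ≤ X) where

    0≤X : 0# ≤ X
    0≤X = ≤-trans (0≤∣∣ (u 0)) (u≤X 0)

    dominated : ∀ k m → ∣ entry A k m * u m ∣ ≤ (K A * X * θ ^ k) * θ ^ m
    dominated k m = ≤-trans (≤-reflexive (∣x*y∣ (entry A k m) (u m))) (≤-trans (*-mono-≤ (0≤∣∣ _) (bound A k m) (0≤∣∣ _) (u≤X m))
      (≤-reflexive (solve 4 (λ K p q X → K :* (p :* q) :* X := (K :* X :* p) :* q) refl (K A) (θ ^ k) (θ ^ m) X)))

    apply : ℕ → Carrier
    apply k = proj₁ (dominated-series (K A * X * θ ^ k) (dominated k))

    apply-series : ∀ k → Series (λ m → entry A k m * u m) (apply k)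
    apply-series k = proj₂ (dominated-series (K A * X * θ ^ k) (dominated k))

    apply-tail : ∀ k n → ∣ apply k - ∑ n (λ m → entry A k m * u m) ∣ ≤ (K A * X * θ ^ k * γ) * θ ^ n
    apply-tail k = dominated-bound (K A * X * θ ^ k) (dominated k) (apply-series k)

    apply-bound : ∀ k → ∣ apply k ∣ ≤ (K A * X * γ) * θ ^ k
    apply-bound k = ≤-resp (∣∣-cong (x-0≈x (apply k)))
      (solve 4 (λ K X p g → (K :* X :* p :* g) :* :1 := (K :* X :* g) :* p) refl (K A) X (θ ^ k) γ) (apply-tail k 0)

    -- Cauchy-Schwarz along row k. The bound is proportional to S, as a bound on an operator norm
    -- must be; `apply-bound` rests on a pointwise bound X, later taken as 1 + ‖f‖², which does not
    -- scale with the vector.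
    apply-square : ∀ {S} → (∀ n → ∑ n (λ m → u m * u m) ≤ S) → ∀ k → apply k * apply k ≤ (K A * K A * γ * S) * θ ^ k
    apply-square {S} h k = limit-square≤ partial (apply-series k)
      where
      open ≤-Reasoning
      entry² : ∀ m → entry A k m * entry A k m ≤ (K A * K A * θ ^ k) * θ ^ m
      entry² m = begin
        entry A k m * entry A k m  ≤⟨ square≤-from-∣∣ (bound A k m) ⟩
        (K A * (θ ^ k * θ ^ m)) * (K A * (θ ^ k * θ ^ m))  ≈⟨ solve 3 (λ K p q → (K :* (p :* q)) :* (K :* (p :* q)) := (K :* K :* p :* q) :* (p :* q)) refl (K A) (θ ^ k) (θ ^ m) ⟩
        (K A * K A * θ ^ k * θ ^ m) * (θ ^ k * θ ^ m)  ≤⟨ *-monoˡ-≤ (0≤* (0≤* (0≤* (0≤K A) (0≤K A)) (0≤^ k 0≤θ)) (0≤^ m 0≤θ))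
                                                                 (*-mono-≤ (0≤^ k 0≤θ) (^≤1 k 0≤θ (<⇒≤ θ<1)) (0≤^ m 0≤θ) (^≤1 m 0≤θ (<⇒≤ θ<1))) ⟩
        (K A * K A * θ ^ k * θ ^ m) * (1# * 1#)  ≈⟨ x*[1*1]≈x _ ⟩
        (K A * K A * θ ^ k) * θ ^ m  ∎
      row² : ∀ n → ∑ n (λ m → entry A k m * entry A k m) ≤ (K A * K A * θ ^ k) * γ
      row² n = ≤-trans (∑-mono n (λ m _ → entry² m)) (≤-trans (≤-reflexive (∑-* n _ _))
        (*-monoˡ-≤ (0≤* (0≤* (0≤K A) (0≤K A)) (0≤^ k 0≤θ)) (∑θ^≤γ n)))
      partial : ∀ n → ∑ n (λ m → entry A k m * u m) * ∑ n (λ m → entry A k m * u m) ≤ (K A * K A * γ * S) * θ ^ k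
      partial n = ≤-trans (cauchy-schwarz n (entry A k) u) (≤-trans
        (*-mono-≤ (∑-nonneg n (λ m → 0≤square _)) (row² n) (∑-nonneg n (λ m → 0≤square _)) (h n))
        (≤-reflexive (solve 4 (λ K p g S → ((K :* K :* p) :* g) :* S := (K :* K :* g :* S) :* p) refl (K A) (θ ^ k) γ S)))

  -- A (B u) is computed on the first n columns, with an error of order θⁿ.
  module Composition (A B : Decaying) (AB : RightInverse A B) {u : ℕ → Carrier} {X : Carrier} (u≤X : ∀ m → ∣ u m ∣ ≤ X) where
    private
      module Au = Action A u≤X
      module Bu = Action B u≤X

    apply-apply : ∀ k → Series (λ j → entry A k j * Bu.apply j) (- (Au.apply k + Bu.apply k))
    apply-apply k = lim-cong (always (λ n → solve 2 (λ x y → (x :- y) :+ y := x) refl _ (∑ n (λ j → entry A k j * ∑ n (λ m → entry B j m * u m)))))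
        (+-identityˡ _)
        (lim-+ (lim-squeeze (always error) (lim-cong (always (λ _ → refl)) (zeroʳ D) (lim-* D θ^→0)))
               (lim-cong (always finite) refl (lim-neg (lim-+ (Au.apply-series k) (Bu.apply-series k)))))
      where
      open ≤-Reasoning
      D = K A * (K B * X * γ) * γ
      0≤KXγ : 0# ≤ K B * X * γ
      0≤KXγ = 0≤* (0≤* (0≤K B) Bu.0≤X) (<⇒≤ 0<γ)
      finite : ∀ n → - (∑ n (λ m → entry A k m * u m) + ∑ n (λ m → entry B k m * u m)) ≈
                     ∑ n (λ j → entry A k j * ∑ n (λ m → entry B j m * u m))
      finite n = sym (begin-equality
        ∑ n (λ j → entry A k j * ∑ n (λ m → entry B j m * u m))
          ≈⟨ ∑-cong n (λ j → trans (sym (∑-* n (entry A k j) _)) (∑-cong n (λ m →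
               solve 3 (λ a b u → a :* (b :* u) := u :* (a :* b)) refl (entry A k j) (entry B j m) (u m)))) ⟩
        ∑ n (λ j → ∑ n (λ m → u m * (entry A k j * entry B j m)))
          ≈⟨ ∑-swap n n _ ⟩
        ∑ n (λ m → ∑ n (λ j → u m * (entry A k j * entry B j m)))
          ≈⟨ ∑-cong< n (λ m m<n → trans (∑-* n (u m) _) (trans (*-congˡ (AB k m<n))
               (solve 3 (λ a b u → u :* :- (a :+ b) := :- (a :* u :+ b :* u)) refl (entry A k m) (entry B k m) (u m)))) ⟩
        ∑ n (λ m → - (entry A k m * u m + entry B k m * u m))
          ≈⟨ trans (∑-neg n _) (-‿cong (∑-+ n _ _)) ⟩
        - (∑ n (λ m → entry A k m * u m) + ∑ n (λ m → entry B k m * u m)) ∎)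
      error-term : ∀ n j → ∣ entry A k j * (Bu.apply j - ∑ n (λ m → entry B j m * u m)) ∣ ≤ (K A * (K B * X * γ) * θ ^ n) * θ ^ j
      error-term n j = begin
        ∣ entry A k j * (Bu.apply j - ∑ n (λ m → entry B j m * u m)) ∣
          ≈⟨ ∣x*y∣ (entry A k j) _ ⟩
        ∣ entry A k j ∣ * ∣ Bu.apply j - ∑ n (λ m → entry B j m * u m) ∣
          ≤⟨ *-mono-≤ (0≤∣∣ _) (bound A k j) (0≤∣∣ _) (Bu.apply-tail j n) ⟩
        (K A * (θ ^ k * θ ^ j)) * ((K B * X * θ ^ j * γ) * θ ^ n)
          ≈⟨ solve 7 (λ a p q b X g r → (a :* (p :* q)) :* ((b :* X :* q :* g) :* r) := (a :* (b :* X :* g) :* r :* q) :* (p :* q))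
               refl (K A) (θ ^ k) (θ ^ j) (K B) X γ (θ ^ n) ⟩
        (K A * (K B * X * γ) * θ ^ n * θ ^ j) * (θ ^ k * θ ^ j)
          ≤⟨ *-monoˡ-≤ (0≤* (0≤* (0≤* (0≤K A) 0≤KXγ) (0≤^ n 0≤θ)) (0≤^ j 0≤θ))
               (*-mono-≤ (0≤^ k 0≤θ) (^≤1 k 0≤θ (<⇒≤ θ<1)) (0≤^ j 0≤θ) (^≤1 j 0≤θ (<⇒≤ θ<1))) ⟩
        (K A * (K B * X * γ) * θ ^ n * θ ^ j) * (1# * 1#)
          ≈⟨ x*[1*1]≈x _ ⟩
        (K A * (K B * X * γ) * θ ^ n) * θ ^ j ∎
      error : ∀ n → ∣ (∑ n (λ j → entry A k j * Bu.apply j) - ∑ n (λ j → entry A k j * ∑ n (λ m → entry B j m * u m))) - 0# ∣ ≤ D * θ ^ n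
      error n = begin
        ∣ (∑ n (λ j → entry A k j * Bu.apply j) - ∑ n (λ j → entry A k j * ∑ n (λ m → entry B j m * u m))) - 0# ∣
          ≈⟨ ∣∣-cong (trans (x-0≈x _) (trans (sym (∑-- n _ _)) (∑-cong n (λ j →
               solve 3 (λ a x y → a :* x :- a :* y := a :* (x :- y)) refl (entry A k j) (Bu.apply j) _)))) ⟩
        ∣ ∑ n (λ j → entry A k j * (Bu.apply j - ∑ n (λ m → entry B j m * u m))) ∣
          ≤⟨ ≤-trans (∣∑∣≤ n _) (∑-mono n (λ j _ → error-term n j)) ⟩
        ∑ n (λ j → (K A * (K B * X * γ) * θ ^ n) * θ ^ j)
          ≈⟨ ∑-* n _ _ ⟩
        (K A * (K B * X * γ) * θ ^ n) * ∑ n (θ ^_)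
          ≤⟨ *-monoˡ-≤ (0≤* (0≤* (0≤K A) 0≤KXγ) (0≤^ n 0≤θ)) (∑θ^≤γ n) ⟩
        (K A * (K B * X * γ) * θ ^ n) * γ
          ≈⟨ solve 4 (λ a b t g → (a :* b :* t) :* g := (a :* b :* g) :* t) refl (K A) (K B * X * γ) (θ ^ n) γ ⟩
        D * θ ^ n ∎

  module LeftInverse (A : Decaying) where
    open DiscreteGronwall ℝ θ 0≤θ θ<1 (K A) (0≤K A) using (P; 0≤P; module Upward)

    -- The first n entries of row k of the inverse minus 1; entry n is found from the earlier ones.
    table : ℕ → ℕ → ℕ → Carrier
    table k zero    j = 0#
    table k (suc n) j with j ℕ.≟ n
    ... | yes _ = - (entry A k n + ∑ n (λ i → table k n i * entry A i n))
    ... | no  _ = table k n j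

    row : ℕ → ℕ → Carrier
    row k m = - (entry A k m + ∑ m (λ i → table k m i * entry A i m))

    table≈row : ∀ k {n j} → j ℕ.< n → table k n j ≈ row k j
    table≈row k {suc n} {j} j≤n with j ℕ.≟ n
    ... | yes ≡.refl = refl
    ... | no  j≢n    = table≈row k (ℕ.≤∧≢⇒< (ℕ.≤-pred j≤n) j≢n)

    -- Entry (k, m) of (1 + B)(1 + A) = 1, solved for the entry of B.
    row-equation : ∀ k m → row k m ≈ - (entry A k m + ∑ m (λ j → row k j * entry A j m))
    row-equation k m = -‿cong (+-congˡ (∑-cong< m (λ j j<m → *-congʳ (table≈row k j<m))))

    row-upper : ∀ {k m} → m ℕ.≤ k → row k m ≈ 0#
    row-upper {k} = <-rec (λ m → m ℕ.≤ k → row k m ≈ 0#) (λ m earlier m≤k → trans (row-equation k m)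
      (trans (-‿cong (trans (+-cong (upper A m≤k) (∑-0 m (λ j j<m →
          trans (*-congʳ (earlier j<m (ℕ.≤-trans (ℕ.<⇒≤ j<m) m≤k))) (zeroˡ _)))) (+-identityˡ 0#)))
        (solve 0 (:- :0 := :0) refl))) _

    private
      module RowBound (k : ℕ) where
        -- Adding row k of the identity supplies the starting value 1 at m = k and absorbs the
        -- inhomogeneous term `entry A k m` as the summand j = k, so that the recursion becomes the
        -- homogeneous one of `Upward`.
        δₖ : ℕ → Carrier
        δₖ m = restrict (m ℕ.≟ k) 1#

        0≤δ : ∀ m → 0# ≤ δₖ m
        0≤δ m with m ℕ.≟ k
        ... | yes _ = 0≤1
        ... | no  _ = ≤-refl

        v : ℕ → Carrier
        v m = ∣ row k m ∣ + δₖ m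

        0≤v : ∀ m → 0# ≤ v m
        0≤v m = 0≤+ (0≤∣∣ _) (0≤δ m)

        row-0 : ∀ {m} → m ℕ.≤ k → ∣ row k m ∣ ≈ 0#
        row-0 m≤k = trans (∣∣-cong (row-upper m≤k)) (∣∣-nonneg ≤-refl)

        step : ∀ m → k ℕ.< m → v m ≤ K A * θ ^ m * ∑ m (λ j → θ ^ j * v j)
        step m k<m = begin
          ∣ row k m ∣ + δₖ m
            ≈⟨ trans (+-congˡ (restrict-no (m ℕ.≟ k) (λ m≡k → ℕ.<-irrefl (≡.sym m≡k) k<m))) (+-identityʳ _) ⟩
          ∣ row k m ∣
            ≈⟨ trans (∣∣-cong (row-equation k m)) (∣-∣ _) ⟩
          ∣ entry A k m + ∑ m (λ j → row k j * entry A j m) ∣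
            ≤⟨ ≤-trans (∣x+y∣≤ _ _) (+-mono-≤ (bound A k m) (≤-trans (∣∑∣≤ m _) (∑-mono m (λ j _ → term j)))) ⟩
          K A * (θ ^ k * θ ^ m) + ∑ m (λ j → (K A * θ ^ m) * (θ ^ j * ∣ row k j ∣))
            ≈⟨ +-cong (solve 3 (λ K p q → K :* (p :* q) := (K :* q) :* p) refl (K A) (θ ^ k) (θ ^ m)) (∑-* m _ _) ⟩
          (K A * θ ^ m) * θ ^ k + (K A * θ ^ m) * ∑ m (λ j → θ ^ j * ∣ row k j ∣)
            ≤⟨ +-monoˡ-≤ _ (*-monoˡ-≤ 0≤Kθ^m δ-term) ⟩
          (K A * θ ^ m) * ∑ m (λ j → θ ^ j * δₖ j) + (K A * θ ^ m) * ∑ m (λ j → θ ^ j * ∣ row k j ∣)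
            ≈⟨ trans (sym (distribˡ _ _ _)) (*-congˡ (trans (+-comm _ _) (trans (sym (∑-+ m _ _)) (∑-cong m (λ j → sym (distribˡ (θ ^ j) _ _)))))) ⟩
          K A * θ ^ m * ∑ m (λ j → θ ^ j * v j) ∎
          where
          open ≤-Reasoning
          0≤Kθ^m : 0# ≤ K A * θ ^ m
          0≤Kθ^m = 0≤* (0≤K A) (0≤^ m 0≤θ)
          term : ∀ j → ∣ row k j * entry A j m ∣ ≤ (K A * θ ^ m) * (θ ^ j * ∣ row k j ∣)
          term j = ≤-trans (≤-reflexive (∣x*y∣ (row k j) _)) (≤-trans (*-monoˡ-≤ (0≤∣∣ _) (bound A j m))
            (≤-reflexive (solve 4 (λ r K p q → r :* (K :* (p :* q)) := (K :* q) :* (p :* r)) refl (∣ row k j ∣) (K A) (θ ^ j) (θ ^ m))))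
          δ-term : θ ^ k ≤ ∑ m (λ j → θ ^ j * δₖ j)
          δ-term = ≤-trans (≤-reflexive (trans (sym (*-identityʳ _)) (*-congˡ (sym (restrict-yes (k ℕ.≟ k) ≡.refl)))))
            (∑-term≤ {f = λ j → θ ^ j * δₖ j} (λ j → 0≤* (0≤^ j 0≤θ) (0≤δ j)) k<m)

        open Upward k v 0≤v
          (λ m m<k → trans (+-cong (row-0 (ℕ.<⇒≤ m<k)) (restrict-no (m ℕ.≟ k) (λ m≡k → ℕ.<-irrefl m≡k m<k))) (+-identityˡ 0#))
          (≤-reflexive (trans (+-cong (row-0 ℕ.≤-refl) (restrict-yes (k ℕ.≟ k) ≡.refl)) (+-identityˡ 1#)))
          step public using (upward)

    inverse-matrix : Decaying
    inverse-matrix = record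
      { entry = row
      ; K     = K A * P
      ; 0≤K   = 0≤* (0≤K A) 0≤P
      ; bound = row-bound
      ; upper = row-upper
      }
      where
      row-bound : ∀ k m → ∣ row k m ∣ ≤ K A * P * (θ ^ k * θ ^ m)
      row-bound k m =
        [ (λ m≤k → ≤-trans (≤-reflexive (trans (∣∣-cong (row-upper m≤k)) (∣∣-nonneg ≤-refl)))
                     (0≤* (0≤* (0≤K A) 0≤P) (0≤* (0≤^ k 0≤θ) (0≤^ m 0≤θ))))
        , (λ k<m → ≤-trans (≤-by (RowBound.0≤δ k m) refl) (RowBound.upward k m k<m))
        ]′ (ℕ.≤-<-connex m k)

    inverse-left : RightInverse inverse-matrix A
    inverse-left k {m} {n} m<n = trans (reflexive (≡.cong (λ n → ∑ n f) (≡.sym (ℕ.m+[n∸m]≡n (ℕ.<⇒≤ m<n)))))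
      (trans (∑-split m (n ℕ.∸ m) f) (trans (+-congˡ (∑-0 (n ℕ.∸ m) (λ i _ → trans (*-congˡ (upper A (ℕ.m≤m+n m i))) (zeroʳ _))))
        (trans (solve 2 (λ s a → s :+ :0 := :- (:- (a :+ s) :+ a)) refl (∑ m f) (entry A k m))
          (-‿cong (+-congʳ (sym (row-equation k m)))))))
      where
      f : ℕ → Carrier
      f j = row k j * entry A j m

  open LeftInverse using (inverse-matrix; inverse-left) public

  -- The left inverse of the left inverse of A is A, by associativity.
  inverse-right : ∀ A → RightInverse A (inverse-matrix A)
  inverse-right A k {m} {n} m<n = trans (∑-cong n (λ j → *-congʳ (sym (A₂≈A j)))) (trans (inverse-left B k m<n) (-‿cong (+-congʳ (A₂≈A m))))
    where
    B = inverse-matrix A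
    A₂ = inverse-matrix B
    a b a₂ : ℕ → ℕ → Carrier
    a  = entry A
    b  = entry B
    a₂ = entry A₂
    A₂≈A : ∀ m → a₂ k m ≈ a k m
    A₂≈A m = begin-equality
      a₂ k m
        ≈⟨ solve 3 (λ x y z → x := ((x :+ y) :- z) :+ (z :- y)) refl (a₂ k m) (b k m) X ⟩
      ((a₂ k m + b k m) - X) + (X - b k m)
        ≈⟨ +-congʳ (trans (sym one) two) ⟩
      ((b k m + a k m) - X) + (X - b k m)
        ≈⟨ solve 3 (λ x y z → ((y :+ x) :- z) :+ (z :- y) := x) refl (a k m) (b k m) X ⟩
      a k m ∎
      where
      open ≤-Reasoning
      N = suc m
      X = ∑ N (λ i → a₂ k i * a i m)
      -- Entry (k, m) of the product A₂ B A, bracketed to the right in `one` and to the left in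
      -- `two`. Length m + 1 is enough by triangularity.
      S = ∑ N (λ i → ∑ N (λ j → a₂ k i * b i j * a j m))
      one : S ≈ (a₂ k m + b k m) - X
      one = trans (∑-cong N (λ i → trans (∑-cong N (λ j → *-assoc _ _ _)) (trans (∑-* N (a₂ k i) _)
              (trans (*-congˡ (inverse-left A i ℕ.≤-refl))
                (solve 3 (λ x y z → x :* :- (y :+ z) := :- (x :* y) :- x :* z) refl (a₂ k i) (b i m) (a i m))))))
            (trans (∑-- N _ _) (+-congʳ (trans (∑-neg N _) (trans (-‿cong (inverse-left B k ℕ.≤-refl))
              (solve 1 (λ x → :- (:- x) := x) refl (a₂ k m + b k m))))))
      two : S ≈ (b k m + a k m) - X
      two = trans (∑-swap N N _) (trans (∑-cong< N (λ j j<N → trans (∑-cong N (λ i → *-comm _ _)) (trans (∑-* N (a j m) _)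
              (trans (*-congˡ (inverse-left B k j<N))
                (solve 3 (λ x y z → z :* :- (x :+ y) := :- (y :* z) :- x :* z) refl (a₂ k j) (b k j) (a j m))))))
            (trans (∑-- N _ _) (+-congʳ (trans (∑-neg N _) (trans (-‿cong (inverse-left A k ℕ.≤-refl))
              (solve 1 (λ x → :- (:- x) := x) refl (b k m + a k m)))))))

-- Complex series, handled through real and imaginary parts

module ComplexSeries {c ℓ₁ ℓ₂ : Level} (ℝ : RealField c ℓ₁ ℓ₂) where
  open ComplexNumbers ℝ
  open Sequences ℝ
  open Limits ℝ ℕ-net
  open SeriesLemmas ℝ
  open Parts ℝ
  open Part

  record Seriesᶜ (f : ℕ → ℂ) (s : ℂ) : Set (lsuc 0ℓ ⊔ c ⊔ ℓ₁ ⊔ ℓ₂) where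
    constructor parts
    field part-series : ∀ p → Series (π p ∘ f) (π p s)
  open Seriesᶜ public

  from-re-im : ∀ {f : ℕ → ℂ} {s} → Series (re ∘ f) (re s) → Series (im ∘ f) (im s) → ∀ ε → 0# < ε →
               Eventually (λ n → ∣ ∑ᶜ n f -ᶜ s ∣² < ε * ε)
  from-re-im {f} {s} p q ε 0<ε = ev-zip
    (λ n a b → near-from-parts 0<ε (≤-resp (∣∣-cong (+-congʳ (reflexive (≡.sym (re-∑ n f))))) refl a)
                                   (≤-resp (∣∣-cong (+-congʳ (reflexive (≡.sym (im-∑ n f))))) refl b))
    (near p (½ * ε) (0<½* 0<ε)) (near q (½ * ε) (0<½* 0<ε))

  HasSeriesSum⇒Series : ∀ {f s} → ℝΣ.HasSeriesSum f s → Series f s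
  HasSeriesSum⇒Series {f} h = lim λ ε 0<ε → map₂ (λ p n N≤n →
    <⇒≤ (<-resp (∣∣-cong (+-congʳ (Σ-upTo n f))) refl (p n N≤n))) (h ε 0<ε)

  Series⇒HasSeriesSum : ∀ {f s} → Series f s → ℝΣ.HasSeriesSum f s
  Series⇒HasSeriesSum {f} h ε 0<ε = map₂ (λ p n N≤n →
    ≤-<-trans (≤-resp (∣∣-cong (+-congʳ (sym (Σ-upTo n f)))) refl (p n N≤n)) (½*< 0<ε)) (near h (½ * ε) (0<½* 0<ε))

  HasSeriesSum⇒Seriesᶜ : ∀ {f s} → ℂΣ.HasSeriesSum f s → Seriesᶜ f s
  HasSeriesSum⇒Seriesᶜ {f} {s} h = parts λ p → lim λ ε 0<ε → map₂ (λ near′ n N≤n →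
    ≤-resp (∣∣-cong (trans (reflexive (π-- p _ s)) (+-congʳ (trans (π-cong p (Σ-upToᶜ n f)) (reflexive (π-∑ p n f)))))) refl
      (∣π∣≤ p (<⇒≤ 0<ε) (<⇒≤ (near′ n N≤n)))) (h ε 0<ε)

  Seriesᶜ⇒HasSeriesSum : ∀ {f s} → Seriesᶜ f s → ℂΣ.HasSeriesSum f s
  Seriesᶜ⇒HasSeriesSum {f} {s} h ε 0<ε = map₂ (λ near′ n N≤n →
    <-resp (∣∣²-cong (ℂR.+-congʳ (ℂR.sym (Σ-upToᶜ n f)))) refl (near′ n N≤n))
    (from-re-im {f} {s} (part-series h re-part) (part-series h im-part) ε 0<ε)

  seriesᶜ-parts : ∀ {f s} → Series (re ∘ f) (re s) → Series (im ∘ f) (im s) → Seriesᶜ f s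
  seriesᶜ-parts p q = HasSeriesSum⇒Seriesᶜ λ ε 0<ε → map₂ (λ {N} near′ n N≤n →
    <-resp (∣∣²-cong (ℂR.+-congʳ (ℂR.sym (Σ-upToᶜ n _)))) refl (near′ n N≤n)) (from-re-im p q ε 0<ε)

  seriesᶜ-unique : ∀ {f s u} → Seriesᶜ f s → Seriesᶜ f u → s ≈ᶜ u
  seriesᶜ-unique p q = lim-unique (part-series p re-part) (part-series q re-part)
                     , lim-unique (part-series p im-part) (part-series q im-part)

  seriesᶜ-cong : ∀ {f g s u} → (∀ k → f k ≈ᶜ g k) → s ≈ᶜ u → Seriesᶜ f s → Seriesᶜ g u
  seriesᶜ-cong h e (parts q) = parts λ p → series-cong (λ k → π-cong p (h k)) (π-cong p e) (q p)

  seriesᶜ-+ : ∀ {f g s u} → Seriesᶜ f s → Seriesᶜ g u → Seriesᶜ (λ k → f k +ᶜ g k) (s +ᶜ u)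
  seriesᶜ-+ {f} {g} {s} {u} (parts q) (parts r) = parts λ p →
    series-cong (λ k → reflexive (≡.sym (π-+ p (f k) (g k)))) (reflexive (≡.sym (π-+ p s u))) (series-+ (q p) (r p))

  seriesᶜ-- : ∀ {f g s u} → Seriesᶜ f s → Seriesᶜ g u → Seriesᶜ (λ k → f k -ᶜ g k) (s -ᶜ u)
  seriesᶜ-- {f} {g} {s} {u} (parts q) (parts r) = parts λ p →
    series-cong (λ k → reflexive (≡.sym (π-- p (f k) (g k)))) (reflexive (≡.sym (π-- p s u))) (series-- (q p) (r p))

  seriesᶜ-* : ∀ {f s} t → Seriesᶜ f s → Seriesᶜ (λ k → t *ᶜ f k) (t *ᶜ s)
  seriesᶜ-* t (parts q) = seriesᶜ-parts
    (series-- (series-* (re t) (q re-part)) (series-* (im t) (q im-part)))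
    (series-+ (series-* (re t) (q im-part)) (series-* (im t) (q re-part)))

  seriesᶜ-finite : ∀ {f} n → (∀ k → n ℕ.≤ k → f k ≈ᶜ 0ℂ) → Seriesᶜ f (∑ᶜ n f)
  seriesᶜ-finite {f} n h = seriesᶜ-parts
    (series-cong (λ _ → refl) (reflexive (≡.sym (re-∑ n f))) (series-finite n (λ k n≤k → proj₁ (h k n≤k))))
    (series-cong (λ _ → refl) (reflexive (≡.sym (im-∑ n f))) (series-finite n (λ k n≤k → proj₂ (h k n≤k))))

  seriesᶜ-tail : ∀ {f g s} n → Seriesᶜ f s → (∀ k → k ℕ.< n → g k ≈ᶜ 0ℂ) → (∀ k → n ℕ.≤ k → g k ≈ᶜ f k) →
                 Seriesᶜ g (s -ᶜ ∑ᶜ n f)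
  seriesᶜ-tail {f} n (parts q) below above = seriesᶜ-parts
    (series-cong (λ _ → refl) (+-congˡ (-‿cong (reflexive (≡.sym (re-∑ n f)))))
      (series-tail n (q re-part) (λ k k<n → proj₁ (below k k<n)) (λ k n≤k → proj₁ (above k n≤k))))
    (series-cong (λ _ → refl) (+-congˡ (-‿cong (reflexive (≡.sym (im-∑ n f)))))
      (series-tail n (q im-part) (λ k k<n → proj₂ (below k k<n)) (λ k n≤k → proj₂ (above k n≤k))))

  -- A number is at most 1 plus its square, which bounds the modulus without a root.
  ∣π∣≤1+∣∣² : ∀ p z → ∣ π p z ∣ ≤ 1# + ∣ z ∣²
  ∣π∣≤1+∣∣² p z = ∣π∣≤ p (0≤+ 0≤1 (0≤∣∣² z)) (≤-by (0≤+ 0≤1 (0≤+ (0≤∣∣² z) (0≤square ∣ z ∣²)))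
    (solve 1 (λ s → (:1 :+ s) :* (:1 :+ s) := s :+ (:1 :+ (s :+ s :* s))) refl ∣ z ∣²))

  -- A modulus exceeds a common bound on both parts by a factor of at most √2; two moduli account
  -- for the 2.
  ∣π[z*u]∣≤ : ∀ p {z u a b} → (∀ q → ∣ π q z ∣ ≤ a) → (∀ q → ∣ π q u ∣ ≤ b) → ∣ π p (z *ᶜ u) ∣ ≤ 2# * (a * b)
  ∣π[z*u]∣≤ p {z} {u} {a} {b} z≤ u≤ = ∣π∣≤ p (0≤* (<⇒≤ 0<2) (0≤* 0≤a 0≤b)) (≤-trans (≤-reflexive (∣∣²-* z u))
    (≤-trans (*-mono-≤ (0≤∣∣² z) (+-mono-≤ (square≤-from-∣∣ (z≤ re-part)) (square≤-from-∣∣ (z≤ im-part)))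
                       (0≤∣∣² u) (+-mono-≤ (square≤-from-∣∣ (u≤ re-part)) (square≤-from-∣∣ (u≤ im-part))))
      (≤-reflexive (solve 2 (λ a b → (a :* a :+ a :* a) :* (b :* b :+ b :* b) := (:2 :* (a :* b)) :* (:2 :* (a :* b))) refl a b))))
    where
    0≤a = ≤-trans (0≤∣∣ _) (z≤ re-part)
    0≤b = ≤-trans (0≤∣∣ _) (u≤ re-part)

-- The Hardy space and its orthonormal basis of monomials

module HardySpace {c ℓ₁ ℓ₂ : Level} (ℝ : RealField c ℓ₁ ℓ₂)
  (a R : RealField.Carrier ℝ) (0<R : RealField._<_ ℝ (RealField.0# ℝ) R) where

  open ComplexNumbers ℝ
  open Sequences ℝ
  open Limits ℝ ℕ-net
  open SeriesLemmas ℝ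
  open ComplexSeries ℝ
  open Parts ℝ
  open Part
  open Hardy ℝ a R 0<R

  private
    R⁻¹ = inverse 0<R

  ∣e∣≤1 : ∀ p m z → ∣ π p (e m z) ∣ ≤ 1#
  ∣e∣≤1 p m (z , z∈D) = ∣π∣≤ p 0≤1 (begin
    ∣ R⁻^ m *ᶜ (z -ᶜ ofℝ a) ^ᶜ m ∣²  ≈⟨ trans (∣∣²-* (R⁻^ m) _) (*-congˡ (∣∣²-^ (z -ᶜ ofℝ a) m)) ⟩
    ∣ R⁻^ m ∣² * ∣ z -ᶜ ofℝ a ∣² ^ m  ≤⟨ *-monoˡ-≤ (0≤∣∣² (R⁻^ m)) (^-monoˡ-≤ m (0≤∣∣² (z -ᶜ ofℝ a)) (<⇒≤ z∈D)) ⟩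
    ∣ R⁻^ m ∣² * (R * R) ^ m  ≈⟨ *-congˡ (^-distrib-* R R m) ⟩
    ∣ R⁻^ m ∣² * (R ^ m * R ^ m)  ≈⟨ solve 2 (λ i r → (i :* i :+ :0 :* :0) :* (r :* r) := (i :* r) :* (i :* r)) refl (R⁻¹ ^ m) (R ^ m) ⟩
    (R⁻¹ ^ m * R ^ m) * (R⁻¹ ^ m * R ^ m)  ≈⟨ *-cong (inverse^-correct 0<R m) (inverse^-correct 0<R m) ⟩
    1# * 1#  ∎)
    where open ≤-Reasoning

  private
    real-point : ∀ y → 0# < y → y < 1# → Disk
    real-point y 0<y y<1 = ofℝ (a + R * y) , <-resp
      (solve 3 (λ a r y → (r :* r) :* (y :* y) := (a :+ r :* y :- a) :* (a :+ r :* y :- a) :+ (:0 :- :0) :* (:0 :- :0)) refl a R y)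
      (*-identityʳ (R * R)) (*-monoˡ-< (*-pos 0<R 0<R) (≤-<-trans (≤-resp refl (*-identityʳ y) (*-monoˡ-≤ (<⇒≤ 0<y) (<⇒≤ y<1))) y<1))

    e-real : ∀ k y 0<y y<1 → e k (real-point y 0<y y<1) ≈ᶜ ofℝ (y ^ k)
    e-real k y 0<y y<1 = ℂR.trans (ℂR.*-congˡ (ℂR.trans (^ᶜ-cong k
        (solve 3 (λ a r y → (a :+ r :* y) :- a := r :* y) refl a R y , -‿inverseʳ 0#)) (ℂR.sym (ofℝ-^ (R * y) k))))
      (ℂR.trans (ℂR.sym (ofℝ-* (R⁻¹ ^ k) _)) (ofℝ-cong (trans (sym (^-distrib-* R⁻¹ (R * y) k))
        (^-congˡ k (trans (sym (*-assoc R⁻¹ R y)) (trans (*-congʳ (inverse-correct 0<R)) (*-identityˡ y)))))))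

  -- At the real points a + R y with 0 < y < 1 the function e_k takes the value yᵏ, so the
  -- uniqueness of real power series applies to each part.
  vanishing-coefficients : ∀ {d : ℕ → ℂ} {X} → (∀ p k → ∣ π p (d k) ∣ ≤ X) →
                           (∀ z → Seriesᶜ (λ k → d k *ᶜ e k z) 0ℂ) → ∀ k → d k ≈ᶜ 0ℂ
  vanishing-coefficients {d} {X} d≤X h k = vanish re-part refl , vanish im-part refl
    where
    vanish : ∀ p → π p 0ℂ ≈ 0# → π p (d k) ≈ 0#
    vanish p π0 = VanishingPowerSeries.vanishing-power-series ½ 0<½ ½<1 {u = λ k → π p (d k)} (d≤X p)
      (λ y 0<y y<1 → series-cong
        (λ j → trans (π-cong p (ℂR.*-congˡ (e-real j y 0<y y<1))) (trans (π-*ofℝ p (d j) (y ^ j)) (*-comm _ _)))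
        π0 (part-series (h (real-point y 0<y y<1)) p)) k

  0≤‖‖² : ∀ f → 0# ≤ ‖ f ‖²
  0≤‖‖² f = partial≤series (λ k → 0≤∣∣² (coeff f k)) (HasSeriesSum⇒Series (summable f)) 0

  partial≤‖‖² : ∀ f n → ∑ n (λ k → ∣ coeff f k ∣²) ≤ ‖ f ‖²
  partial≤‖‖² f = partial≤series (λ k → 0≤∣∣² (coeff f k)) (HasSeriesSum⇒Series (summable f))

  coeff-bound : ∀ f p k → ∣ π p (coeff f k) ∣ ≤ 1# + ‖ f ‖²
  coeff-bound f p k = ≤-trans (∣π∣≤1+∣∣² p (coeff f k)) (+-monoʳ-≤ 1#
    (≤-trans (∑-term≤ {f = λ k → ∣ coeff f k ∣²} (λ k → 0≤∣∣² (coeff f k)) (ℕ.n<1+n k)) (partial≤‖‖² f (suc k))))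

  expansionᶜ : ∀ f z → Seriesᶜ (λ m → coeff f m *ᶜ e m z) (fun f z)
  expansionᶜ f z = HasSeriesSum⇒Seriesᶜ (expansion f z)

  fun-determined : ∀ {f φ} → (∀ z → Seriesᶜ (λ m → coeff f m *ᶜ e m z) (φ z)) → fun f ≗ φ
  fun-determined {f} h z = seriesᶜ-unique (expansionᶜ f z) (h z)

  linear-combination : ∀ t f g z → Seriesᶜ (λ k → (t *ᶜ coeff f k +ᶜ coeff g k) *ᶜ e k z) (t *ᶜ fun f z +ᶜ fun g z)
  linear-combination t f g z = seriesᶜ-cong
    (λ k → ℂR.trans (ℂR.+-congʳ (ℂR.sym (ℂR.*-assoc t _ _))) (ℂR.sym (ℂR.distribʳ (e k z) _ _))) ℂR.refl
    (seriesᶜ-+ (seriesᶜ-* t (expansionᶜ f z)) (expansionᶜ g z))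

  -- `BoundedOperator` states linearity for functions whereas the operators act on coefficients;
  -- uniqueness of the expansion carries the hypothesis from the former to the latter.
  coeff-linear : ∀ t f g h → fun h ≗ (λ z → t *ᶜ fun f z +ᶜ fun g z) → ∀ k → coeff h k ≈ᶜ t *ᶜ coeff f k +ᶜ coeff g k
  coeff-linear t f g h eq k = ℂR.trans (ℂS.solve 2 (λ x y → x ℂS.:= (x ℂS.:- y) ℂS.:+ y) ℂR.refl (coeff h k) (t *ᶜ coeff f k +ᶜ coeff g k))
    (ℂR.trans (ℂR.+-congʳ (vanishing-coefficients d-bound d-series k)) (ℂR.+-identityˡ _))
    where
    d : ℕ → ℂ
    d k = coeff h k -ᶜ (t *ᶜ coeff f k +ᶜ coeff g k)
    T = 1# + ∣ t ∣²
    X = (1# + ‖ h ‖²) + (2# * (T * (1# + ‖ f ‖²)) + (1# + ‖ g ‖²))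
    d-bound : ∀ p k → ∣ π p (d k) ∣ ≤ X
    d-bound p k = ≤-trans (≤-reflexive (∣∣-cong (reflexive (π-- p _ _)))) (≤-trans (∣x-y∣≤ _ _) (+-mono-≤ (coeff-bound h p k)
      (≤-trans (≤-reflexive (∣∣-cong (reflexive (π-+ p _ _)))) (≤-trans (∣x+y∣≤ _ _)
        (+-mono-≤ (∣π[z*u]∣≤ p {t} {coeff f k} (λ q → ∣π∣≤1+∣∣² q t) (λ q → coeff-bound f q k)) (coeff-bound g p k))))))
    d-series : ∀ z → Seriesᶜ (λ k → d k *ᶜ e k z) 0ℂ
    d-series z = seriesᶜ-cong
      (λ k → ℂS.solve 3 (λ x y e → x ℂS.:* e ℂS.:- y ℂS.:* e ℂS.:= (x ℂS.:- y) ℂS.:* e) ℂR.refl (coeff h k) (t *ᶜ coeff f k +ᶜ coeff g k) (e k z))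
      (ℂR.trans (ℂR.+-congʳ (eq z)) (ℂR.-‿inverseʳ _))
      (seriesᶜ-- (expansionᶜ h z) (linear-combination t f g z))

  δ-same : ∀ m → δ m m ≡ 1ℂ
  δ-same m with m ℕ.≟ m
  ... | yes _  = ≡.refl
  ... | no m≢m = ⊥-elim (m≢m ≡.refl)

  δ-distinct : ∀ {m n} → m ≢ n → δ m n ≡ 0ℂ
  δ-distinct {m} {n} m≢n with m ℕ.≟ n
  ... | yes m≡n = ⊥-elim (m≢n m≡n)
  ... | no _    = ≡.refl

  single : ∀ m (f : ℕ → ℂ) → (∀ k → k ≢ m → f k ≈ᶜ 0ℂ) → Seriesᶜ f (f m)
  single m f h = seriesᶜ-cong (λ _ → ℂR.refl)
    (ℂR.trans (ℂR.+-congʳ (∑ᶜ-0 m (λ k k<m → h k (λ k≡m → ℕ.<-irrefl k≡m k<m)))) (ℂR.+-identityˡ (f m)))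
    (seriesᶜ-finite (suc m) (λ k m<k → h k (λ k≡m → ℕ.<-irrefl (≡.sym k≡m) m<k)))

  δ-expansion : ∀ m z → Seriesᶜ (λ k → δ m k *ᶜ e k z) (e m z)
  δ-expansion m z = seriesᶜ-cong (λ _ → ℂR.refl) (ℂR.trans (ℂR.*-congʳ (ℂR.reflexive (δ-same m))) (ℂR.*-identityˡ _))
    (single m _ (λ k k≢m → ℂR.trans (ℂR.*-congʳ (ℂR.reflexive (δ-distinct (k≢m ∘ ≡.sym)))) (ℂR.zeroˡ _)))

  polynomial : ∀ n (c : ℕ → ℂ) → (∀ k → n ℕ.≤ k → c k ≈ᶜ 0ℂ) → (φ : Fun) → (∀ z → ∑ᶜ n (λ k → c k *ᶜ e k z) ≈ᶜ φ z) → H²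
  polynomial n c c≈0 φ h = record
    { fun       = φ
    ; coeff     = c
    ; expansion = λ z → Seriesᶜ⇒HasSeriesSum (seriesᶜ-cong (λ _ → ℂR.refl) (h z)
                    (seriesᶜ-finite n (λ k n≤k → ℂR.trans (ℂR.*-congʳ (c≈0 k n≤k)) (ℂR.zeroˡ _))))
    ; ‖_‖²      = ∑ n (λ k → ∣ c k ∣²)
    ; summable  = Series⇒HasSeriesSum (series-finite n (λ k n≤k → trans (∣∣²-cong (c≈0 k n≤k)) (solve 0 (:0 :* :0 :+ :0 :* :0 := :0) refl)))
    }

  basis : ℕ → H²
  basis m = polynomial (suc m) (δ m) (λ k m<k → ℂR.reflexive (δ-distinct (λ m≡k → ℕ.<-irrefl m≡k m<k))) (e m)
    (λ z → seriesᶜ-unique (seriesᶜ-finite (suc m) (λ k m<k → ℂR.trans (ℂR.*-congʳ (ℂR.reflexive (δ-distinct (λ m≡k → ℕ.<-irrefl m≡k m<k)))) (ℂR.zeroˡ _)))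
                          (δ-expansion m z))

  basis-orthonormal : ∀ m n → ⟨ basis m , basis n ⟩≈ δ m n
  basis-orthonormal m n = Seriesᶜ⇒HasSeriesSum (seriesᶜ-cong (λ _ → ℂR.refl)
      (ℂR.trans (ℂR.*-congʳ (ℂR.reflexive (δ-same m))) (ℂR.trans (ℂR.*-identityˡ _) (conj-δ m n)))
      (single m _ (λ k k≢m → ℂR.trans (ℂR.*-congʳ (ℂR.reflexive (δ-distinct (k≢m ∘ ≡.sym)))) (ℂR.zeroˡ _))))
    where
    -0≈0 : - 0# ≈ 0#
    -0≈0 = solve 0 (:- :0 := :0) refl
    conj-δ : ∀ m n → conj (δ n m) ≈ᶜ δ m n
    conj-δ m n with n ℕ.≟ m
    ... | yes ≡.refl = ℂR.trans (refl , -0≈0) (ℂR.reflexive (≡.sym (δ-same n)))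
    ... | no n≢m     = ℂR.trans (refl , -0≈0) (ℂR.reflexive (≡.sym (δ-distinct (n≢m ∘ ≡.sym))))

  tail-coeff : ℕ → (ℕ → ℂ) → ℕ → ℂ
  tail-coeff n c k = [ (λ _ → c k) , (λ _ → 0ℂ) ]′ (ℕ.≤-<-connex n k)

  tail-above : ∀ {n} c k → n ℕ.≤ k → tail-coeff n c k ≡ c k
  tail-above {n} c k n≤k with ℕ.≤-<-connex n k
  ... | inj₁ _   = ≡.refl
  ... | inj₂ k<n = ⊥-elim (ℕ.<-irrefl ≡.refl (ℕ.<-≤-trans k<n n≤k))

  tail-below : ∀ {n} c k → k ℕ.< n → tail-coeff n c k ≡ 0ℂ
  tail-below {n} c k k<n with ℕ.≤-<-connex n k
  ... | inj₁ n≤k = ⊥-elim (ℕ.<-irrefl ≡.refl (ℕ.<-≤-trans k<n n≤k))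
  ... | inj₂ _   = ≡.refl

  remainder : H² → ℕ → H²
  remainder f n = record
    { fun       = λ z → fun f z -ᶜ ℂΣ.Σ[ upTo n ] (λ k → coeff f k *ᶜ e k z)
    ; coeff     = tail-coeff n (coeff f)
    ; expansion = λ z → Seriesᶜ⇒HasSeriesSum (seriesᶜ-cong (λ _ → ℂR.refl) (ℂR.+-congˡ (ℂR.-‿cong (ℂR.sym (Σ-upToᶜ n _))))
        (seriesᶜ-tail n (expansionᶜ f z)
          (λ k k<n → ℂR.trans (ℂR.*-congʳ (ℂR.reflexive (tail-below (coeff f) k k<n))) (ℂR.zeroˡ _))
          (λ k n≤k → ℂR.*-congʳ (ℂR.reflexive (tail-above (coeff f) k n≤k)))))
    ; ‖_‖²      = ‖ f ‖² - ∑ n (λ k → ∣ coeff f k ∣²)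
    ; summable  = Series⇒HasSeriesSum (series-tail n (HasSeriesSum⇒Series (summable f))
        (λ k k<n → trans (∣∣²-cong (ℂR.reflexive (tail-below (coeff f) k k<n))) (solve 0 (:0 :* :0 :+ :0 :* :0 := :0) refl))
        (λ k n≤k → ∣∣²-cong (ℂR.reflexive (tail-above (coeff f) k n≤k))))
    }

  basis-total : ∀ (f : H²) ε → 0# < ε → ∃[ n ] Σ[ t ∈ (ℕ → ℂ) ]
                ‖ (λ z → fun f z -ᶜ ℂΣ.Σ[ upTo n ] (λ k → t k *ᶜ fun (basis k) z)) ‖≤ ε
  basis-total f ε 0<ε =
    -- The remainder after n terms has squared norm ‖f‖² minus the n-th partial sum, hence the
    -- tolerance `ε * ε`.
    let n , close = near (HasSeriesSum⇒Series (summable f)) (ε * ε) (*-pos 0<ε 0<ε)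
    in n , coeff f , remainder f n , (λ z → ℂR.refl) , <⇒≤ 0<ε ,
       ≤-trans (≤-trans (x≤∣x∣ _) (≤-reflexive (∣x-y∣≈∣y-x∣ _ _))) (close n ℕ.≤-refl)

  basis-isOrthonormalBasis : IsOrthonormalBasis basis
  basis-isOrthonormalBasis = record { orthonormal = basis-orthonormal ; total = basis-total }

-- The operators 1 + A and the Riesz basis property

module Operators {c ℓ₁ ℓ₂ : Level} (ℝ : RealField c ℓ₁ ℓ₂)
  (a R : RealField.Carrier ℝ) (0<R : RealField._<_ ℝ (RealField.0# ℝ) R)
  (θ : RealField.Carrier ℝ) (0≤θ : RealField._≤_ ℝ (RealField.0# ℝ) θ) (θ<1 : RealField._<_ ℝ θ (RealField.1# ℝ)) where

  open ComplexNumbers ℝ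
  open Sequences ℝ
  open Limits ℝ ℕ-net
  open SeriesLemmas ℝ
  open ComplexSeries ℝ
  open Parts ℝ
  open Part
  open Hardy ℝ a R 0<R
  open HardySpace ℝ a R 0<R
  open DecayingMatrices ℝ θ 0≤θ θ<1
  open Geometric θ 0≤θ θ<1

  -- Only the series that defines A f is used below, not how its sum was found.
  record Image (A : Decaying) : Set (lsuc 0ℓ ⊔ c ⊔ ℓ₁ ⊔ ℓ₂) where
    field
      A·        : H² → ℕ → ℂ
      A·-series : ∀ f k → Seriesᶜ (λ m → ofℝ (entry A k m) *ᶜ coeff f m) (A· f k)

  image : ∀ A → Image A
  image A = record
    { A·        = λ f k → Apply.apply f re-part k +i Apply.apply f im-part k
    ; A·-series = λ f k → seriesᶜ-parts
        (series-cong (λ m → sym (re-ofℝ* _ (coeff f m))) refl (Apply.apply-series f re-part k))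
        (series-cong (λ m → sym (im-ofℝ* _ (coeff f m))) refl (Apply.apply-series f im-part k))
    }
    where
    module Apply (f : H²) (p : Part) = Action A {u = π p ∘ coeff f} (coeff-bound f p)

  module Construction (A : Decaying) (I : Image A) where
    open Image I

    module _ (f : H²) where
      private
        module Apply (p : Part) = Action A {u = π p ∘ coeff f} (coeff-bound f p)
        S = ‖ f ‖²
        X = 1# + S

        0≤X : 0# ≤ X
        0≤X = Apply.0≤X re-part

        A·≈apply : ∀ p k → π p (A· f k) ≈ Apply.apply p k
        A·≈apply p k = lim-unique (part-series (A·-series f k) p)
          (series-cong (λ m → sym (π-ofℝ* p _ (coeff f m))) refl (Apply.apply-series p k))

      private
        D = K A * X * γ

        0≤D : 0# ≤ D
        0≤D = 0≤* (0≤* (0≤K A) 0≤X) (<⇒≤ 0<γ)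

        A·-bound : ∀ p k → ∣ π p (A· f k) ∣ ≤ D * θ ^ k
        A·-bound p k = ≤-trans (≤-reflexive (∣∣-cong (A·≈apply p k))) (Apply.apply-bound p k)

        term : Disk → ℕ → ℂ
        term z k = A· f k *ᶜ e k z

        term-bound : ∀ z p k → ∣ π p (term z k) ∣ ≤ (2# * D) * θ ^ k
        term-bound z p k = ≤-trans (∣π[z*u]∣≤ p {A· f k} {e k z} (λ q → A·-bound q k) (λ q → ∣e∣≤1 q k z))
          (≤-reflexive (solve 2 (λ d t → :2 :* ((d :* t) :* :1) := (:2 :* d) :* t) refl D (θ ^ k)))

        term-sum : ∀ z p → Σ[ s ∈ Carrier ] Series (π p ∘ term z) s
        term-sum z p = dominated-series (2# * D) (term-bound z p)

        sum : Disk → ℂ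
        sum z = proj₁ (term-sum z re-part) +i proj₁ (term-sum z im-part)

        new : ℕ → ℂ
        new k = coeff f k +ᶜ A· f k

        new-expansion : ∀ z → Seriesᶜ (λ k → new k *ᶜ e k z) (fun f z +ᶜ sum z)
        new-expansion z = seriesᶜ-cong (λ k → ℂR.sym (ℂR.distribʳ (e k z) _ _)) ℂR.refl
          (seriesᶜ-+ (expansionᶜ f z) (seriesᶜ-parts (proj₂ (term-sum z re-part)) (proj₂ (term-sum z im-part))))

        -- |x + u|² - |x|² for the old coefficient x and its increment u. The squared norm must be
        -- an actual limit, for which bounded partial sums do not suffice; these differences decay
        -- geometrically, so their series converges.
        extra : ℕ → Carrier
        extra k = 2# * (re (coeff f k) * re (A· f k) + im (coeff f k) * im (A· f k)) + ∣ A· f k ∣²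

        extra-bound : ∀ k → ∣ extra k ∣ ≤ (2# * (X * D + X * D) + (D * D + D * D)) * θ ^ k
        extra-bound k = begin
          ∣ extra k ∣
            ≤⟨ ∣x+y∣≤ _ _ ⟩
          ∣ 2# * (re (coeff f k) * re (A· f k) + im (coeff f k) * im (A· f k)) ∣ + ∣ ∣ A· f k ∣² ∣
            ≤⟨ +-mono-≤ (≤-trans (≤-reflexive (∣c*x∣ _ (<⇒≤ 0<2))) (*-monoˡ-≤ (<⇒≤ 0<2)
                 (≤-trans (∣x+y∣≤ _ _) (+-mono-≤ (cross re-part) (cross im-part)))))
                 (≤-trans (≤-reflexive (∣∣-nonneg (0≤∣∣² (A· f k)))) (+-mono-≤ (square re-part) (square im-part))) ⟩
          2# * (X * (D * θ ^ k) + X * (D * θ ^ k)) + (D * D * θ ^ k + D * D * θ ^ k)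
            ≈⟨ solve 3 (λ x d t → :2 :* (x :* (d :* t) :+ x :* (d :* t)) :+ (d :* d :* t :+ d :* d :* t) :=
                 (:2 :* (x :* d :+ x :* d) :+ (d :* d :+ d :* d)) :* t) refl X D (θ ^ k) ⟩
          (2# * (X * D + X * D) + (D * D + D * D)) * θ ^ k ∎
          where
          open ≤-Reasoning
          cross : ∀ p → ∣ π p (coeff f k) * π p (A· f k) ∣ ≤ X * (D * θ ^ k)
          cross p = ≤-trans (≤-reflexive (∣x*y∣ (π p (coeff f k)) _))
            (*-mono-≤ (0≤∣∣ _) (coeff-bound f p k) (0≤∣∣ _) (A·-bound p k))
          square : ∀ p → π p (A· f k) * π p (A· f k) ≤ D * D * θ ^ k
          square p = ≤-trans (square≤-from-∣∣ (A·-bound p k)) (≤-trans (≤-reflexive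
              (solve 2 (λ d t → (d :* t) :* (d :* t) := (d :* d :* t) :* t) refl D (θ ^ k)))
            (≤-resp refl (*-identityʳ _) (*-monoˡ-≤ (0≤* (0≤* 0≤D 0≤D) (0≤^ k 0≤θ)) (^≤1 k 0≤θ (<⇒≤ θ<1)))))

        extra-sum : Σ[ s ∈ Carrier ] Series extra s
        extra-sum = dominated-series (2# * (X * D + X * D) + (D * D + D * D)) extra-bound

        new-summable : Series (λ k → ∣ new k ∣²) (S + proj₁ extra-sum)
        new-summable = series-cong (λ k → solve 4 (λ x y u v →
            (x :* x :+ y :* y) :+ (:2 :* (x :* u :+ y :* v) :+ (u :* u :+ v :* v)) := (x :+ u) :* (x :+ u) :+ (y :+ v) :* (y :+ v))
            refl (re (coeff f k)) (im (coeff f k)) (re (A· f k)) (im (A· f k))) refl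
          (series-+ (HasSeriesSum⇒Series (summable f)) (proj₂ extra-sum))

      apply : H²
      apply = record
        { fun       = λ z → fun f z +ᶜ sum z
        ; coeff     = new
        ; expansion = λ z → Seriesᶜ⇒HasSeriesSum (new-expansion z)
        ; ‖_‖²      = S + proj₁ extra-sum
        ; summable  = Series⇒HasSeriesSum new-summable
        }

      private
        κ = K A * K A * γ * S

        A·-square : ∀ k → ∣ A· f k ∣² ≤ (κ + κ) * θ ^ k
        A·-square k = ≤-trans (+-mono-≤
            (part-square re-part (λ n → ≤-trans (∑-mono n (λ m _ → re²≤∣∣² (coeff f m))) (partial≤‖‖² f n)))
            (part-square im-part (λ n → ≤-trans (∑-mono n (λ m _ → im²≤∣∣² (coeff f m))) (partial≤‖‖² f n))))
          (≤-reflexive (sym (distribʳ (θ ^ k) κ κ)))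
          where
          part-square : ∀ p → (∀ n → ∑ n (λ m → π p (coeff f m) * π p (coeff f m)) ≤ S) → π p (A· f k) * π p (A· f k) ≤ κ * θ ^ k
          part-square p h = ≤-trans (≤-reflexive (*-cong (A·≈apply p k) (A·≈apply p k))) (Apply.apply-square p h k)

        0≤κ : 0# ≤ κ
        0≤κ = 0≤* (0≤* (0≤* (0≤K A) (0≤K A)) (<⇒≤ 0<γ)) (0≤‖‖² f)

      -- The parallelogram inequality separates f from A f. One γ comes from Cauchy-Schwarz within
      -- each row, the other from summing θᵏ over the rows.
      apply-norm : ‖ apply ‖² ≤ (2# * (1# + 2# * (K A * K A * γ * γ))) * S
      apply-norm = series≤ (λ n → begin
          ∑ n (λ k → ∣ new k ∣²)
            ≤⟨ ∑-mono n (λ k _ → parallelogram (coeff f k) (A· f k)) ⟩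
          ∑ n (λ k → 2# * (∣ coeff f k ∣² + ∣ A· f k ∣²))
            ≈⟨ trans (∑-* n _ _) (*-congˡ (∑-+ n _ _)) ⟩
          2# * (∑ n (λ k → ∣ coeff f k ∣²) + ∑ n (λ k → ∣ A· f k ∣²))
            ≤⟨ *-monoˡ-≤ (<⇒≤ 0<2) (+-mono-≤ (partial≤‖‖² f n) (≤-trans (∑-mono n (λ k _ → A·-square k))
                 (≤-trans (≤-reflexive (∑-* n _ _)) (*-monoˡ-≤ (0≤+ 0≤κ 0≤κ) (∑θ^≤γ n))))) ⟩
          2# * (S + (κ + κ) * γ)
            ≈⟨ solve 3 (λ k g s → :2 :* (s :+ (k :* k :* g :* s :+ k :* k :* g :* s) :* g) := (:2 :* (:1 :+ :2 :* (k :* k :* g :* g))) :* s)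
                 refl (K A) γ S ⟩
          (2# * (1# + 2# * (K A * K A * γ * γ))) * S ∎)
        (HasSeriesSum⇒Series (summable apply))
        where
        open ≤-Reasoning
        parallelogram : ∀ z u → ∣ z +ᶜ u ∣² ≤ 2# * (∣ z ∣² + ∣ u ∣²)
        parallelogram z u = ≤-by (0≤∣∣² (z -ᶜ u)) (solve 4 (λ x y u v →
          :2 :* ((x :* x :+ y :* y) :+ (u :* u :+ v :* v)) :=
          ((x :+ u) :* (x :+ u) :+ (y :+ v) :* (y :+ v)) :+ ((x :- u) :* (x :- u) :+ (y :- v) :* (y :- v)))
          refl (re z) (im z) (re u) (im u))

  -- The operator with matrix 1 + A in the basis (eₘ).
  record Perturbed (A : Decaying) : Set (lsuc 0ℓ ⊔ c ⊔ ℓ₁ ⊔ ℓ₂) where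
    field
      A·          : H² → ℕ → ℂ
      A·-series   : ∀ f k → Seriesᶜ (λ m → ofℝ (entry A k m) *ᶜ coeff f m) (A· f k)
      apply       : H² → H²
      apply-coeff : ∀ f k → coeff (apply f) k ≈ᶜ coeff f k +ᶜ A· f k
      apply-norm  : ∀ f → ‖ apply f ‖² ≤ (2# * (1# + 2# * (K A * K A * γ * γ))) * ‖ f ‖²

  perturbed : ∀ A → Perturbed A
  perturbed A = record
    { A·          = Image.A· (image A)
    ; A·-series   = Image.A·-series (image A)
    ; apply       = Construction.apply A (image A)
    ; apply-coeff = λ f k → ℂR.refl
    ; apply-norm  = Construction.apply-norm A (image A)
    }

  module Perturbation {A : Decaying} (T : Perturbed A) where
    open Perturbed T public

    apply-linear : ∀ t f g h → fun h ≗ (λ z → t *ᶜ fun f z +ᶜ fun g z) →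
                   fun (apply h) ≗ (λ z → t *ᶜ fun (apply f) z +ᶜ fun (apply g) z)
    apply-linear t f g h eq = fun-determined {apply h} λ z → seriesᶜ-cong (λ k → ℂR.*-congʳ (ℂR.sym (coefficients k))) ℂR.refl
      (linear-combination t (apply f) (apply g) z)
      where
      coeff-h = coeff-linear t f g h eq
      A·-linear : ∀ k → A· h k ≈ᶜ t *ᶜ A· f k +ᶜ A· g k
      A·-linear k = seriesᶜ-unique (A·-series h k) (seriesᶜ-cong
        (λ m → ℂR.trans (ℂS.solve 4 (λ t a x y → t ℂS.:* (a ℂS.:* x) ℂS.:+ a ℂS.:* y ℂS.:= a ℂS.:* (t ℂS.:* x ℂS.:+ y)) ℂR.refl
            t (ofℝ (entry A k m)) (coeff f m) (coeff g m)) (ℂR.*-congˡ (ℂR.sym (coeff-h m))))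
        ℂR.refl (seriesᶜ-+ (seriesᶜ-* t (A·-series f k)) (A·-series g k)))
      coefficients : ∀ k → coeff (apply h) k ≈ᶜ t *ᶜ coeff (apply f) k +ᶜ coeff (apply g) k
      coefficients k = ℂR.trans (ℂR.trans (apply-coeff h k) (ℂR.+-cong (coeff-h k) (A·-linear k)))
        (ℂR.trans (ℂS.solve 5 (λ t x y u v → (t ℂS.:* x ℂS.:+ y) ℂS.:+ (t ℂS.:* u ℂS.:+ v) ℂS.:= t ℂS.:* (x ℂS.:+ u) ℂS.:+ (y ℂS.:+ v)) ℂR.refl
            t (coeff f k) (coeff g k) (A· f k) (A· g k))
          (ℂR.sym (ℂR.+-cong (ℂR.*-congˡ (apply-coeff f k)) (apply-coeff g k))))

    operator : BoundedOperator
    operator = record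
      { op      = apply
      ; linear  = apply-linear
      -- M bounds the square of the norm; (1 + M)² ≥ M replaces the root of M.
      ; bound   = 1# + M
      ; 0≤bound = 0≤+ 0≤1 0≤M
      ; bounded = λ f → ≤-trans (apply-norm f) (*-monoʳ-≤ (0≤‖‖² f) (≤-by (0≤+ 0≤1 (0≤+ 0≤M (0≤square M)))
          (solve 1 (λ m → (:1 :+ m) :* (:1 :+ m) := m :+ (:1 :+ (m :+ m :* m))) refl M)))
      }
      where
      M = 2# * (1# + 2# * (K A * K A * γ * γ))
      0≤M : 0# ≤ M
      0≤M = 0≤* (<⇒≤ 0<2) (0≤+ 0≤1 (0≤* (<⇒≤ 0<2) (0≤* (0≤* (0≤* (0≤K A) (0≤K A)) (<⇒≤ 0<γ)) (<⇒≤ 0<γ))))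

    apply-basis : ∀ m z → fun (apply (basis m)) z ≈ᶜ e m z +ᶜ ∑ᶜ m (λ k → ofℝ (entry A k m) *ᶜ e k z)
    apply-basis m z = fun-determined {apply (basis m)} {λ z → e m z +ᶜ ∑ᶜ m (λ k → ofℝ (entry A k m) *ᶜ e k z)} (λ z → seriesᶜ-cong
      (λ k → ℂR.trans (ℂR.sym (ℂR.distribʳ (e k z) _ _)) (ℂR.*-congʳ (ℂR.sym (ℂR.trans (apply-coeff (basis m) k) (ℂR.+-congˡ (column k)))))) ℂR.refl
      (seriesᶜ-+ (δ-expansion m z) (seriesᶜ-finite m (λ k m≤k → ℂR.trans (ℂR.*-congʳ (ofℝ-cong (upper A m≤k))) (ℂR.zeroˡ _))))) z
      where
      column : ∀ k → A· (basis m) k ≈ᶜ ofℝ (entry A k m)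
      column k = seriesᶜ-unique (A·-series (basis m) k) (seriesᶜ-cong (λ _ → ℂR.refl)
        (ℂR.trans (ℂR.*-congˡ (ℂR.reflexive (δ-same m))) (ℂR.*-identityʳ _))
        (single m (λ j → ofℝ (entry A k j) *ᶜ δ m j) (λ j j≢m → ℂR.trans (ℂR.*-congˡ (ℂR.reflexive (δ-distinct (j≢m ∘ ≡.sym)))) (ℂR.zeroʳ _))))


  -- Expanding, (1 + A)(f + B f) = f + B f + A f + A (B f), and the last term is -(A f + B f) by
  -- `Composition`.
  inverse-composition : ∀ {A B} (I : Perturbed A) (J : Perturbed B) → RightInverse A B →
    let module PA = Perturbed I
        module PB = Perturbed J
    in ∀ f → fun (PA.apply (PB.apply f)) ≗ fun f
  inverse-composition {A} {B} I J AB f = fun-determined {PA.apply (PB.apply f)} λ z →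
    seriesᶜ-cong (λ k → ℂR.*-congʳ (ℂR.sym (cancel k))) ℂR.refl (expansionᶜ f z)
    where
    module PA = Perturbed I
    module PB = Perturbed J
    AB· : ∀ p k → Series (λ j → entry A k j * π p (PB.A· f j)) (- (π p (PA.A· f k) + π p (PB.A· f k)))
    AB· p k = series-cong (λ j → *-congˡ (identify J j)) (-‿cong (+-cong (identify I k) (identify J k)))
      (Composition.apply-apply A B AB {u = π p ∘ coeff f} (coeff-bound f p) k)
      where
      -- `Perturbed` exposes only the defining series of its sum, so the two forms of that sum agree
      -- by uniqueness of limits.
      identify : ∀ {C} (L : Perturbed C) j → Action.apply C {u = π p ∘ coeff f} (coeff-bound f p) j ≈ π p (Perturbed.A· L f j)
      identify {C} L j = lim-unique (series-cong (λ m → sym (π-ofℝ* p _ (coeff f m))) refl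
        (Action.apply-series C {u = π p ∘ coeff f} (coeff-bound f p) j)) (part-series (Perturbed.A·-series L f j) p)
    part-cancel : ∀ p k → π p (PA.A· (PB.apply f) k) ≈ - π p (PB.A· f k)
    part-cancel p k = trans (lim-unique (part-series (PA.A·-series (PB.apply f) k) p) (series-cong
        (λ m → trans (sym (distribˡ (entry A k m) _ _)) (trans (*-congˡ (trans (reflexive (≡.sym (π-+ p (coeff f m) (PB.A· f m)))) (π-cong p (ℂR.sym (PB.apply-coeff f m))))) (sym (π-ofℝ* p _ _))))
        refl (series-+ (series-cong (λ m → π-ofℝ* p _ (coeff f m)) refl (part-series (PA.A·-series f k) p)) (AB· p k))))
      (solve 2 (λ x y → x :+ :- (x :+ y) := :- y) refl (π p (PA.A· f k)) (π p (PB.A· f k)))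
    cancel : ∀ k → coeff (PA.apply (PB.apply f)) k ≈ᶜ coeff f k
    cancel k = ℂR.trans (ℂR.trans (PA.apply-coeff (PB.apply f) k)
        (ℂR.+-cong (PB.apply-coeff f k) (part-cancel re-part k , part-cancel im-part k)))
      (ℂS.solve 2 (λ x y → (x ℂS.:+ y) ℂS.:+ ℂS.:- y ℂS.:= x) ℂR.refl (coeff f k) (PB.A· f k))

  module _ (A : Decaying) (φ : ℕ → Fun)
           (φ-expansion : ∀ m z → φ m z ≈ᶜ e m z +ᶜ ∑ᶜ m (λ k → ofℝ (entry A k m) *ᶜ e k z)) where

    private
      module RieszBasis (I : Perturbed A) (J : Perturbed (inverse-matrix A)) where
        module T  = Perturbation I
        module T⁻ = Perturbation J

        isRieszBasis : IsRieszBasis φ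
        isRieszBasis = basis , T.operator , basis-isOrthonormalBasis ,
          record { inv      = T⁻.operator
                 ; inverseˡ = inverse-composition J I (inverse-left A)
                 ; inverseʳ = inverse-composition I J (inverse-right A) } ,
          λ m z → ℂR.trans (T.apply-basis m z) (ℂR.sym (φ-expansion m z))

    perturbed-basis-isRieszBasis : IsRieszBasis φ
    perturbed-basis-isRieszBasis = RieszBasis.isRieszBasis (perturbed A) (perturbed (inverse-matrix A))

    perturbed-basis-close : ExponentiallyClose φ e
    perturbed-basis-close = C , θ , 0≤θ , θ<1 , λ m → difference m , (λ z → ℂR.refl) , 0≤* 0≤C (0≤^ m 0≤θ) , norm m
      where
      -- The squared norm is at most K² θ²ᵐ Σ θᵏ ≤ K² θ²ᵐ γ, and (1 + γ)² ≥ γ again avoids a root.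
      C = K A * (1# + γ)
      0≤C : 0# ≤ C
      0≤C = 0≤* (0≤K A) (0≤+ 0≤1 (<⇒≤ 0<γ))
      difference : ℕ → H²
      difference m = polynomial m (λ k → ofℝ (entry A k m)) (λ k m≤k → ofℝ-cong (upper A m≤k)) (λ z → φ m z -ᶜ e m z)
        (λ z → ℂR.sym (ℂR.trans (ℂR.+-congʳ (φ-expansion m z)) (ℂS.solve 2 (λ x y → (x ℂS.:+ y) ℂS.:- x ℂS.:= y) ℂR.refl (e m z) _)))
      norm : ∀ m → ‖ difference m ‖² ≤ (C * θ ^ m) * (C * θ ^ m)
      norm m = begin
        ∑ m (λ k → ∣ ofℝ (entry A k m) ∣²)
          ≤⟨ ∑-mono m (λ k _ → term k) ⟩
        ∑ m (λ k → (K A * θ ^ m) * (K A * θ ^ m) * θ ^ k)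
          ≈⟨ ∑-* m _ _ ⟩
        (K A * θ ^ m) * (K A * θ ^ m) * ∑ m (θ ^_)
          ≤⟨ *-monoˡ-≤ (0≤square _) (≤-trans (∑θ^≤γ m) (≤-by (0≤+ 0≤1 (0≤+ (<⇒≤ 0<γ) (0≤square γ)))
               (solve 1 (λ m → (:1 :+ m) :* (:1 :+ m) := m :+ (:1 :+ (m :+ m :* m))) refl γ))) ⟩
        (K A * θ ^ m) * (K A * θ ^ m) * ((1# + γ) * (1# + γ))
          ≈⟨ solve 3 (λ k t g → (k :* t) :* (k :* t) :* (g :* g) := ((k :* g) :* t) :* ((k :* g) :* t)) refl (K A) (θ ^ m) (1# + γ) ⟩
        (C * θ ^ m) * (C * θ ^ m) ∎
        where
        open ≤-Reasoning
        term : ∀ k → ∣ ofℝ (entry A k m) ∣² ≤ (K A * θ ^ m) * (K A * θ ^ m) * θ ^ k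
        term k = begin
          ∣ ofℝ (entry A k m) ∣²  ≈⟨ solve 1 (λ x → x :* x :+ :0 :* :0 := x :* x) refl (entry A k m) ⟩
          entry A k m * entry A k m  ≤⟨ square≤-from-∣∣ (bound A k m) ⟩
          (K A * (θ ^ k * θ ^ m)) * (K A * (θ ^ k * θ ^ m))  ≈⟨ solve 3 (λ K p q → (K :* (p :* q)) :* (K :* (p :* q)) := ((K :* q) :* (K :* q) :* p) :* p)
                                                                   refl (K A) (θ ^ k) (θ ^ m) ⟩
          ((K A * θ ^ m) * (K A * θ ^ m) * θ ^ k) * θ ^ k     ≤⟨ ≤-resp refl (*-identityʳ _)
                                                                   (*-monoˡ-≤ (0≤* (0≤square _) (0≤^ k 0≤θ)) (^≤1 k 0≤θ (<⇒≤ θ<1))) ⟩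
          (K A * θ ^ m) * (K A * θ ^ m) * θ ^ k  ∎

proposition10 : ∀ {c ℓ₁ ℓ₂} (ℝ : RealField c ℓ₁ ℓ₂) (b : ℕ) (1<b : 1 ℕ.< b) (w : List (Fin b)) → w ≢ [] →
    let open RealField ℝ
        open Complex ℝ using (MonicPoly)
        open Complex ℝ using (eval)
        open Words b w
        open Setting ℝ b 1<b w
    in
    (g_w : Word) (shortest : IsShortest𝒢 g_w) →
    (x_w : Carrier) → HasDigits x_w (periodic g_w (proj₁ (proj₁ shortest))) →
    (Λ : ℕ → Carrier) → (∀ n → 1 ℕ.≤ n → Isλ n (Λ n)) →
    (𝓑 : ∀ m → MonicPoly m) → (∀ m → IsEigenfunction (Λ (suc m)) (eval (𝓑 m))) →
    (R : Carrier) (R_w<R : x_w ∨ (1# - x_w) < R) →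
    let open Hardy ℝ x_w R (max[x,1-x]<R⇒0<R R_w<R)
    in
    ExponentiallyClose (normalized 𝓑) e × IsRieszBasis (normalized 𝓑)
proposition10 ℝ b 1<b w w≢[] g_w shortest x_w digits Λ isΛ 𝓑 eigen R R_w<R =
  perturbed-basis-close A (normalized 𝓑) normalized-expansion , perturbed-basis-isRieszBasis A (normalized 𝓑) normalized-expansion
  where
  open EigenvalueEquation ℝ b 1<b w w≢[] g_w shortest x_w digits Λ isΛ R R_w<R
  open Eigenpolynomials 𝓑 eigen
  0<R = RealField.max[x,1-x]<R⇒0<R ℝ R_w<R
  open Hardy ℝ x_w R 0<R using (normalized)
  open Operators ℝ x_w R 0<R θ 0≤θ θ<1
  A : DecayingMatrices.Decaying ℝ θ 0≤θ θ<1
  A = record { entry = N ; K = K ; 0≤K = 0≤K ; bound = N-bound ; upper = N-upper }
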